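{- Let $k\ge1$, $m\ge1$, let $1\le t_1,\dots,t_m\le k$ be distinct integers, $a_1,\dots,a_m$ positive integers, $P=R_{t_1}^{a_1}\cup\cdots\cup R_{t_m}^{a_m}$ and $Q=R_{t_1}\cup\cdots\cup R_{t_m}$. Then for every $\lambda\in\mathcal P^k$, $$\frac{g^{(k)}_{P\cup\lambda}}{g^{(k)}_P}=\frac{g^{(k)}_{Q\cup\lambda}}{g^{(k)}_Q}.$$
   Context: Partitions are identified with Young diagrams in French notation (cells $(i,j)$ with $j\le\lambda_i$, row $i$ from the bottom); $\lambda'$ is the conjugate; $\lambda\cup\mu$ is the partition whose multiset of parts is the union of those of $\lambda$ and $\mu$. $\mathcal P^k$ is the set of partitions with $\lambda_1\le k$. For $1\le t\le k$, $R_t=(t^{k+1-t})$ and $R_t^a$ is the union of $a$ copies of $R_t$. The hook length of $c=(i,j)\in\lambda$ is $\lambda_i+\lambda'_j-i-j+1$. A $(k+1)$-core has no cell of hook length $k+1$; $|\kappa|_{k+1}$ is its number of cells of hook length $<k+1$. The map $\mathfrak p(\kappa)_i=\#\{j:(i,j)\in\kappa,\ \text{hook length}\le k\}$ is a bijection from $(k+1)$-cores to $\mathcal P^k$ with inverse $\mathfrak c$. The residue of $(i,j)$ is $j-i\bmod(k+1)$. For $(k+1)$-cores $\tau\subset\kappa$, $\kappa/\tau$ is a weak $r$-strip if it is a horizontal strip, $|\kappa|_{k+1}=|\tau|_{k+1}+r$, and its cells have exactly $r$ distinct residues. A removable corner of $\mu$ is $(i,j)\in\mu$ with $(i+1,j),(i,j+1)\notin\mu$;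 $(i,j)$ is $\lambda$-blocked if $(i+1,j)\in\lambda$; $r_{\lambda\mu}$ is the number of distinct residues of non-$\lambda$-blocked removable corners of $\mu$. $h_r$ are the complete homogeneous symmetric functions ($h_0=1$), $\Lambda^{(k)}=\mathbb Z[h_1,\dots,h_k]$; $\binom ab=0$ for $b<0$. The $K$-$k$-Schur functions $\{g^{(k)}_\lambda\}_{\lambda\in\mathcal P^k}$ are the unique elements of $\Lambda^{(k)}$ with $g^{(k)}_\emptyset=1$ and, for $\lambda\in\mathcal P^k$, $0\le r\le k$, $$h_r\,g^{(k)}_\lambda=\sum_{s=0}^{r}(-1)^{r-s}\sum_{\mu\in\mathcal P^k:\ \mathfrak c(\mu)/\mathfrak c(\lambda)\text{ weak }s\text{ -strip}}\binom{r_{\mathfrak c(\mu)\mathfrak c(\lambda)}}{r-s}g^{(k)}_\mu .$$ Quotients are taken in the fraction field of $\Lambda^{(k)}$ (they lie in $\Lambda^{(k)}$). -}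

module Defs where

open import Data.Bool using (Bool; true; false; if_then_else_)
open import Data.Nat as ℕ using (ℕ; zero; suc; _∸_; _≤_; _<_; _≤?_; _<?_; _≤ᵇ_)
open import Data.Nat.DivMod using (_%_)
open import Data.Nat.Combinatorics using (_C_)
open import Data.Integer as ℤ using (ℤ; +_)
open import Data.Fin using (Fin; _≟_)
open import Data.List as List using (List; []; _∷_; length; map; concatMap; upTo; filter; deduplicate; replicate; foldr; concat)
open import Data.List.Relation.Unary.All using (All)
open import Data.List.Relation.Unary.Linked using (Linked)
open import Data.List.Relation.Unary.Unique.Propositional using (Unique)
open import Data.List.Membership.Propositional using (_∈_)
open import Data.Vec as Vec using (Vec; []; _∷_; zipWith; tabulate)
open import Data.Vec.Properties using (≡-dec)
open import Data.Product using (Σ; ∃; _×_; _,_)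
open import Function.Bundles using (_⇔_)
open import Relation.Nullary using (¬_)
open import Relation.Nullary.Decidable using (⌊_⌋; does)
open import Relation.Binary.PropositionalEquality using (_≡_; _≢_)

-- The ring Λ^(k) = ℤ[h₁,…,h_k] as polynomials in k variables.
-- An element is a coefficient function on exponent vectors
-- (finitely supported: see IsPoly); equality is pointwise.

Poly : ℕ → Set
Poly k = Vec ℕ k → ℤ

IsPoly : ∀ {k} → Poly k → Set
IsPoly {k} f = Σ ℕ λ N → (e : Vec ℕ k) → N < Vec.sum e → f e ≡ + 0

_≈P_ : ∀ {k} → Poly k → Poly k → Set
f ≈P g = ∀ e → f e ≡ g e

infix 4 _≈P_
infixl 6 _+P_
infixl 7 _*P_ _•P_

sumℤ : List ℤ → ℤ
sumℤ = foldr ℤ._+_ (+ 0)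

divs : ∀ {n} → Vec ℕ n → List (Vec ℕ n)
divs [] = [] ∷ []
divs (x ∷ e) = concatMap (λ i → map (i ∷_) (divs e)) (upTo (suc x))

_+P_ : ∀ {k} → Poly k → Poly k → Poly k
(f +P g) e = f e ℤ.+ g e

_*P_ : ∀ {k} → Poly k → Poly k → Poly k
(f *P g) e = sumℤ (map (λ d → f d ℤ.* g (zipWith _∸_ e d)) (divs e))

_•P_ : ∀ {k} → ℤ → Poly k → Poly k
(c •P f) e = c ℤ.* f e

zeroP : ∀ {k} → Poly k
zeroP e = + 0

sumP : ∀ {k} → List (Poly k) → Poly k
sumP = foldr _+P_ zeroP

mono : ∀ {k} → Vec ℕ k → Poly k
mono u e = if ⌊ ≡-dec ℕ._≟_ e u ⌋ then + 1 else + 0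

oneP : ∀ {k} → Poly k
oneP {k} = mono (Vec.replicate k 0)

unitVec : ∀ {k} → Fin k → Vec ℕ k
unitVec i = tabulate (λ j → if ⌊ j ≟ i ⌋ then 1 else 0)

-- h_r : h_0 = 1, h_r (1 ≤ r ≤ k) is the r-th variable.
-- (For r > k we return 0; this case is never used.)
hP : (k r : ℕ) → Poly k
hP k zero = oneP
hP k (suc r) with r <? k
... | Relation.Nullary.yes p = mono (unitVec (Data.Fin.fromℕ< p))
... | Relation.Nullary.no _ = zeroP

-- Partitions: weakly decreasing lists of positive integers
-- (row i, 0-indexed, is the i-th entry; French notation).

Partition : Set
Partition = List ℕ

IsPartition : Partition → Set
IsPartition λ′ = All (0 <_) λ′ × Linked (λ a b → b ≤ a) λ′

InPk : ℕ → Partition → Set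
InPk k λ′ = IsPartition λ′ × All (_≤ k) λ′

row : Partition → ℕ → ℕ
row [] i = 0
row (x ∷ xs) zero = x
row (x ∷ xs) (suc i) = row xs i

col : Partition → ℕ → ℕ
col λ′ j = length (filter (j <?_) λ′)

insert : ℕ → List ℕ → List ℕ
insert x [] = x ∷ []
insert x (y ∷ ys) = if y ≤ᵇ x then x ∷ y ∷ ys else y ∷ insert x ys

_∪_ : Partition → Partition → Partition
xs ∪ ys = foldr insert ys xs

Rpow : (k t a : ℕ) → Partition
Rpow k t a = replicate (a ℕ.* (suc k ∸ t)) t

R : (k t : ℕ) → Partition
R k t = Rpow k t 1

⋃ : List Partition → Partition
⋃ = foldr _∪_ []

-- Cells, hooks, cores (cells (i,j) are 0-indexed: (i+1,j+1) in the paper)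

Cell : Set
Cell = ℕ × ℕ

cellsFrom : ℕ → Partition → List Cell
cellsFrom i [] = []
cellsFrom i (x ∷ xs) = map (λ j → (i , j)) (upTo x) List.++ cellsFrom (suc i) xs

cells : Partition → List Cell
cells = cellsFrom 0

-- hook length λ_i + λ'_j − i − j + 1 (1-indexed) = λ_i + λ'_j − i₀ − j₀ − 1
hook : Partition → Cell → ℕ
hook κ (i , j) = (row κ i ℕ.+ col κ j) ∸ (i ℕ.+ j ℕ.+ 1)

IsCore : ℕ → Partition → Set
IsCore k κ = All (λ c → hook κ c ≢ suc k) (cells κ)

size≤ : ℕ → Partition → ℕ
size≤ k κ = length (filter (λ c → hook κ c ≤? k) (cells κ))

pRows : ℕ → Partition → ℕ → Partition → List ℕ
pRows k κ i [] = []
pRows k κ i (x ∷ xs) =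
  length (filter (λ j → hook κ (i , j) ≤? k) (upTo x)) ∷ pRows k κ (suc i) xs

𝔭 : ℕ → Partition → Partition
𝔭 k κ = filter (0 <?_) (pRows k κ 0 κ)

-- residue (j − i) mod (k+1), computed as (j + i·k) mod (k+1)
residue : ℕ → Cell → ℕ
residue k (i , j) = (j ℕ.+ i ℕ.* k) % suc k

#residues : ℕ → List Cell → ℕ
#residues k cs = length (deduplicate ℕ._≟_ (map (residue k) cs))

Contained : Partition → Partition → Set
Contained τ κ = ∀ i → row τ i ≤ row κ i

Horizontal : Partition → Partition → Set
Horizontal τ κ = ∀ j → col κ j ≤ suc (col τ j)

skewCells : Partition → Partition → List Cell
skewCells κ τ = filter (λ c → row τ (Data.Product.proj₁ c) ≤? Data.Product.proj₂ c) (cells κ)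

WeakStrip : ℕ → Partition → Partition → ℕ → Set
WeakStrip k τ κ r =
  Contained τ κ × Horizontal τ κ ×
  (size≤ k κ ≡ size≤ k τ ℕ.+ r) × (#residues k (skewCells κ τ) ≡ r)

-- non-λ-blocked removable corners of μ (row i, column μ_i − 1)
freeCorners : Partition → Partition → List Cell
freeCorners λ′ μ = go 0 μ
  where
  go : ℕ → List ℕ → List Cell
  go i [] = []
  go i (zero ∷ xs) = go (suc i) xs
  go i (suc j ∷ xs) =
    if (row μ (suc i) ≤ᵇ j) Data.Bool.∧ (row λ′ (suc i) ≤ᵇ j)
    then (i , j) ∷ go (suc i) xs else go (suc i) xs

rr : ℕ → Partition → Partition → ℕ
rr k λ′ μ = #residues k (freeCorners λ′ μ)

sign : ℕ → ℤ
sign zero = + 1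
sign (suc n) = ℤ.- sign n

-- Pieri rule defining the K-k-Schur functions.
-- For λ ∈ 𝒫^k with core τ = 𝔠(λ), and 0 ≤ r ≤ k, and any duplicate-free
-- list L enumerating exactly the (k+1)-cores κ such that κ/τ is a weak
-- s-strip for some s ≤ r (these are the 𝔠(μ), μ ∈ 𝒫^k), we require
--   h_r g_λ = Σ_{κ ∈ L} (-1)^{r-s} binom(r_{κτ}, r-s) g_{𝔭(κ)},
-- where s = |κ|_{k+1} − |τ|_{k+1}.

IsCoreOf : ℕ → Partition → Partition → Set
IsCoreOf k λ′ τ = IsPartition τ × IsCore k τ × 𝔭 k τ ≡ λ′

PieriTerm : (k r : ℕ) → (Partition → Poly k) → Partition → Partition → Poly k
PieriTerm k r g τ κ =
  let s = size≤ k κ ∸ size≤ k τ in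
  (sign (r ∸ s) ℤ.* (+ (rr k κ τ C (r ∸ s)))) •P g (𝔭 k κ)

IsKkSchur : (k : ℕ) → (Partition → Poly k) → Set
IsKkSchur k g =
  ((λ′ : Partition) → IsPoly (g λ′)) ×
  (g [] ≈P oneP) ×
  ((λ′ : Partition) → InPk k λ′ → (r : ℕ) → r ≤ k →
   (τ : Partition) → IsCoreOf k λ′ τ →
   (L : List Partition) → Unique L →
   (∀ κ → κ ∈ L ⇔ (IsPartition κ × IsCore k κ × Σ ℕ λ s → s ≤ r × WeakStrip k τ κ s)) →
   hP k r *P g λ′ ≈P sumP (map (PieriTerm k r g τ) L))

{-# OPTIONS --safe #-}
module Submission where


-- Put n = k + 1. The boundary of a partition is a Maya diagram on ℕ, and the
-- partition is an n-core exactly when x + n is a gap whenever x is one. A core is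
-- therefore given by the lowest gaps v₀ < … < v_k of the residue classes mod n, and
-- column t of 𝔭 (core v) has height equal to the number of beads above v_t.
--
-- For a horizontal strip of cores the size |·|_n grows by the number of classes
-- whose lowest gap moves, while the residues of the strip are the classes in which
-- some gap moves. Hence weak strips correspond to the sets A of classes such that
-- every class of A is below (in the order of the v_i) the first class outside A
-- preceding it cyclically; the strip adds to 𝔭 (core v) one cell in each column
-- t ∈ A. Adding k-rectangles replaces v_i by v_i + n F(i) with F monotone. This
-- changes neither residues nor order, so it commutes with the moves, and the number
-- of unblocked corners depends only on where F jumps, that is on the set of the
-- t_i but not on their multiplicities. So λ ↦ g (P ∪ λ) g Q and λ ↦ g (Q ∪ λ) g P
-- satisfy the same Pieri recursion with the same value at ∅. The recursion
-- determines the family: multiplying the ν-th term by h_r produces the term of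
-- r ∷ ν with coefficient 1, and otherwise terms of smaller size or of the same size
-- with a longer first row.

open import Defs
open import Data.Bool as Bool using (Bool; true; false; if_then_else_; _∧_; T)
open import Data.Bool.Properties using (T-∧)
open import Data.Nat using (ℕ; zero; suc; _+_; _*_; _∸_; _≤_; _<_; z≤n; s≤s; _≤?_; _<?_; _≟_; _≤ᵇ_; >-nonZero)
open import Data.Nat.Combinatorics using (_C_)
open import Data.Nat.DivMod
open import Data.Nat.Divisibility using (n∣m*n)
open import Data.Nat.Properties
import Data.Nat.Tactic.RingSolver as ℕ-Solver
open import Data.Integer as ℤ using (ℤ)
import Data.Integer.Properties as ℤₚ
import Data.Integer.Tactic.RingSolver as ℤ-Solver
open import Algebra.Properties.AbelianGroup ℤₚ.+-0-abelianGroup using (∙-cancelˡ; ∙-cancelʳ)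
open import Data.Fin as Fin using (Fin; toℕ; fromℕ<)
open import Data.Fin.Properties using (pigeonhole; toℕ<n; fromℕ<-injective)
open import Data.List using (List; []; _∷_; _++_; length; map; concatMap; filter; upTo; applyUpTo; replicate; tabulate; deduplicate)
open import Data.List.Properties using (map-++; map-∘; map-cong; map-applyUpTo; filter-++; filter-accept; filter-reject; length-++; length-map)
open import Data.List.Relation.Unary.All as All using (All; []; _∷_)
open import Data.List.Relation.Unary.All.Properties using (all-filter; replicate⁺)
open import Data.List.Relation.Unary.AllPairs as AllPairs using (AllPairs; []; _∷_)
import Data.List.Relation.Unary.AllPairs.Properties as AllPairsₚ
open import Data.List.Relation.Unary.Any using (here; there)
open import Data.List.Relation.Unary.Linked using ([]; [-]; _∷_)
open import Data.List.Relation.Unary.Unique.Propositional using (Unique)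
open import Data.List.Relation.Unary.Unique.DecPropositional.Properties _≟_ using (deduplicate-!)
open import Data.List.Membership.Propositional using (_∈_)
open import Data.List.Membership.Propositional.Properties using (∈-++⁺ˡ; ∈-++⁺ʳ; ∈-++⁻; ∈-map⁺; ∈-map⁻; ∈-upTo⁺; ∈-upTo⁻; ∈-filter⁺; ∈-filter⁻; ∈-deduplicate⁺; ∈-deduplicate⁻; ∈-∃++)
open import Data.Vec using ([]; _∷_; zipWith)
open import Data.Product using (_×_; _,_; proj₁; proj₂; ∃; Σ)
open import Data.Sum using (_⊎_; inj₁; inj₂)
open import Data.Empty using (⊥; ⊥-elim)
open import Function using (_∘_; id; Equivalence; _⇔_; mk⇔)
open import Relation.Nullary using (¬_; Dec; yes; no; does)
open import Relation.Nullary.Decidable using (_×-dec_; _⊎-dec_; _→-dec_; map′)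
open import Relation.Binary.PropositionalEquality

-- The Pieri rule accepts any core `τ` with `𝔭 k τ` the given partition and any duplicate-free list
-- of its weak strips, so `𝔠` is never inverted: `windowOf` builds one core for each bounded
-- partition and `Pieri.strips` one list. The burden is the completeness of that list. It comes from
-- playing the two numerical conditions of a weak strip against each other: the size sees only moved
-- lowest gaps, the residues see every class with a moved gap, and equality of the two numbers
-- forces the lowest gap to move in each class that moves at all. Positions are natural numbers,
-- although a Maya diagram extends to both sides. Windows therefore keep their lowest gap away from
-- 0: `1 ≤ v 0` leaves room for a step to the left, and `n ≤ v 0` ensures that a bead `x` with a gap
-- below it has a position `x - n`, which is needed to read off `𝔭`. The two recursions can be
-- compared term by term because whether a set `A` may move depends on `idx` alone, so that the
-- Pieri sums for `P ∪ μ` and `Q ∪ μ` run over the same list `moves k idx r`.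

-- Polynomial multiplication as iterated convolution

conv : ℕ → (ℕ → ℕ → ℤ) → ℤ
conv zero F = F 0 0
conv (suc x) F = F 0 (suc x) ℤ.+ conv x (λ i j → F (suc i) j)

conv-cong : ∀ x {F G : ℕ → ℕ → ℤ} → (∀ i j → F i j ≡ G i j) → conv x F ≡ conv x G
conv-cong zero h = h 0 0
conv-cong (suc x) h = cong₂ ℤ._+_ (h 0 (suc x)) (conv-cong x (λ i → h (suc i)))

conv-+ : ∀ x (F G : ℕ → ℕ → ℤ) → conv x (λ i j → F i j ℤ.+ G i j) ≡ conv x F ℤ.+ conv x G
conv-+ zero F G = refl
conv-+ (suc x) F G =
  trans (cong (λ z → (F 0 (suc x) ℤ.+ G 0 (suc x)) ℤ.+ z)
              (conv-+ x (λ i j → F (suc i) j) (λ i j → G (suc i) j)))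
        (interchange (F 0 (suc x)) (G 0 (suc x)) _ _)
  where
  interchange : ∀ a b c d → (a ℤ.+ b) ℤ.+ (c ℤ.+ d) ≡ (a ℤ.+ c) ℤ.+ (b ℤ.+ d)
  interchange = ℤ-Solver.solve-∀

conv-last : ∀ x (F : ℕ → ℕ → ℤ) →
  conv (suc x) F ≡ conv x (λ i j → F i (suc j)) ℤ.+ F (suc x) 0
conv-last zero F = refl
conv-last (suc x) F =
  trans (cong (λ z → F 0 (suc (suc x)) ℤ.+ z) (conv-last x (λ i j → F (suc i) j)))
        (sym (ℤₚ.+-assoc (F 0 (suc (suc x))) (conv x (λ i j → F (suc i) (suc j))) (F (suc (suc x)) 0)))

conv-comm : ∀ x (F : ℕ → ℕ → ℤ) → conv x F ≡ conv x (λ i j → F j i)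
conv-comm zero F = refl
conv-comm (suc x) F = begin
  F 0 (suc x) ℤ.+ conv x (λ i j → F (suc i) j)
    ≡⟨ cong (λ z → F 0 (suc x) ℤ.+ z) (conv-comm x (λ i j → F (suc i) j)) ⟩
  F 0 (suc x) ℤ.+ conv x (λ i j → F (suc j) i)
    ≡⟨ ℤₚ.+-comm (F 0 (suc x)) (conv x (λ i j → F (suc j) i)) ⟩
  conv x (λ i j → F (suc j) i) ℤ.+ F 0 (suc x)
    ≡⟨ conv-last x (λ i j → F j i) ⟨
  conv (suc x) (λ i j → F j i) ∎
  where open ≡-Reasoning

-- Both sides sum `T j l c` over `j + l + c = x`; the induction splits off the terms with `j = 0`.
-- Since `conv` passes both indices to its summand, no truncated subtraction interferes.
conv-assoc : ∀ x (T : ℕ → ℕ → ℕ → ℤ) →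
  conv x (λ i c → conv i (λ j l → T j l c)) ≡ conv x (λ j m → conv m (λ l c → T j l c))
conv-assoc zero T = refl
conv-assoc (suc x) T = begin
  T 0 0 (suc x) ℤ.+ conv x (λ i c → T 0 (suc i) c ℤ.+ conv i (λ j l → T (suc j) l c))
    ≡⟨ cong (λ z → T 0 0 (suc x) ℤ.+ z) (conv-+ x (λ i c → T 0 (suc i) c) (λ i c → conv i (λ j l → T (suc j) l c))) ⟩
  T 0 0 (suc x) ℤ.+ (conv x (λ i c → T 0 (suc i) c) ℤ.+ conv x (λ i c → conv i (λ j l → T (suc j) l c)))
    ≡⟨ ℤₚ.+-assoc (T 0 0 (suc x)) (conv x (λ i c → T 0 (suc i) c)) _ ⟨
  (T 0 0 (suc x) ℤ.+ conv x (λ i c → T 0 (suc i) c)) ℤ.+ conv x (λ i c → conv i (λ j l → T (suc j) l c))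
    ≡⟨ cong (λ z → (T 0 0 (suc x) ℤ.+ conv x (λ i c → T 0 (suc i) c)) ℤ.+ z) (conv-assoc x (λ j → T (suc j))) ⟩
  (T 0 0 (suc x) ℤ.+ conv x (λ i c → T 0 (suc i) c)) ℤ.+ conv x (λ j m → conv m (λ l c → T (suc j) l c)) ∎
  where open ≡-Reasoning

sumℤ-++ : ∀ xs ys → sumℤ (xs ++ ys) ≡ sumℤ xs ℤ.+ sumℤ ys
sumℤ-++ [] ys = sym (ℤₚ.+-identityˡ (sumℤ ys))
sumℤ-++ (x ∷ xs) ys = trans (cong (λ z → x ℤ.+ z) (sumℤ-++ xs ys)) (sym (ℤₚ.+-assoc x (sumℤ xs) (sumℤ ys)))

sumℤ-concatMap : ∀ {A B : Set} (f : B → ℤ) (F : A → List B) xs →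
  sumℤ (map f (concatMap F xs)) ≡ sumℤ (map (λ a → sumℤ (map f (F a))) xs)
sumℤ-concatMap f F [] = refl
sumℤ-concatMap f F (x ∷ xs) =
  trans (cong sumℤ (map-++ f (F x) (concatMap F xs)))
  (trans (sumℤ-++ (map f (F x)) (map f (concatMap F xs)))
         (cong (λ z → sumℤ (map f (F x)) ℤ.+ z) (sumℤ-concatMap f F xs)))

sumℤ-conv : ∀ x (F : ℕ → ℕ → ℤ) →
  sumℤ (map (λ i → F i (x ∸ i)) (upTo (suc x))) ≡ conv x F
sumℤ-conv zero F = ℤₚ.+-identityʳ (F 0 0)
sumℤ-conv (suc x) F = cong (λ z → F 0 (suc x) ℤ.+ z)
  (trans (cong sumℤ (trans (map-applyUpTo suc (λ i → F i (suc x ∸ i)) (suc x))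
                           (sym (map-applyUpTo id (λ i → F (suc i) (x ∸ i)) (suc x)))))
         (sumℤ-conv x (λ i → F (suc i))))

_at_ : ∀ {k} → Poly (suc k) → ℕ → Poly k
(f at i) e = f (i ∷ e)

-- A polynomial is read as a series in its first variable with coefficients `f at i` in the
-- remaining ones. Commutativity and associativity of `_*P_` then follow from those of `conv` by
-- induction on the number of variables.
*P-∷ : ∀ {k} (f g : Poly (suc k)) x e → (f *P g) (x ∷ e) ≡ conv x (λ i j → ((f at i) *P (g at j)) e)
*P-∷ f g x e = begin
  sumℤ (map F (concatMap (λ i → map (i ∷_) (divs e)) (upTo (suc x))))
    ≡⟨ sumℤ-concatMap F (λ i → map (i ∷_) (divs e)) (upTo (suc x)) ⟩
  sumℤ (map (λ i → sumℤ (map F (map (i ∷_) (divs e)))) (upTo (suc x)))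
    ≡⟨ cong sumℤ (map-cong (λ i → cong sumℤ (sym (map-∘ (divs e)))) (upTo (suc x))) ⟩
  sumℤ (map (λ i → ((f at i) *P (g at (x ∸ i))) e) (upTo (suc x)))
    ≡⟨ sumℤ-conv x (λ i j → ((f at i) *P (g at j)) e) ⟩
  conv x (λ i j → ((f at i) *P (g at j)) e) ∎
  where
  open ≡-Reasoning
  F = λ d → f d ℤ.* g (zipWith _∸_ (x ∷ e) d)

*P-cong : ∀ {k} {f f′ g g′ : Poly k} → f ≈P f′ → g ≈P g′ → f *P g ≈P f′ *P g′
*P-cong p q e = cong sumℤ (map-cong (λ d → cong₂ ℤ._*_ (p d) (q (zipWith _∸_ e d))) (divs e))

*P-comm : ∀ {k} (f g : Poly k) → f *P g ≈P g *P f
*P-comm f g [] = cong (λ z → z ℤ.+ ℤ.+0) (ℤₚ.*-comm (f []) (g []))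
*P-comm f g (x ∷ e) = begin
  (f *P g) (x ∷ e)                            ≡⟨ *P-∷ f g x e ⟩
  conv x (λ i j → ((f at i) *P (g at j)) e)   ≡⟨ conv-comm x _ ⟩
  conv x (λ i j → ((f at j) *P (g at i)) e)   ≡⟨ conv-cong x (λ i j → *P-comm (f at j) (g at i) e) ⟩
  conv x (λ i j → ((g at i) *P (f at j)) e)   ≡⟨ *P-∷ g f x e ⟨
  (g *P f) (x ∷ e) ∎
  where open ≡-Reasoning

*P-zeroˡ : ∀ {k} (f : Poly k) → zeroP *P f ≈P zeroP
*P-zeroˡ f e = go (divs e)
  where
  go : ∀ ds → sumℤ (map (λ d → ℤ.+0 ℤ.* f (zipWith _∸_ e d)) ds) ≡ ℤ.+0
  go [] = refl
  go (d ∷ ds) = cong₂ ℤ._+_ (ℤₚ.*-zeroˡ (f (zipWith _∸_ e d))) (go ds)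

*P-distribʳ : ∀ {k} (f g h : Poly k) → (f +P g) *P h ≈P (f *P h) +P (g *P h)
*P-distribʳ f g h e = go (divs e)
  where
  distrib : ∀ a b c s t → (a ℤ.+ b) ℤ.* c ℤ.+ (s ℤ.+ t) ≡ (a ℤ.* c ℤ.+ s) ℤ.+ (b ℤ.* c ℤ.+ t)
  distrib = ℤ-Solver.solve-∀
  go : ∀ ds → sumℤ (map (λ d → (f d ℤ.+ g d) ℤ.* h (zipWith _∸_ e d)) ds)
     ≡ sumℤ (map (λ d → f d ℤ.* h (zipWith _∸_ e d)) ds) ℤ.+ sumℤ (map (λ d → g d ℤ.* h (zipWith _∸_ e d)) ds)
  go [] = refl
  go (d ∷ ds) = trans (cong (λ z → (f d ℤ.+ g d) ℤ.* h (zipWith _∸_ e d) ℤ.+ z) (go ds))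
    (distrib (f d) (g d) (h (zipWith _∸_ e d)) _ _)

*P-•ˡ : ∀ {k} c (f g : Poly k) → (c •P f) *P g ≈P c •P (f *P g)
*P-•ˡ c f g e = go (divs e)
  where
  distrib : ∀ c a b s → (c ℤ.* a) ℤ.* b ℤ.+ c ℤ.* s ≡ c ℤ.* (a ℤ.* b ℤ.+ s)
  distrib = ℤ-Solver.solve-∀
  go : ∀ ds → sumℤ (map (λ d → (c ℤ.* f d) ℤ.* g (zipWith _∸_ e d)) ds)
     ≡ c ℤ.* sumℤ (map (λ d → f d ℤ.* g (zipWith _∸_ e d)) ds)
  go [] = sym (ℤₚ.*-zeroʳ c)
  go (d ∷ ds) = trans (cong (λ z → (c ℤ.* f d) ℤ.* g (zipWith _∸_ e d) ℤ.+ z) (go ds))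
    (distrib c (f d) (g (zipWith _∸_ e d)) _)

sumP-*P : ∀ {k} (fs : List (Poly k)) (g : Poly k) → sumP fs *P g ≈P sumP (map (_*P g) fs)
sumP-*P [] g = *P-zeroˡ g
sumP-*P (f ∷ fs) g e =
  trans (*P-distribʳ f (sumP fs) g e) (cong (λ z → (f *P g) e ℤ.+ z) (sumP-*P fs g e))

conv-*Pˡ : ∀ {k} x (F : ℕ → ℕ → Poly k) (g : Poly k) →
  (λ e → conv x (λ i j → F i j e)) *P g ≈P (λ e → conv x (λ i j → (F i j *P g) e))
conv-*Pˡ zero F g e = refl
conv-*Pˡ (suc x) F g e =
  trans (*P-distribʳ (F 0 (suc x)) (λ e → conv x (λ i j → F (suc i) j e)) g e)
        (cong (λ z → (F 0 (suc x) *P g) e ℤ.+ z) (conv-*Pˡ x (λ i j → F (suc i) j) g e))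

conv-*Pʳ : ∀ {k} x (f : Poly k) (G : ℕ → ℕ → Poly k) →
  f *P (λ e → conv x (λ i j → G i j e)) ≈P (λ e → conv x (λ i j → (f *P G i j) e))
conv-*Pʳ x f G e =
  trans (*P-comm f (λ e → conv x (λ i j → G i j e)) e)
  (trans (conv-*Pˡ x G f e) (conv-cong x (λ i j → *P-comm (G i j) f e)))

*P-assoc : ∀ {k} (f g h : Poly k) → (f *P g) *P h ≈P f *P (g *P h)
*P-assoc f g h [] = assoc (f []) (g []) (h [])
  where
  assoc : ∀ a b c → (a ℤ.* b ℤ.+ ℤ.+0) ℤ.* c ℤ.+ ℤ.+0 ≡ a ℤ.* (b ℤ.* c ℤ.+ ℤ.+0) ℤ.+ ℤ.+0
  assoc = ℤ-Solver.solve-∀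
*P-assoc f g h (x ∷ e) = begin
  ((f *P g) *P h) (x ∷ e)
    ≡⟨ *P-∷ (f *P g) h x e ⟩
  conv x (λ i c → (((f *P g) at i) *P (h at c)) e)
    ≡⟨ conv-cong x (λ i c → *P-cong {f = (f *P g) at i} {g = h at c} (*P-∷ f g i) (λ _ → refl) e) ⟩
  conv x (λ i c → ((λ e → conv i (λ j l → ((f at j) *P (g at l)) e)) *P (h at c)) e)
    ≡⟨ conv-cong x (λ i c → conv-*Pˡ i (λ j l → (f at j) *P (g at l)) (h at c) e) ⟩
  conv x (λ i c → conv i (λ j l → (((f at j) *P (g at l)) *P (h at c)) e))
    ≡⟨ conv-assoc x (λ j l c → (((f at j) *P (g at l)) *P (h at c)) e) ⟩
  conv x (λ j m → conv m (λ l c → (((f at j) *P (g at l)) *P (h at c)) e))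
    ≡⟨ conv-cong x (λ j m → conv-cong m (λ l c → *P-assoc (f at j) (g at l) (h at c) e)) ⟩
  conv x (λ j m → conv m (λ l c → ((f at j) *P ((g at l) *P (h at c))) e))
    ≡⟨ conv-cong x (λ j m → conv-*Pʳ m (f at j) (λ l c → (g at l) *P (h at c)) e) ⟨
  conv x (λ j m → ((f at j) *P (λ e → conv m (λ l c → ((g at l) *P (h at c)) e))) e)
    ≡⟨ conv-cong x (λ j m → *P-cong {f = f at j} {g = (g *P h) at m} (λ _ → refl) (*P-∷ g h m) e) ⟨
  conv x (λ j m → ((f at j) *P ((g *P h) at m)) e)
    ≡⟨ *P-∷ f (g *P h) x e ⟨
  (f *P (g *P h)) (x ∷ e) ∎
  where open ≡-Reasoning

-- Finite sums and indicators

Σ< : ℕ → (ℕ → ℕ) → ℕ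
Σ< zero f = 0
Σ< (suc n) f = Σ< n f + f n

𝟙 : {P : Set} → Dec P → ℕ
𝟙 (yes _) = 1
𝟙 (no _) = 0

𝟙-yes : {P : Set} (d : Dec P) → P → 𝟙 d ≡ 1
𝟙-yes (yes _) p = refl
𝟙-yes (no ¬p) p = ⊥-elim (¬p p)

𝟙-no : {P : Set} (d : Dec P) → ¬ P → 𝟙 d ≡ 0
𝟙-no (yes p) ¬p = ⊥-elim (¬p p)
𝟙-no (no _) ¬p = refl

𝟙-true : {P : Set} (d : Dec P) → 𝟙 d ≡ 1 → P
𝟙-true (yes p) _ = p

𝟙-⇔ : {P Q : Set} (d : Dec P) (e : Dec Q) → (P → Q) → (Q → P) → 𝟙 d ≡ 𝟙 e
𝟙-⇔ (yes p) e f g = sym (𝟙-yes e (f p))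
𝟙-⇔ (no ¬p) e f g = sym (𝟙-no e (¬p ∘ g))

𝟙-mono : {P Q : Set} (d : Dec P) (e : Dec Q) → (P → Q) → 𝟙 d ≤ 𝟙 e
𝟙-mono (yes p) e f = ≤-reflexive (sym (𝟙-yes e (f p)))
𝟙-mono (no _) e f = z≤n

𝟙≤1 : {P : Set} (d : Dec P) → 𝟙 d ≤ 1
𝟙≤1 (yes _) = s≤s z≤n
𝟙≤1 (no _) = z≤n

Σ<-cong : ∀ n {f g : ℕ → ℕ} → (∀ i → i < n → f i ≡ g i) → Σ< n f ≡ Σ< n g
Σ<-cong zero h = refl
Σ<-cong (suc n) h = cong₂ _+_ (Σ<-cong n (λ i i<n → h i (m<n⇒m<1+n i<n))) (h n (n<1+n n))

Σ<-mono : ∀ n {f g : ℕ → ℕ} → (∀ i → i < n → f i ≤ g i) → Σ< n f ≤ Σ< n g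
Σ<-mono zero h = z≤n
Σ<-mono (suc n) h = +-mono-≤ (Σ<-mono n (λ i i<n → h i (m<n⇒m<1+n i<n))) (h n (n<1+n n))

Σ<-zero : ∀ n {f : ℕ → ℕ} → (∀ i → i < n → f i ≡ 0) → Σ< n f ≡ 0
Σ<-zero zero h = refl
Σ<-zero (suc n) h = cong₂ _+_ (Σ<-zero n (λ i i<n → h i (m<n⇒m<1+n i<n))) (h n (n<1+n n))

Σ<-const : ∀ n c → Σ< n (λ _ → c) ≡ n * c
Σ<-const zero c = refl
Σ<-const (suc n) c = trans (cong (_+ c) (Σ<-const n c)) (+-comm (n * c) c)

Σ<-+ : ∀ n (f g : ℕ → ℕ) → Σ< n (λ i → f i + g i) ≡ Σ< n f + Σ< n g
Σ<-+ zero f g = refl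
Σ<-+ (suc n) f g = trans (cong (_+ (f n + g n)) (Σ<-+ n f g)) (interchange (Σ< n f) (Σ< n g) (f n) (g n))
  where
  interchange : ∀ a b c d → (a + b) + (c + d) ≡ (a + c) + (b + d)
  interchange = ℕ-Solver.solve-∀

Σ<-* : ∀ n c (f : ℕ → ℕ) → Σ< n (λ i → c * f i) ≡ c * Σ< n f
Σ<-* zero c f = sym (*-zeroʳ c)
Σ<-* (suc n) c f = trans (cong (_+ c * f n) (Σ<-* n c f)) (sym (*-distribˡ-+ c (Σ< n f) (f n)))

Σ<-swap : ∀ m n (f : ℕ → ℕ → ℕ) → Σ< m (λ i → Σ< n (f i)) ≡ Σ< n (λ j → Σ< m (λ i → f i j))
Σ<-swap zero n f = sym (Σ<-zero n (λ _ _ → refl))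
Σ<-swap (suc m) n f = trans (cong (_+ Σ< n (f m)) (Σ<-swap m n f))
  (sym (Σ<-+ n (λ j → Σ< m (λ i → f i j)) (f m)))

Σ<-front : ∀ n (f : ℕ → ℕ) → Σ< (suc n) f ≡ f 0 + Σ< n (f ∘ suc)
Σ<-front zero f = sym (+-identityʳ (f 0))
Σ<-front (suc n) f = trans (cong (_+ f (suc n)) (Σ<-front n f)) (+-assoc (f 0) (Σ< n (f ∘ suc)) (f (suc n)))

Σ<-split : ∀ m n (f : ℕ → ℕ) → Σ< (m + n) f ≡ Σ< m f + Σ< n (λ i → f (m + i))
Σ<-split m zero f = trans (cong (λ z → Σ< z f) (+-identityʳ m)) (sym (+-identityʳ (Σ< m f)))
Σ<-split m (suc n) f = begin
  Σ< (m + suc n) f                                   ≡⟨ cong (λ z → Σ< z f) (+-suc m n) ⟩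
  Σ< (m + n) f + f (m + n)                           ≡⟨ cong (_+ f (m + n)) (Σ<-split m n f) ⟩
  Σ< m f + Σ< n (λ i → f (m + i)) + f (m + n)        ≡⟨ +-assoc (Σ< m f) _ _ ⟩
  Σ< m f + (Σ< n (λ i → f (m + i)) + f (m + n))      ∎
  where open ≡-Reasoning

Σ<-extend : ∀ {m n} (f : ℕ → ℕ) → m ≤ n → (∀ i → m ≤ i → f i ≡ 0) → Σ< n f ≡ Σ< m f
Σ<-extend {m} {n} f m≤n h = begin
  Σ< n f                                      ≡⟨ cong (λ z → Σ< z f) (m+[n∸m]≡n m≤n) ⟨
  Σ< (m + (n ∸ m)) f                          ≡⟨ Σ<-split m (n ∸ m) f ⟩
  Σ< m f + Σ< (n ∸ m) (λ i → f (m + i))       ≡⟨ cong (Σ< m f +_) (Σ<-zero (n ∸ m) (λ i _ → h (m + i) (m≤m+n m i))) ⟩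
  Σ< m f + 0                                  ≡⟨ +-identityʳ (Σ< m f) ⟩
  Σ< m f                                      ∎
  where open ≡-Reasoning

Σ<-single : ∀ n j {f : ℕ → ℕ} → j < n → (∀ i → i < n → i ≢ j → f i ≡ 0) → Σ< n f ≡ f j
Σ<-single (suc n) j {f} j<n h with j ≟ n
... | yes refl = cong (_+ f n) (Σ<-zero n (λ i i<n → h i (m<n⇒m<1+n i<n) (<⇒≢ i<n)))
... | no j≢n = trans (cong₂ _+_ (Σ<-single n j (≤∧≢⇒< (≤-pred j<n) j≢n) (λ i i<n → h i (m<n⇒m<1+n i<n)))
                                (h n (n<1+n n) (j≢n ∘ sym)))
                     (+-identityʳ (f j))

count-≤ : ∀ n {P : ℕ → Set} (P? : ∀ i → Dec (P i)) → Σ< n (𝟙 ∘ P?) ≤ n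
count-≤ n P? = ≤-trans (Σ<-mono n (λ i _ → 𝟙≤1 (P? i))) (≤-reflexive (trans (Σ<-const n 1) (*-identityʳ n)))

count-all : ∀ n {P : ℕ → Set} (P? : ∀ i → Dec (P i)) → (∀ i → i < n → P i) → Σ< n (𝟙 ∘ P?) ≡ n
count-all n P? h = trans (Σ<-cong n (λ i i<n → 𝟙-yes (P? i) (h i i<n))) (trans (Σ<-const n 1) (*-identityʳ n))

count-full : ∀ n {P : ℕ → Set} (P? : ∀ i → Dec (P i)) → Σ< n (𝟙 ∘ P?) ≡ n → ∀ i → i < n → P i
count-full (suc n) P? eq i i<n with P? n
... | no _ = ⊥-elim (<-irrefl (trans (sym (+-identityʳ _)) eq) (s≤s (count-≤ n P?)))
... | yes p with i ≟ n
...   | yes refl = p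
...   | no i≢n = count-full n P? (suc-injective (trans (+-comm 1 _) eq)) i (≤∧≢⇒< (≤-pred i<n) i≢n)

module _ {P : ℕ → Set} (P? : ∀ i → Dec (P i)) where

  -- A downward closed predicate holds on an initial segment whose length is its count. This turns
  -- row lengths, path heights and ranks, all defined by counting, back into the inequalities they
  -- stand for.
  segment : ∀ n → (∀ {i j} → i ≤ j → j < n → P j → P i) → ∀ {i} → i < n →
    (i < Σ< n (𝟙 ∘ P?) → P i) × (P i → i < Σ< n (𝟙 ∘ P?))
  segment (suc n) down {i} i<n with P? n
  ... | yes p = (λ _ → down (≤-pred i<n) (n<1+n n) p) ,
                (λ _ → subst (i <_) (trans (+-comm 1 n) (cong (_+ 1) (sym (count-all n P? (λ j j<n → down (<⇒≤ j<n) (n<1+n n) p))))) i<n)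
  ... | no ¬p rewrite +-identityʳ (Σ< n (𝟙 ∘ P?)) =
    (λ i<c → proj₁ (ih (≤-trans i<c (count-≤ n P?))) i<c) ,
    (λ q → proj₂ (ih (≤∧≢⇒< (≤-pred i<n) (λ { refl → ¬p q }))) q)
    where
    ih : ∀ {i} → i < n → (i < Σ< n (𝟙 ∘ P?) → P i) × (P i → i < Σ< n (𝟙 ∘ P?))
    ih = segment n (λ i≤j j<n → down i≤j (m<n⇒m<1+n j<n))

  length-filter-∷ : ∀ x xs → length (filter P? (x ∷ xs)) ≡ 𝟙 (P? x) + length (filter P? xs)
  length-filter-∷ x xs with P? x
  ... | yes _ = refl
  ... | no _ = refl

  length-filter-applyUpTo : ∀ (f : ℕ → ℕ) n → length (filter P? (applyUpTo f n)) ≡ Σ< n (𝟙 ∘ P? ∘ f)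
  length-filter-applyUpTo f zero = refl
  length-filter-applyUpTo f (suc n) = trans (length-filter-∷ (f 0) (applyUpTo (f ∘ suc) n))
    (trans (cong (𝟙 (P? (f 0)) +_) (length-filter-applyUpTo (f ∘ suc) n)) (sym (Σ<-front n (𝟙 ∘ P? ∘ f))))

count-from : ∀ n b → Σ< n (λ i → 𝟙 (b ≤? i)) ≡ n ∸ b
count-from zero b = sym (0∸n≡0 b)
count-from (suc n) b with b ≤? n
... | yes b≤n = trans (cong (_+ 1) (count-from n b)) (trans (+-comm (n ∸ b) 1) (sym (+-∸-assoc 1 b≤n)))
... | no b≰n = trans (+-identityʳ _) (trans (count-from n b)
                 (trans (m≤n⇒m∸n≡0 (<⇒≤ (≰⇒> b≰n))) (sym (m≤n⇒m∸n≡0 (≰⇒> b≰n)))))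

≤-ext : ∀ {a b} → (∀ j → j < a → j < b) → a ≤ b
≤-ext {zero} h = z≤n
≤-ext {suc a} h = h a (n<1+n a)

≡-ext : ∀ {a b} → (∀ j → j < a → j < b) → (∀ j → j < b → j < a) → a ≡ b
≡-ext f g = ≤-antisym (≤-ext f) (≤-ext g)

m∸n≤o⇒m≤n+o : ∀ m n {o} → m ∸ n ≤ o → m ≤ n + o
m∸n≤o⇒m≤n+o m n q = ≤-trans (m≤n+m∸n m n) (+-monoʳ-≤ n q)

-- Partitions

IsPartition-tail : ∀ {x xs} → IsPartition (x ∷ xs) → IsPartition xs
IsPartition-tail (_ ∷ ps , [-]) = ps , []
IsPartition-tail (_ ∷ ps , _ ∷ l) = ps , l

row≤head : ∀ {x xs} → IsPartition (x ∷ xs) → ∀ i → row xs i ≤ x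
row≤head {xs = []} _ i = z≤n
row≤head {xs = y ∷ ys} (_ , y≤x ∷ _) zero = y≤x
row≤head {xs = y ∷ ys} p@(_ , y≤x ∷ _) (suc i) = ≤-trans (row≤head (IsPartition-tail p) i) y≤x

row-antitone : ∀ {τ} → IsPartition τ → ∀ i → row τ (suc i) ≤ row τ i
row-antitone {[]} _ i = z≤n
row-antitone {x ∷ xs} p zero = row≤head p 0
row-antitone {x ∷ xs} p (suc i) = row-antitone (IsPartition-tail p) i

row≤row₀ : ∀ {τ} → IsPartition τ → ∀ i → row τ i ≤ row τ 0
row≤row₀ p zero = ≤-refl
row≤row₀ p (suc i) = ≤-trans (row-antitone p i) (row≤row₀ p i)

col-∷ : ∀ x xs j → col (x ∷ xs) j ≡ 𝟙 (j <? x) + col xs j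
col-∷ x xs j = length-filter-∷ (j <?_) x xs

<col⇔<row : ∀ {τ} → IsPartition τ → ∀ {i j} → (i < col τ j → j < row τ i) × (j < row τ i → i < col τ j)
<col⇔<row {[]} p = (λ ()) , (λ ())
<col⇔<row {x ∷ xs} p {i} {j} rewrite col-∷ x xs j = go i (j <? x)
  where
  ih : ∀ {i} → (i < col xs j → j < row xs i) × (j < row xs i → i < col xs j)
  ih = <col⇔<row (IsPartition-tail p)
  go : ∀ i (d : Dec (j < x)) → (i < 𝟙 d + col xs j → j < row (x ∷ xs) i) × (j < row (x ∷ xs) i → i < 𝟙 d + col xs j)
  go zero (yes j<x) = (λ _ → j<x) , (λ _ → s≤s z≤n)
  go (suc i) (yes j<x) = (λ q → proj₁ ih (≤-pred q)) , (λ q → s≤s (proj₂ ih q))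
  go i (no j≮x) = (λ q → ⊥-elim (j≮x (<-≤-trans (proj₁ ih q) (row≤head p i)))) ,
                  (λ q → ⊥-elim (j≮x (<-≤-trans q (row≤row₀ p i))))

partition-ext : ∀ {τ κ} → IsPartition τ → IsPartition κ → (∀ i → row τ i ≡ row κ i) → τ ≡ κ
partition-ext {[]} {[]} p q h = refl
partition-ext {[]} {y ∷ ys} p (0<y ∷ _ , _) h = ⊥-elim (<-irrefl (h 0) 0<y)
partition-ext {x ∷ xs} {[]} (0<x ∷ _ , _) q h = ⊥-elim (<-irrefl (sym (h 0)) 0<x)
partition-ext {x ∷ xs} {y ∷ ys} p q h =
  cong₂ _∷_ (h 0) (partition-ext (IsPartition-tail p) (IsPartition-tail q) (h ∘ suc))

-- Columns are additive under `_∪_` (see `col-∪`) and a move adds single cells to columns, so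
-- identities between partitions are checked on columns rather than rows.
partition-ext-col : ∀ {τ κ} → IsPartition τ → IsPartition κ → (∀ j → col τ j ≡ col κ j) → τ ≡ κ
partition-ext-col p q h = partition-ext p q λ i → ≡-ext
  (λ j j<r → proj₁ (<col⇔<row q) (subst (i <_) (h j) (proj₂ (<col⇔<row p) j<r)))
  (λ j j<r → proj₁ (<col⇔<row p) (subst (i <_) (sym (h j)) (proj₂ (<col⇔<row q) j<r)))

row-beyond : ∀ τ {i} → length τ ≤ i → row τ i ≡ 0
row-beyond [] _ = refl
row-beyond (x ∷ xs) (s≤s l≤i) = row-beyond xs l≤i

fromRows : (ℕ → ℕ) → ℕ → Partition
fromRows f B = filter (0 <?_) (applyUpTo f B)

fromRows-zero : ∀ f B → (∀ i → f (suc i) ≤ f i) → f 0 ≡ 0 → fromRows f B ≡ []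
fromRows-zero f zero anti f0 = refl
fromRows-zero f (suc B) anti f0 =
  trans (filter-reject (0 <?_) (λ p → <-irrefl (sym f0) p))
        (fromRows-zero (f ∘ suc) B (anti ∘ suc) (n≤0⇒n≡0 (subst (f 1 ≤_) f0 (anti 0))))

antitone-zero : ∀ (f : ℕ → ℕ) → (∀ i → f (suc i) ≤ f i) → f 0 ≡ 0 → ∀ i → f i ≡ 0
antitone-zero f anti f0 zero = f0
antitone-zero f anti f0 (suc i) = n≤0⇒n≡0 (≤-trans (anti i) (≤-reflexive (antitone-zero f anti f0 i)))

-- For antitone `f` the filter cuts off only a tail of zeros, hence it renumbers no row.
row-fromRows : ∀ f B → (∀ i → f (suc i) ≤ f i) → (∀ i → B ≤ i → f i ≡ 0) → ∀ i → row (fromRows f B) i ≡ f i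
row-fromRows f zero anti fin i = sym (fin i z≤n)
row-fromRows f (suc B) anti fin i = go (0 <? f 0) i
  where
  go : Dec (0 < f 0) → ∀ i → row (fromRows f (suc B)) i ≡ f i
  go (yes p) i rewrite filter-accept (0 <?_) {xs = applyUpTo (f ∘ suc) B} p = accepted i
    where
    accepted : ∀ i → row (f 0 ∷ fromRows (f ∘ suc) B) i ≡ f i
    accepted zero = refl
    accepted (suc i) = row-fromRows (f ∘ suc) B (anti ∘ suc) (λ i B≤i → fin (suc i) (s≤s B≤i)) i
  go (no ¬p) i = trans (cong (λ τ → row τ i) (fromRows-zero f (suc B) anti f0)) (sym (antitone-zero f anti f0 i))
    where f0 = n≤0⇒n≡0 (≮⇒≥ ¬p)

IsPartition-∷ : ∀ {x xs} → 0 < x → IsPartition xs → row xs 0 ≤ x → IsPartition (x ∷ xs)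
IsPartition-∷ {xs = []} 0<x p h = 0<x ∷ [] , [-]
IsPartition-∷ {xs = y ∷ ys} 0<x (ps , l) h = 0<x ∷ ps , h ∷ l

IsPartition-fromRows : ∀ f B → (∀ i → f (suc i) ≤ f i) → (∀ i → B ≤ i → f i ≡ 0) → IsPartition (fromRows f B)
IsPartition-fromRows f zero anti fin = [] , []
IsPartition-fromRows f (suc B) anti fin = go (0 <? f 0)
  where
  ih : IsPartition (fromRows (f ∘ suc) B)
  ih = IsPartition-fromRows (f ∘ suc) B (anti ∘ suc) (λ i B≤i → fin (suc i) (s≤s B≤i))
  go : Dec (0 < f 0) → IsPartition (fromRows f (suc B))
  go (yes p) = subst IsPartition (sym (filter-accept (0 <?_) p)) (IsPartition-∷ p ih
    (subst (_≤ f 0) (sym (row-fromRows (f ∘ suc) B (anti ∘ suc) (λ i B≤i → fin (suc i) (s≤s B≤i)) 0)) (anti 0)))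
  go (no ¬p) = subst IsPartition (sym (filter-reject (0 <?_) ¬p)) ih

col-insert : ∀ x ys j → col (insert x ys) j ≡ 𝟙 (j <? x) + col ys j
col-insert x [] j = col-∷ x [] j
col-insert x (y ∷ ys) j with y ≤ᵇ x
... | true = col-∷ x (y ∷ ys) j
... | false = begin
  col (y ∷ insert x ys) j                     ≡⟨ col-∷ y (insert x ys) j ⟩
  𝟙 (j <? y) + col (insert x ys) j            ≡⟨ cong (𝟙 (j <? y) +_) (col-insert x ys j) ⟩
  𝟙 (j <? y) + (𝟙 (j <? x) + col ys j)        ≡⟨ swap (𝟙 (j <? y)) (𝟙 (j <? x)) (col ys j) ⟩
  𝟙 (j <? x) + (𝟙 (j <? y) + col ys j)        ≡⟨ cong (𝟙 (j <? x) +_) (col-∷ y ys j) ⟨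
  𝟙 (j <? x) + col (y ∷ ys) j                 ∎
  where
  open ≡-Reasoning
  swap : ∀ a b c → a + (b + c) ≡ b + (a + c)
  swap = ℕ-Solver.solve-∀

col-∪ : ∀ xs ys j → col (xs ∪ ys) j ≡ col xs j + col ys j
col-∪ [] ys j = refl
col-∪ (x ∷ xs) ys j = begin
  col (insert x (xs ∪ ys)) j                ≡⟨ col-insert x (xs ∪ ys) j ⟩
  𝟙 (j <? x) + col (xs ∪ ys) j              ≡⟨ cong (𝟙 (j <? x) +_) (col-∪ xs ys j) ⟩
  𝟙 (j <? x) + (col xs j + col ys j)        ≡⟨ +-assoc (𝟙 (j <? x)) (col xs j) (col ys j) ⟨
  𝟙 (j <? x) + col xs j + col ys j          ≡⟨ cong (_+ col ys j) (col-∷ x xs j) ⟨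
  col (x ∷ xs) j + col ys j                 ∎
  where open ≡-Reasoning

row₀-insert : ∀ x ys → row (insert x ys) 0 ≡ x ⊎ row (insert x ys) 0 ≡ row ys 0
row₀-insert x [] = inj₁ refl
row₀-insert x (y ∷ ys) with y ≤ᵇ x
... | true = inj₁ refl
... | false = inj₂ refl

IsPartition-insert : ∀ {x ys} → 0 < x → IsPartition ys → IsPartition (insert x ys)
IsPartition-insert {x} {[]} 0<x p = 0<x ∷ [] , [-]
IsPartition-insert {x} {y ∷ ys} 0<x p with y ≤ᵇ x in eq
... | true = IsPartition-∷ 0<x p (≤ᵇ⇒≤ y x (subst T (sym eq) _))
... | false = IsPartition-∷ (All.head (proj₁ p)) (IsPartition-insert 0<x (IsPartition-tail p)) (bound (row₀-insert x ys))
  where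
  bound : row (insert x ys) 0 ≡ x ⊎ row (insert x ys) 0 ≡ row ys 0 → row (insert x ys) 0 ≤ y
  bound (inj₁ e) = ≤-trans (≤-reflexive e) (<⇒≤ (≰⇒> λ y≤x → subst T eq (≤⇒≤ᵇ y≤x)))
  bound (inj₂ e) = ≤-trans (≤-reflexive e) (row≤head p 0)

IsPartition-∪ : ∀ {xs ys} → All (0 <_) xs → IsPartition ys → IsPartition (xs ∪ ys)
IsPartition-∪ [] q = q
IsPartition-∪ (0<x ∷ ps) q = IsPartition-insert 0<x (IsPartition-∪ ps q)

All-insert : ∀ {P : ℕ → Set} {x ys} → P x → All P ys → All P (insert x ys)
All-insert {ys = []} px [] = px ∷ []
All-insert {x = x} {y ∷ ys} px (py ∷ pys) with y ≤ᵇ x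
... | true = px ∷ py ∷ pys
... | false = py ∷ All-insert px pys

All-∪ : ∀ {P : ℕ → Set} {xs ys} → All P xs → All P ys → All P (xs ∪ ys)
All-∪ [] q = q
All-∪ (px ∷ p) q = All-insert px (All-∪ p q)

All≤⇒col : ∀ {k} xs → All (_≤ k) xs → ∀ j → k ≤ j → col xs j ≡ 0
All≤⇒col [] [] j k≤j = refl
All≤⇒col (x ∷ xs) (p ∷ ps) j k≤j =
  trans (col-∷ x xs j) (cong₂ _+_ (𝟙-no (j <? x) (≤⇒≯ (≤-trans p k≤j))) (All≤⇒col xs ps j k≤j))

row⇒All≤ : ∀ {k} xs → (∀ i → row xs i ≤ k) → All (_≤ k) xs
row⇒All≤ [] h = []
row⇒All≤ (x ∷ xs) h = h 0 ∷ row⇒All≤ xs (h ∘ suc)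

∪-[] : ∀ {xs} → IsPartition xs → xs ∪ [] ≡ xs
∪-[] {xs} p = partition-ext-col (IsPartition-∪ (proj₁ p) ([] , [])) p
  (λ j → trans (col-∪ xs [] j) (+-identityʳ (col xs j)))

col-replicate : ∀ m s j → col (replicate m s) j ≡ m * 𝟙 (j <? s)
col-replicate zero s j = refl
col-replicate (suc m) s j = trans (col-∷ s (replicate m s) j) (cong (𝟙 (j <? s) +_) (col-replicate m s j))

-- Boundary paths of partitions

Gap : (ℕ → ℕ) → ℕ → Set
Gap h x = h (suc x) ≡ h x

gap? : ∀ h x → Dec (Gap h x)
gap? h x = h (suc x) ≟ h x

Bead : (ℕ → ℕ) → ℕ → Set
Bead h x = h x ≡ suc (h (suc x))

Flush : ℕ → (ℕ → ℕ) → Set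
Flush n h = ∀ y → Gap h y → Gap h (y + n)

-- The boundary of a diagram is encoded by a Maya diagram on ℕ whose beads are
-- the rows and whose gaps are the columns: h x is the number of beads at
-- positions ≥ x, and gaps h x the number of gaps at positions < x.
record IsPath (h : ℕ → ℕ) : Set where
  field
    antitone : ∀ x → h (suc x) ≤ h x
    lipschitz : ∀ x → h x ≤ suc (h (suc x))
    top : ℕ
    h-top : h top ≡ 0

gaps : (ℕ → ℕ) → ℕ → ℕ
gaps h x = x + h x ∸ h 0

module Path {h : ℕ → ℕ} (path : IsPath h) where
  open IsPath path public

  h-anti : ∀ {x y} → x ≤ y → h y ≤ h x
  h-anti {x} {y} x≤y = subst (λ z → h z ≤ h x) (m+[n∸m]≡n x≤y) (go (y ∸ x))
    where
    go : ∀ d → h (x + d) ≤ h x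
    go zero = ≤-reflexive (cong h (+-identityʳ x))
    go (suc d) = ≤-trans (≤-reflexive (cong h (+-suc x d))) (≤-trans (antitone (x + d)) (go d))

  beyond-top : ∀ {x} → top ≤ x → h x ≡ 0
  beyond-top t≤x = n≤0⇒n≡0 (≤-trans (h-anti t≤x) (≤-reflexive h-top))

  gap⊎bead : ∀ x → Gap h x ⊎ Bead h x
  gap⊎bead x with gap? h x
  ... | yes e = inj₁ e
  ... | no ne = inj₂ (≤-antisym (lipschitz x) (≤∧≢⇒< (antitone x) ne))

  ¬gap∧bead : ∀ {x} → Gap h x → Bead h x → ⊥
  ¬gap∧bead e f = <-irrefl e (≤-reflexive (sym f))

  h₀≤ : ∀ x → h 0 ≤ x + h x
  h₀≤ zero = ≤-refl
  h₀≤ (suc x) = ≤-trans (h₀≤ x) (≤-trans (+-monoʳ-≤ x (lipschitz x)) (≤-reflexive (+-suc x (h (suc x)))))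

  balance : ∀ x → gaps h x + h 0 ≡ x + h x
  balance x = m∸n+n≡m (h₀≤ x)

  gaps-gap : ∀ {x} → Gap h x → gaps h (suc x) ≡ suc (gaps h x)
  gaps-gap {x} e = trans (cong (λ z → suc (x + z) ∸ h 0) e) (+-∸-assoc 1 (h₀≤ x))

  gaps-bead : ∀ {x} → Bead h x → gaps h (suc x) ≡ gaps h x
  gaps-bead {x} e = cong (_∸ h 0) (trans (sym (+-suc x (h (suc x)))) (cong (x +_) (sym e)))

  gaps₀ : gaps h 0 ≡ 0
  gaps₀ = n∸n≡0 (h 0)

  gaps-step : ∀ x → gaps h x ≤ gaps h (suc x) × gaps h (suc x) ≤ suc (gaps h x)
  gaps-step x with gap⊎bead x
  ... | inj₁ e = ≤-trans (n≤1+n _) (≤-reflexive (sym (gaps-gap e))) , ≤-reflexive (gaps-gap e)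
  ... | inj₂ e = ≤-reflexive (sym (gaps-bead e)) , ≤-trans (≤-reflexive (gaps-bead e)) (n≤1+n _)

  gaps-+ : ∀ x d → gaps h x ≤ gaps h (x + d) × gaps h (x + d) ≤ d + gaps h x
  gaps-+ x zero rewrite +-identityʳ x = ≤-refl , ≤-refl
  gaps-+ x (suc d) rewrite +-suc x d =
    ≤-trans (proj₁ (gaps-+ x d)) (proj₁ (gaps-step (x + d))) ,
    ≤-trans (proj₂ (gaps-step (x + d))) (s≤s (proj₂ (gaps-+ x d)))

  gaps-mono : ∀ {x y} → x ≤ y → gaps h x ≤ gaps h y
  gaps-mono {x} {y} x≤y = subst (λ z → gaps h x ≤ gaps h z) (m+[n∸m]≡n x≤y) (proj₁ (gaps-+ x (y ∸ x)))

  gaps-∸ : ∀ x k → gaps h x ∸ gaps h (x ∸ k) ≤ k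
  gaps-∸ x k = m≤n+o⇒m∸n≤o (gaps h x) (gaps h (x ∸ k)) (≤-trans
    (gaps-mono (≤-trans (m≤n+m∸n x k) (≤-reflexive (+-comm k (x ∸ k)))))
    (≤-trans (proj₂ (gaps-+ (x ∸ k) k)) (≤-reflexive (+-comm k _))))

  find-bead : ∀ {i} → i < h 0 → ∃ λ x → Bead h x × h (suc x) ≡ i
  find-bead {i} i<B = go top (≤-trans (≤-reflexive h-top) z≤n)
    where
    go : ∀ t → h t ≤ i → ∃ λ x → Bead h x × h (suc x) ≡ i
    go zero ht≤i = ⊥-elim (<⇒≱ i<B ht≤i)
    go (suc t) ht≤i with h t ≤? i
    ... | yes q = go t q
    ... | no q = t , ≤-antisym (lipschitz t) (≤-trans (s≤s ht≤i) (≰⇒> q)) ,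
                 ≤-antisym ht≤i (≤-pred (≤-trans (≰⇒> q) (lipschitz t)))

  find-gap : ∀ j → ∃ λ y → Gap h y × gaps h y ≡ j
  -- There are only `h 0` beads in all, so the first `suc j + h 0` positions contain more than `j`
  -- gaps.
  find-gap j = go (suc j + h 0) (+-cancelʳ-≤ (h 0) (suc j) _
      (≤-trans (m≤m+n (suc j + h 0) _) (≤-reflexive (sym (balance (suc j + h 0))))))
    where
    go : ∀ N → j < gaps h N → ∃ λ y → Gap h y × gaps h y ≡ j
    go zero j<g = ⊥-elim (n≮0 (<-≤-trans j<g (≤-reflexive gaps₀)))
    go (suc N) j<g with j <? gaps h N
    ... | yes q = go N q
    ... | no q with gap⊎bead N
    ...   | inj₁ e = N , e , ≤-antisym (≮⇒≥ q) (≤-pred (≤-trans j<g (≤-reflexive (gaps-gap e))))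
    ...   | inj₂ e = ⊥-elim (q (<-≤-trans j<g (≤-reflexive (gaps-bead e))))

  bead<⇔ : ∀ {x y} → Gap h y → (y < x → gaps h y < gaps h x) × (gaps h y < gaps h x → y < x)
  bead<⇔ {x} {y} e = (λ y<x → ≤-trans (≤-reflexive (sym (gaps-gap e))) (gaps-mono y<x)) ,
                     (λ q → ≰⇒> λ x≤y → <⇒≱ q (gaps-mono x≤y))

-- Here the bead of row i and the gap of column j sit at the positions
-- row i - i + B - 1 and j - col j + B, where B = h 0.
record Rep (τ : Partition) (h : ℕ → ℕ) : Set where
  field
    isPartition : IsPartition τ
    beyond : ∀ i → h 0 ≤ i → row τ i ≡ 0
    cell : ∀ {i j x} → x + i ≡ j + h 0 → (j < row τ i → i < h x) × (i < h x → j < row τ i)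

-- Counts the columns that meet the criterion of `Rep.cell`. These form an initial segment, and `t`
-- has to be a position with no beads from there on, so that none is missed.
coreRow : (ℕ → ℕ) → ℕ → ℕ → ℕ
coreRow h t i = Σ< t (λ j → 𝟙 (i <? h (j + h 0 ∸ i)))

coreOf : (ℕ → ℕ) → ℕ → Partition
coreOf h t = fromRows (coreRow h t) (h 0)

module _ {h : ℕ → ℕ} (path : IsPath h) where
  open Path path

  coreRow-cell : ∀ {i j x} → x + i ≡ j + h 0 → (j < coreRow h top i → i < h x) × (i < h x → j < coreRow h top i)
  coreRow-cell {i} {j} {x} eq =
    (λ q → subst (λ z → i < h z) pos (proj₁ (seg (<-≤-trans q (count-≤ top P?))) q)) ,
    (λ i<hx → proj₂ (seg (j<top i<hx)) (subst (λ z → i < h z) (sym pos) i<hx))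
    where
    P? : ∀ j → Dec (i < h (j + h 0 ∸ i))
    P? j = i <? h (j + h 0 ∸ i)
    seg : j < top → (j < coreRow h top i → i < h (j + h 0 ∸ i)) × (i < h (j + h 0 ∸ i) → j < coreRow h top i)
    seg = segment P? top (λ a≤b _ q → <-≤-trans q (h-anti (∸-monoˡ-≤ i (+-monoˡ-≤ (h 0) a≤b))))
    pos : j + h 0 ∸ i ≡ x
    pos = trans (cong (_∸ i) (sym eq)) (m+n∸n≡m x i)
    j<top : i < h x → j < top
    j<top i<hx = <-trans
      (+-cancelʳ-< (h 0) j x (≤-<-trans (≤-reflexive (sym eq)) (+-monoʳ-< x (<-≤-trans i<hx (h-anti z≤n)))))
      (≰⇒> λ t≤x → n≮0 (<-≤-trans i<hx (≤-reflexive (beyond-top t≤x))))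

  coreRow-antitone : ∀ i → coreRow h top (suc i) ≤ coreRow h top i
  coreRow-antitone i = Σ<-mono top λ j _ → 𝟙-mono _ (i <? h (j + h 0 ∸ i)) λ q →
    ≤-trans (≤-pred (≤-trans q (lipschitz _))) (h-anti (∸-suc≤ j))
    where
    ∸-suc≤ : ∀ j → j + h 0 ∸ i ≤ suc (j + h 0 ∸ suc i)
    ∸-suc≤ j = ≤-trans (m≤n+m∸n (j + h 0 ∸ i) 1) (≤-reflexive (cong suc (trans (∸-+-assoc (j + h 0) i 1) (cong (j + h 0 ∸_) (+-comm i 1)))))

  coreRow-beyond : ∀ i → h 0 ≤ i → coreRow h top i ≡ 0
  coreRow-beyond i B≤i = Σ<-zero top λ j _ → 𝟙-no (i <? h (j + h 0 ∸ i)) λ q →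
    <⇒≱ q (≤-trans (h-anti z≤n) B≤i)

  rep-core : Rep (coreOf h top) h
  rep-core = record
    { isPartition = IsPartition-fromRows (coreRow h top) (h 0) coreRow-antitone coreRow-beyond
    ; beyond = λ i B≤i → trans (rows i) (coreRow-beyond i B≤i)
    ; cell = λ {i} {j} eq → (λ q → proj₁ (coreRow-cell eq) (subst (j <_) (rows i) q)) ,
                            (λ q → subst (j <_) (sym (rows i)) (proj₂ (coreRow-cell eq) q))
    }
    where
    rows : ∀ i → row (coreOf h top) i ≡ coreRow h top i
    rows = row-fromRows (coreRow h top) (h 0) coreRow-antitone coreRow-beyond

-- The bead of row `i` sits at `row κ i + B - i - 1`, and the condition says that this is at least
-- `x`. Empty rows below index `B` contribute beads as well.
pathOf : Partition → ℕ → ℕ → ℕ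
pathOf κ B x = Σ< B (λ i → 𝟙 (x + i <? row κ i + B))

module _ {κ : Partition} (p : IsPartition κ) {B : ℕ} (rows-beyond : ∀ i → B ≤ i → row κ i ≡ 0) where

  pathOf₀ : pathOf κ B 0 ≡ B
  pathOf₀ = count-all B _ (λ i i<B → <-≤-trans i<B (m≤n+m B (row κ i)))

  pathOf-segment : ∀ x {i} → i < B → (i < pathOf κ B x → x + i < row κ i + B) × (x + i < row κ i + B → i < pathOf κ B x)
  pathOf-segment x = segment (λ i → x + i <? row κ i + B) B
    (λ i≤j _ q → ≤-<-trans (+-monoʳ-≤ x i≤j) (<-≤-trans q (+-monoˡ-≤ B (row-anti i≤j))))
    where
    row-anti : ∀ {i j} → i ≤ j → row κ j ≤ row κ i
    row-anti {i} {j} i≤j = subst (λ z → row κ z ≤ row κ i) (trans (+-comm (j ∸ i) i) (m+[n∸m]≡n i≤j)) (go (j ∸ i))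
      where
      go : ∀ d → row κ (d + i) ≤ row κ i
      go zero = ≤-refl
      go (suc d) = ≤-trans (row-antitone p (d + i)) (go d)

  isPath-pathOf : IsPath (pathOf κ B)
  isPath-pathOf = record
    { antitone = λ x → Σ<-mono B (λ i _ → 𝟙-mono (suc x + i <? row κ i + B) (x + i <? row κ i + B) <⇒≤)
    ; lipschitz = λ x → ≤-ext λ { zero _ → s≤s z≤n ; (suc i) q → s≤s (step x i q) }
    ; top = row κ 0 + B
    ; h-top = Σ<-zero B λ i _ → 𝟙-no (row κ 0 + B + i <? row κ i + B) λ q →
        <⇒≱ q (≤-trans (+-monoˡ-≤ B (row≤row₀ p i)) (m≤m+n (row κ 0 + B) i))
    }
    where
    step : ∀ x i → suc i < pathOf κ B x → i < pathOf κ B (suc x)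
    step x i q = proj₂ (pathOf-segment (suc x) (<-trans (n<1+n i) si<B))
      (≤-<-trans (≤-reflexive (sym (+-suc x i)))
        (<-≤-trans (proj₁ (pathOf-segment x si<B) q) (+-monoˡ-≤ B (row-antitone p i))))
      where si<B = <-≤-trans q (count-≤ B (λ i → x + i <? row κ i + B))

  rep-pathOf : Rep κ (pathOf κ B)
  rep-pathOf = record
    { isPartition = p
    ; beyond = λ i q → rows-beyond i (subst (_≤ i) pathOf₀ q)
    ; cell = λ {i} {j} {x} eq →
        let eq′ = trans eq (cong (j +_) pathOf₀) in
        (λ j<r → proj₂ (pathOf-segment x (≰⇒> λ B≤i → n≮0 (<-≤-trans j<r (≤-reflexive (rows-beyond i B≤i)))))
                   (subst (_< row κ i + B) (sym eq′) (+-monoˡ-< B j<r))) ,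
        (λ i<h → +-cancelʳ-< B j (row κ i) (subst (_< row κ i + B) eq′
                   (proj₁ (pathOf-segment x (<-≤-trans i<h (count-≤ B (λ i → x + i <? row κ i + B)))) i<h)))
    }

-- Cells and hooks

∈cellsFrom⁺ : ∀ m xs {i j} → j < row xs i → (m + i , j) ∈ cellsFrom m xs
∈cellsFrom⁺ m (x ∷ xs) {zero} {j} j<x rewrite +-identityʳ m = ∈-++⁺ˡ (∈-map⁺ (m ,_) (∈-upTo⁺ j<x))
∈cellsFrom⁺ m (x ∷ xs) {suc i} {j} j<r rewrite +-suc m i = ∈-++⁺ʳ _ (∈cellsFrom⁺ (suc m) xs j<r)

∈cellsFrom⁻ : ∀ m xs {c} → c ∈ cellsFrom m xs → ∃ λ i → proj₁ c ≡ m + i × proj₂ c < row xs i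
∈cellsFrom⁻ m (x ∷ xs) c∈ with ∈-++⁻ (map (m ,_) (upTo x)) c∈
... | inj₁ q with ∈-map⁻ (m ,_) q
...   | j , j∈ , refl = 0 , sym (+-identityʳ m) , ∈-upTo⁻ j∈
∈cellsFrom⁻ m (x ∷ xs) c∈ | inj₂ q with ∈cellsFrom⁻ (suc m) xs q
...   | i , e , r = suc i , trans e (sym (+-suc m i)) , r

∈cells⁺ : ∀ τ {i j} → j < row τ i → (i , j) ∈ cells τ
∈cells⁺ τ = ∈cellsFrom⁺ 0 τ

∈cells⁻ : ∀ τ {i j} → (i , j) ∈ cells τ → j < row τ i
∈cells⁻ τ c∈ with ∈cellsFrom⁻ 0 τ c∈
... | i , refl , r = r

rowCount : ℕ → Partition → ℕ → ℕ
rowCount k κ i = length (filter (λ j → hook κ (i , j) ≤? k) (upTo (row κ i)))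

pRows-applyUpTo : ∀ k κ m xs → (∀ i → row xs i ≡ row κ (m + i)) →
  pRows k κ m xs ≡ applyUpTo (λ i → rowCount k κ (m + i)) (length xs)
pRows-applyUpTo k κ m [] h = refl
pRows-applyUpTo k κ m (x ∷ xs) h = cong₂ _∷_ first rest
  where
  first : length (filter (λ j → hook κ (m , j) ≤? k) (upTo x)) ≡ rowCount k κ (m + 0)
  first rewrite +-identityʳ m = cong (λ z → length (filter (λ j → hook κ (m , j) ≤? k) (upTo z))) (trans (h 0) (cong (row κ) (+-identityʳ m)))
  rest : pRows k κ (suc m) xs ≡ applyUpTo (λ i → rowCount k κ (m + suc i)) (length xs)
  rest = trans (pRows-applyUpTo k κ (suc m) xs (λ i → trans (h (suc i)) (cong (row κ) (+-suc m i))))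
               (applyUpTo-cong (length xs) (λ i → cong (rowCount k κ) (sym (+-suc m i))))
    where
    applyUpTo-cong : ∀ {f f′ : ℕ → ℕ} n → (∀ i → f i ≡ f′ i) → applyUpTo f n ≡ applyUpTo f′ n
    applyUpTo-cong zero e = refl
    applyUpTo-cong (suc n) e = cong₂ _∷_ (e 0) (applyUpTo-cong n (e ∘ suc))

rowCount-beyond : ∀ k κ i → row κ i ≡ 0 → rowCount k κ i ≡ 0
rowCount-beyond k κ i e rewrite e = refl

𝔭-fromRows : ∀ k κ → 𝔭 k κ ≡ fromRows (rowCount k κ) (length κ)
𝔭-fromRows k κ = cong (filter (0 <?_)) (pRows-applyUpTo k κ 0 κ (λ _ → refl))

size-rows : ∀ k κ → size≤ k κ ≡ Σ< (length κ) (rowCount k κ)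
size-rows k κ = go 0 κ (λ _ → refl)
  where
  small? = λ (c : Cell) → hook κ c ≤? k
  length-filter-map : ∀ m js → length (filter small? (map (m ,_) js)) ≡ length (filter (λ j → hook κ (m , j) ≤? k) js)
  length-filter-map m [] = refl
  length-filter-map m (j ∷ js) = trans (length-filter-any small? (m , j) (map (m ,_) js))
    (trans (cong (𝟙 (small? (m , j)) +_) (length-filter-map m js)) (sym (length-filter-∷ (λ j → hook κ (m , j) ≤? k) j js)))
    where
    length-filter-any : {A : Set} {P : A → Set} (P? : ∀ a → Dec (P a)) → ∀ x xs →
      length (filter P? (x ∷ xs)) ≡ 𝟙 (P? x) + length (filter P? xs)
    length-filter-any P? x xs with P? x
    ... | yes _ = refl
    ... | no _ = refl
  go : ∀ m xs → (∀ i → row xs i ≡ row κ (m + i)) →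
    length (filter small? (cellsFrom m xs)) ≡ Σ< (length xs) (λ i → rowCount k κ (m + i))
  go m [] h = refl
  go m (x ∷ xs) h = begin
    length (filter small? (map (m ,_) (upTo x) ++ cellsFrom (suc m) xs))
      ≡⟨ cong length (filter-++ small? (map (m ,_) (upTo x)) (cellsFrom (suc m) xs)) ⟩
    length (filter small? (map (m ,_) (upTo x)) ++ filter small? (cellsFrom (suc m) xs))
      ≡⟨ length-++ (filter small? (map (m ,_) (upTo x))) ⟩
    length (filter small? (map (m ,_) (upTo x))) + length (filter small? (cellsFrom (suc m) xs))
      ≡⟨ cong₂ _+_ (length-filter-map m (upTo x)) (go (suc m) xs (λ i → trans (h (suc i)) (cong (row κ) (+-suc m i)))) ⟩
    length (filter (λ j → hook κ (m , j) ≤? k) (upTo x)) + Σ< (length xs) (λ i → rowCount k κ (suc m + i))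
      ≡⟨ cong₂ _+_ first (Σ<-cong (length xs) (λ i _ → cong (rowCount k κ) (sym (+-suc m i)))) ⟩
    rowCount k κ (m + 0) + Σ< (length xs) (λ i → rowCount k κ (m + suc i))
      ≡⟨ Σ<-front (length xs) (λ i → rowCount k κ (m + i)) ⟨
    Σ< (suc (length xs)) (λ i → rowCount k κ (m + i)) ∎
    where
    open ≡-Reasoning
    first : length (filter (λ j → hook κ (m , j) ≤? k) (upTo x)) ≡ rowCount k κ (m + 0)
    first rewrite +-identityʳ m = cong (λ z → length (filter (λ j → hook κ (m , j) ≤? k) (upTo z))) (trans (h 0) (cong (row κ) (+-identityʳ m)))

∸-balance : ∀ {a q x y} → a + y ≡ x + q → a ∸ q ≡ x ∸ y
∸-balance {a} {q} {x} {y} e = begin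
  a ∸ q               ≡⟨ [m+n]∸[m+o]≡n∸o y a q ⟨
  y + a ∸ (y + q)     ≡⟨ cong₂ _∸_ (trans (+-comm y a) (trans e (+-comm x q))) (+-comm y q) ⟩
  q + x ∸ (q + y)     ≡⟨ [m+n]∸[m+o]≡n∸o q x y ⟩
  x ∸ y               ∎
  where open ≡-Reasoning

module RepPath {τ : Partition} {h : ℕ → ℕ} (rep : Rep τ h) (path : IsPath h) where
  open Rep rep public
  open Path path public

  bead-pos : ∀ {x} → Bead h x → gaps h x + h 0 ≡ x + suc (h (suc x))
  bead-pos {x} b = trans (balance x) (cong (x +_) b)

  row-bead : ∀ {x} → Bead h x → row τ (h (suc x)) ≡ gaps h x
  row-bead {x} b = ≤-antisym
    (≮⇒≥ λ q → <-irrefl refl (proj₁ (cell {x = suc x} (trans (sym (+-suc x _)) (sym (bead-pos b)))) q))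
    (≤-ext λ j j<g → <-≤-trans (n<1+n j) (≤-trans j<g (bound (gaps h x) refl)))
    where
    bound : ∀ m → gaps h x ≡ m → m ≤ row τ (h (suc x))
    bound zero e = z≤n
    bound (suc m) e = proj₂ (cell {x = x} (suc-injective (trans (sym (+-suc x (h (suc x)))) (trans (sym (bead-pos b)) (cong (_+ h 0) e)))))
                        (≤-reflexive (sym b))

  col-gap : ∀ {y} → Gap h y → col τ (gaps h y) ≡ h y
  col-gap {y} e = ≤-antisym
    (≮⇒≥ λ q → <-irrefl refl (proj₁ (cell {x = y} (sym (balance y))) (proj₁ (<col⇔<row isPartition) q)))
    (bound (h y) refl)
    where
    bound : ∀ m → h y ≡ m → m ≤ col τ (gaps h y)
    bound zero _ = z≤n
    bound (suc m) eq = proj₂ (<col⇔<row isPartition) (proj₂ (cell {x = suc y}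
      (trans (sym (+-suc y m)) (trans (cong (y +_) (sym eq)) (sym (balance y)))))
      (≤-reflexive (sym (trans e eq))))

  -- The rim of the hook is the stretch of boundary from the gap of its column to the bead of its
  -- row. From here on hook lengths are distances between positions.
  hook-eq : ∀ {x y} → Bead h x → Gap h y → hook τ (h (suc x) , gaps h y) ≡ x ∸ y
  hook-eq {x} {y} b e rewrite row-bead b | col-gap e = ∸-balance {a = gaps h x + h y} (+-cancelʳ-≡ (h 0) _ _ (begin
    gaps h x + h y + y + h 0                    ≡⟨ shuffle (gaps h x) (h y) y (h 0) ⟩
    (gaps h x + h 0) + (y + h y)                ≡⟨ cong₂ _+_ (bead-pos b) (sym (balance y)) ⟩
    (x + suc (h (suc x))) + (gaps h y + h 0)    ≡⟨ shuffle′ x (h (suc x)) (gaps h y) (h 0) ⟩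
    x + (h (suc x) + gaps h y + 1) + h 0        ∎))
    where
    open ≡-Reasoning
    shuffle : ∀ a b c d → a + b + c + d ≡ (a + d) + (c + b)
    shuffle = ℕ-Solver.solve-∀
    shuffle′ : ∀ a b c d → (a + suc b) + (c + d) ≡ a + (b + c + 1) + d
    shuffle′ = ℕ-Solver.solve-∀

  row-bound : ∀ {i j} → j < row τ i → i < h 0
  row-bound {i} j<r = ≰⇒> λ B≤i → n≮0 (<-≤-trans j<r (≤-reflexive (beyond i B≤i)))

  cell-bead-gap : ∀ {x y} → Bead h x → Gap h y →
    (gaps h y < row τ (h (suc x)) → y < x) × (y < x → gaps h y < row τ (h (suc x)))
  cell-bead-gap b e rewrite row-bead b = proj₂ (bead<⇔ e) , proj₁ (bead<⇔ e)

  flush⇒core : ∀ {k} → Flush (suc k) h → IsCore k τ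
  flush⇒core {k} flush = All.tabulate λ { {i , j} c∈ → no-hook i j (∈cells⁻ τ c∈) }
    where
    no-hook : ∀ i j → j < row τ i → hook τ (i , j) ≢ suc k
    no-hook i j j<r eq with find-bead (row-bound j<r) | find-gap j
    ... | x , b , refl | y , e , refl = ¬gap∧bead (subst (Gap h) x≡ (flush y e)) b
      where
      y<x : y < x
      y<x = proj₁ (cell-bead-gap b e) j<r
      x≡ : y + suc k ≡ x
      x≡ = trans (cong (y +_) (sym (trans (sym (hook-eq b e)) eq))) (m+[n∸m]≡n (<⇒≤ y<x))

  core⇒flush : ∀ {k} → IsCore k τ → Flush (suc k) h
  core⇒flush {k} core y e with gap⊎bead (y + suc k)
  ... | inj₁ e′ = e′
  ... | inj₂ b = ⊥-elim (All.lookup core (∈cells⁺ τ (proj₂ (cell-bead-gap b e) (m<m+n y (s≤s z≤n))))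
                          (trans (hook-eq b e) (m+n∸m≡n y (suc k))))

  -- In the row of `x` a hook of length at most `k` belongs to a gap between `x - k` and `x`.
  rowCount-bead : ∀ k {x} → Bead h x → rowCount k τ (h (suc x)) ≡ gaps h x ∸ gaps h (x ∸ k)
  rowCount-bead k {x} b = begin
    rowCount k τ i                              ≡⟨ length-filter-applyUpTo (λ j → hook τ (i , j) ≤? k) id (row τ i) ⟩
    Σ< (row τ i) (λ j → 𝟙 (hook τ (i , j) ≤? k))  ≡⟨ Σ<-cong (row τ i) (λ j _ → 𝟙-⇔ _ _ (to j) (from j)) ⟩
    Σ< (row τ i) (λ j → 𝟙 (gaps h (x ∸ k) ≤? j))  ≡⟨ count-from (row τ i) (gaps h (x ∸ k)) ⟩
    row τ i ∸ gaps h (x ∸ k)                    ≡⟨ cong (_∸ gaps h (x ∸ k)) (row-bead b) ⟩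
    gaps h x ∸ gaps h (x ∸ k)                   ∎
    where
    open ≡-Reasoning
    i = h (suc x)
    to : ∀ j → hook τ (i , j) ≤ k → gaps h (x ∸ k) ≤ j
    to j q with find-gap j
    ... | y , e , refl = gaps-mono (m≤n+o⇒m∸n≤o x k (≤-trans (m∸n≤o⇒m≤n+o x y (≤-trans (≤-reflexive (sym (hook-eq b e))) q)) (≤-reflexive (+-comm y k))))
    from : ∀ j → gaps h (x ∸ k) ≤ j → hook τ (i , j) ≤ k
    from j q with find-gap j
    ... | y , e , refl = ≤-trans (≤-reflexive (hook-eq b e))
      (m≤n+o⇒m∸n≤o x y (≤-trans (m∸n≤o⇒m≤n+o x k (≮⇒≥ λ y< → <⇒≱ (proj₁ (bead<⇔ e) y<) q)) (≤-reflexive (+-comm k y))))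

  count-interval : ∀ {N a} b → a ≤ N → Σ< N (λ i → 𝟙 ((i <? a) ×-dec (b ≤? i))) ≡ a ∸ b
  count-interval {N} {a} b a≤N =
    trans (Σ<-extend _ a≤N (λ i a≤i → 𝟙-no ((i <? a) ×-dec (b ≤? i)) (λ { (i<a , _) → <⇒≱ i<a a≤i })))
    (trans (Σ<-cong a (λ i i<a → 𝟙-⇔ ((i <? a) ×-dec (b ≤? i)) (b ≤? i) proj₂ (i<a ,_))) (count-from a b))

  Σ<-gaps : ∀ (f : ℕ → ℕ) Y → Σ< (gaps h Y) f ≡ Σ< Y (λ y → 𝟙 (gap? h y) * f (gaps h y))
  Σ<-gaps f zero = cong (λ z → Σ< z f) gaps₀
  Σ<-gaps f (suc Y) with gap? h Y
  ... | yes e = trans (cong (λ z → Σ< z f) (gaps-gap e)) (cong₂ _+_ (Σ<-gaps f Y) (sym (+-identityʳ _)))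
  ... | no ne with gap⊎bead Y
  ...   | inj₁ e = ⊥-elim (ne e)
  ...   | inj₂ b = trans (cong (λ z → Σ< z f) (gaps-bead b)) (trans (Σ<-gaps f Y) (sym (+-identityʳ _)))

  -- Counting by columns: the short hooks in the column of the gap `y` end at the beads between `y`
  -- and `y + suc k`. Summing over positions instead of column indices lets the sizes of two
  -- diagrams be compared place by place.
  size-gaps : ∀ k {Y} → top ≤ Y → size≤ k τ ≡ Σ< Y (λ y → 𝟙 (gap? h y) * (h y ∸ h (y + suc k)))
  size-gaps k {Y} t≤Y = begin
    size≤ k τ                                                    ≡⟨ size-rows k τ ⟩
    Σ< (length τ) (rowCount k τ)                                 ≡⟨ Σ<-extend (rowCount k τ) (m≤m+n (length τ) (h 0)) (λ i q → rowCount-beyond k τ i (row-beyond τ q)) ⟨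
    Σ< (length τ + h 0) (rowCount k τ)                           ≡⟨ Σ<-extend (rowCount k τ) (m≤n+m (h 0) (length τ)) (λ i q → rowCount-beyond k τ i (beyond i q)) ⟩
    Σ< (h 0) (rowCount k τ)                                      ≡⟨ Σ<-cong (h 0) (λ i _ → row-sum i) ⟩
    Σ< (h 0) (λ i → Σ< (gaps h Y) (λ j → 𝟙 (small? i j)))        ≡⟨ Σ<-swap (h 0) (gaps h Y) (λ i j → 𝟙 (small? i j)) ⟩
    Σ< (gaps h Y) (λ j → Σ< (h 0) (λ i → 𝟙 (small? i j)))        ≡⟨ Σ<-gaps _ Y ⟩
    Σ< Y (λ y → 𝟙 (gap? h y) * Σ< (h 0) (λ i → 𝟙 (small? i (gaps h y))))
      ≡⟨ Σ<-cong Y (λ y _ → column y (gap? h y)) ⟩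
    Σ< Y (λ y → 𝟙 (gap? h y) * (h y ∸ h (y + suc k)))            ∎
    where
    open ≡-Reasoning
    small? : ∀ i j → Dec (j < row τ i × hook τ (i , j) ≤ k)
    small? i j = (j <? row τ i) ×-dec (hook τ (i , j) ≤? k)
    row≤ : ∀ i → row τ i ≤ gaps h Y
    row≤ i = ≤-ext λ j j<r → help i j j<r
      where
      help : ∀ i j → j < row τ i → j < gaps h Y
      help i j j<r with find-bead (row-bound j<r)
      ... | x , b , refl = <-≤-trans (<-≤-trans j<r (≤-reflexive (row-bead b))) (gaps-mono (≤-trans (<⇒≤ (≰⇒> λ t≤x →
              1+n≢0 (trans (sym b) (beyond-top t≤x)))) t≤Y))
    row-sum : ∀ i → rowCount k τ i ≡ Σ< (gaps h Y) (λ j → 𝟙 (small? i j))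
    row-sum i = trans (length-filter-applyUpTo (λ j → hook τ (i , j) ≤? k) id (row τ i))
      (sym (trans (Σ<-extend _ (row≤ i) (λ j r≤j → 𝟙-no (small? i j) (λ { (j<r , _) → <⇒≱ j<r r≤j })))
                  (Σ<-cong (row τ i) (λ j j<r → 𝟙-⇔ (small? i j) (hook τ (i , j) ≤? k) proj₂ (j<r ,_)))))
    to : ∀ y → Gap h y → ∀ i → i < h 0 → gaps h y < row τ i × hook τ (i , gaps h y) ≤ k → i < h y × h (y + suc k) ≤ i
    to y e i i<B (c , s) with find-bead i<B
    ... | x , b , refl = ≤-trans (≤-reflexive (sym b)) (≤-trans (h-anti y<x) (≤-reflexive e)) ,
                         h-anti (≤-trans (s≤s x≤) (≤-reflexive (sym (+-suc y k))))
      where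
      y<x = proj₁ (cell-bead-gap b e) c
      x≤ : x ≤ y + k
      x≤ = m∸n≤o⇒m≤n+o x y (≤-trans (≤-reflexive (sym (hook-eq b e))) s)
    from : ∀ y → Gap h y → ∀ i → i < h 0 → i < h y × h (y + suc k) ≤ i → gaps h y < row τ i × hook τ (i , gaps h y) ≤ k
    from y e i i<B (c , s) with find-bead i<B
    ... | x , b , refl = proj₂ (cell-bead-gap b e) y<x ,
                         ≤-trans (≤-reflexive (hook-eq b e)) (m≤n+o⇒m∸n≤o x y (≤-pred (≤-trans x< (≤-reflexive (+-suc y k)))))
      where
      y<x : y < x
      y<x = ≰⇒> λ x≤y → <⇒≱ c (≤-trans (≤-reflexive (sym e)) (h-anti (s≤s x≤y)))
      x< : x < y + suc k
      x< = ≰⇒> λ q → <⇒≱ (n<1+n (h (suc x))) (≤-trans (≤-reflexive (sym b)) (≤-trans (h-anti q) s))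
    column : ∀ y (d : Dec (Gap h y)) →
      𝟙 d * Σ< (h 0) (λ i → 𝟙 (small? i (gaps h y))) ≡ 𝟙 d * (h y ∸ h (y + suc k))
    column y (no _) = refl
    column y (yes e) = cong (1 *_) (trans
      (Σ<-cong (h 0) (λ i i<B → 𝟙-⇔ (small? i (gaps h y)) ((i <? h y) ×-dec (h (y + suc k) ≤? i)) (to y e i i<B) (from y e i i<B)))
      (count-interval (h (y + suc k)) (h-anti z≤n)))

-- The boundary paths of a horizontal strip κ/τ: every column of κ, viewed as
-- a gap, is a column of τ moved left by at most one step.
Interlaced : (ℕ → ℕ) → (ℕ → ℕ) → Set
Interlaced h h′ = ∀ x → h x ≤ h′ x × h′ x ≤ suc (h (suc x))

module _ {τ κ : Partition} {h h′ : ℕ → ℕ} (rep : Rep τ h) (path : IsPath h) (rep′ : Rep κ h′) (path′ : IsPath h′)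
         (same : h′ 0 ≡ h 0) where
  private
    module A = RepPath rep path
    module B = RepPath rep′ path′

  strip⇒interlaced : Contained τ κ → Horizontal τ κ → Interlaced h h′
  strip⇒interlaced sub hor x = ≤-ext below , ≤-ext above
    where
    below : ∀ i → i < h x → i < h′ x
    below i i<h with h 0 ≤? x + i
    ... | yes q = proj₁ (B.cell (trans e (cong (_ +_) (sym same)))) (<-≤-trans (proj₂ (A.cell e) i<h) (sub i))
      where
      e : x + i ≡ (x + i ∸ h 0) + h 0
      e = sym (m∸n+n≡m q)
    -- With `x + i < h 0` the position corresponds to no column, so there is no cell to compare; the
    -- bound `h₀≤`, valid for every path, suffices.
    ... | no q = +-cancelˡ-< x i (h′ x) (<-≤-trans (≰⇒> q) (≤-trans (≤-reflexive (sym same)) (B.h₀≤ x)))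
    above : ∀ i → i < h′ x → i < suc (h (suc x))
    above zero _ = s≤s z≤n
    above (suc i) i<h with h 0 ≤? x + suc i
    ... | yes q = s≤s (proj₁ (A.cell (trans (sym (+-suc x i)) e)) (proj₁ (<col⇔<row A.isPartition)
                    (≤-pred (≤-trans (proj₂ (<col⇔<row B.isPartition) (proj₂ (B.cell (trans e (cong (_ +_) (sym same)))) i<h)) (hor _)))))
      where
      e : x + suc i ≡ (x + suc i ∸ h 0) + h 0
      e = sym (m∸n+n≡m q)
    ... | no q = s≤s (+-cancelˡ-< (suc x) i _ (<-≤-trans (≤-<-trans (≤-reflexive (sym (+-suc x i))) (≰⇒> q)) (A.h₀≤ (suc x))))

  interlaced⇒strip : Interlaced h h′ → Contained τ κ × Horizontal τ κ
  interlaced⇒strip il = (λ i → ≤-ext (sub i)) , (λ j → ≤-ext (hor j))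
    where
    sub : ∀ i j → j < row τ i → j < row κ i
    sub i j j<r = proj₂ (B.cell (trans e (cong (j +_) (sym same)))) (<-≤-trans (proj₁ (A.cell e) j<r) (proj₁ (il _)))
      where
      e : (j + h 0 ∸ i) + i ≡ j + h 0
      e = m∸n+n≡m (≤-trans (<⇒≤ (A.row-bound j<r)) (m≤n+m (h 0) j))
    hor : ∀ j i → i < col κ j → i < suc (col τ j)
    hor j zero _ = s≤s z≤n
    hor j (suc i) q = s≤s (proj₂ (<col⇔<row A.isPartition) (proj₂ (A.cell (trans (sym (+-suc x i)) e))
      (≤-pred (<-≤-trans (proj₁ (B.cell (trans e (cong (j +_) (sym same)))) si<r) (proj₂ (il x))))))
      where
      si<r : j < row κ (suc i)
      si<r = proj₁ (<col⇔<row B.isPartition) q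
      x = j + h 0 ∸ suc i
      e : x + suc i ≡ j + h 0
      e = m∸n+n≡m (≤-trans (<⇒≤ (<-≤-trans (B.row-bound si<r) (≤-reflexive same))) (m≤n+m (h 0) j))

-- Moved gaps and the growth of the size

𝟙-gap : ∀ {h} (path : IsPath h) x → 𝟙 (gap? h x) + h x ≡ suc (h (suc x))
𝟙-gap {h} path x with gap? h x
... | yes e = cong suc (sym e)
... | no ne with Path.gap⊎bead path x
...   | inj₁ e = ⊥-elim (ne e)
...   | inj₂ b = b

module Strip {h h′ : ℕ → ℕ} (path : IsPath h) (path′ : IsPath h′) (same : h′ 0 ≡ h 0) (il : Interlaced h h′) where
  private
    module A = Path path
    module B = Path path′

  -- With the same number of beads in total, one more bead from `x` on means one more gap below `x`:
  -- the gap of `h` at `x` has stepped to `x - 1`.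
  Moved : ℕ → Set
  Moved x = h x < h′ x

  moved? : ∀ x → Dec (Moved x)
  moved? x = h x <? h′ x

  mv : ℕ → ℕ
  mv x = 𝟙 (moved? x)

  ¬moved₀ : ¬ Moved 0
  ¬moved₀ q = <-irrefl (sym same) q

  h′≡ : ∀ x → h′ x ≡ h x + mv x
  h′≡ x with moved? x
  ... | yes q = trans (≤-antisym (≤-trans (proj₂ (il x)) (s≤s (A.antitone x))) q) (+-comm 1 (h x))
  ... | no q = trans (≤-antisym (≮⇒≥ q) (proj₁ (il x))) (sym (+-identityʳ (h x)))

  moved⇒gap : ∀ {x} → Moved x → Gap h x
  moved⇒gap {x} q with A.gap⊎bead x
  ... | inj₁ e = e
  ... | inj₂ b = ⊥-elim (<-irrefl b (<-≤-trans q (proj₂ (il x))))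

  moved⇒gap′ : ∀ {x} → Moved (suc x) → Gap h′ x
  moved⇒gap′ {x} q = ≤-antisym (B.antitone x) (≤-trans (proj₂ (il x)) q)

  -- Conservation of gaps at position `x`: `mv x` is what leaves to the left and `mv (suc x)` what
  -- arrives from the right.
  gap-balance : ∀ x → 𝟙 (gap? h′ x) + mv x ≡ 𝟙 (gap? h x) + mv (suc x)
  gap-balance x = +-cancelʳ-≡ (h x) _ _ (begin
    γ′ + mv x + h x                ≡⟨ shuffle γ′ (mv x) (h x) ⟩
    γ′ + (h x + mv x)              ≡⟨ cong (γ′ +_) (h′≡ x) ⟨
    γ′ + h′ x                      ≡⟨ 𝟙-gap path′ x ⟩
    suc (h′ (suc x))               ≡⟨ cong suc (h′≡ (suc x)) ⟩
    suc (h (suc x)) + mv (suc x)   ≡⟨ cong (_+ mv (suc x)) (𝟙-gap path x) ⟨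
    γ + h x + mv (suc x)           ≡⟨ shuffle′ γ (h x) (mv (suc x)) ⟩
    γ + mv (suc x) + h x           ∎)
    where
    open ≡-Reasoning
    γ = 𝟙 (gap? h x)
    γ′ = 𝟙 (gap? h′ x)
    shuffle : ∀ a b c → a + b + c ≡ a + (c + b)
    shuffle = ℕ-Solver.solve-∀
    shuffle′ : ∀ a b c → a + b + c ≡ a + c + b
    shuffle′ = ℕ-Solver.solve-∀

  module _ (n : ℕ) (flush′ : Flush n h′) where
    private
      θ θ′ γ γ′ : ℕ → ℕ
      θ y = h y ∸ h (y + n)
      θ′ y = h′ y ∸ h′ (y + n)
      γ y = 𝟙 (gap? h y)
      γ′ y = 𝟙 (gap? h′ y)

      θ-balance : ∀ y → θ′ y + mv (y + n) ≡ θ y + mv y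
      θ-balance y = +-cancelʳ-≡ (h (y + n)) _ _ (begin
        θ′ y + mv (y + n) + h (y + n)     ≡⟨ shuffle (θ′ y) (mv (y + n)) (h (y + n)) ⟩
        θ′ y + (h (y + n) + mv (y + n))   ≡⟨ cong (θ′ y +_) (h′≡ (y + n)) ⟨
        θ′ y + h′ (y + n)                 ≡⟨ m∸n+n≡m (B.h-anti (m≤m+n y n)) ⟩
        h′ y                              ≡⟨ h′≡ y ⟩
        h y + mv y                        ≡⟨ cong (_+ mv y) (m∸n+n≡m (A.h-anti (m≤m+n y n))) ⟨
        θ y + h (y + n) + mv y            ≡⟨ shuffle′ (θ y) (h (y + n)) (mv y) ⟩
        θ y + mv y + h (y + n)            ∎)
        where
        open ≡-Reasoning
        shuffle : ∀ a b c → a + b + c ≡ a + (c + b)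
        shuffle = ℕ-Solver.solve-∀
        shuffle′ : ∀ a b c → a + b + c ≡ a + c + b
        shuffle′ = ℕ-Solver.solve-∀

      -- After a move into position y, both y and y + n are gaps of h′.
      θ′-shift : ∀ y → mv (suc y) * θ′ y ≡ mv (suc y) * θ′ (suc y)
      θ′-shift y with moved? (suc y)
      ... | no _ = refl
      ... | yes q = cong (1 *_) (sym (cong₂ _∸_ (moved⇒gap′ q) (flush′ y (moved⇒gap′ q))))

      γ-mv : ∀ y → γ y * mv y ≡ mv y
      γ-mv y with moved? y
      ... | no _ = *-zeroʳ (γ y)
      ... | yes q = trans (*-identityʳ (γ y)) (𝟙-yes (gap? h y) (moved⇒gap q))

      -- The local form of `size-balance`. A moving gap carries its weight `θ′` along, and this flux
      -- `mv y * θ′ y` telescopes; it vanishes at 0 and beyond the top.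
      step : ∀ y → γ′ y * θ′ y + γ y * mv (y + n) + mv y * θ′ y ≡ γ y * θ y + mv y + mv (suc y) * θ′ (suc y)
      step y = begin
        γ′ y * θ′ y + γ y * mv (y + n) + mv y * θ′ y
          ≡⟨ collect (γ′ y) (θ′ y) (γ y * mv (y + n)) (mv y) ⟩
        (γ′ y + mv y) * θ′ y + γ y * mv (y + n)
          ≡⟨ cong (λ z → z * θ′ y + γ y * mv (y + n)) (gap-balance y) ⟩
        (γ y + mv (suc y)) * θ′ y + γ y * mv (y + n)
          ≡⟨ collect′ (γ y) (mv (suc y)) (θ′ y) (mv (y + n)) ⟩
        γ y * (θ′ y + mv (y + n)) + mv (suc y) * θ′ y
          ≡⟨ cong₂ _+_ (trans (cong (γ y *_) (θ-balance y)) (*-distribˡ-+ (γ y) (θ y) (mv y))) (θ′-shift y) ⟩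
        γ y * θ y + γ y * mv y + mv (suc y) * θ′ (suc y)
          ≡⟨ cong (λ z → γ y * θ y + z + mv (suc y) * θ′ (suc y)) (γ-mv y) ⟩
        γ y * θ y + mv y + mv (suc y) * θ′ (suc y) ∎
        where
        open ≡-Reasoning
        collect : ∀ a b c d → a * b + c + d * b ≡ (a + d) * b + c
        collect = ℕ-Solver.solve-∀
        collect′ : ∀ a b c d → (a + b) * c + a * d ≡ a * (c + d) + b * c
        collect′ = ℕ-Solver.solve-∀

      partial : ∀ Y → Σ< Y (λ y → γ′ y * θ′ y) + Σ< Y (λ y → γ y * mv (y + n))
                    ≡ Σ< Y (λ y → γ y * θ y) + Σ< Y mv + mv Y * θ′ Y
      partial zero = sym (cong (_* θ′ 0) (𝟙-no (moved? 0) ¬moved₀))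
      partial (suc Y) = +-cancelʳ-≡ (mv Y * θ′ Y) _ _ (begin
        (a + γ′ Y * θ′ Y) + (b + γ Y * mv (Y + n)) + mv Y * θ′ Y
          ≡⟨ regroup a (γ′ Y * θ′ Y) b (γ Y * mv (Y + n)) (mv Y * θ′ Y) ⟩
        (a + b) + (γ′ Y * θ′ Y + γ Y * mv (Y + n) + mv Y * θ′ Y)
          ≡⟨ cong₂ _+_ (partial Y) (step Y) ⟩
        (c + d + mv Y * θ′ Y) + (γ Y * θ Y + mv Y + mv (suc Y) * θ′ (suc Y))
          ≡⟨ regroup′ c d (mv Y * θ′ Y) (γ Y * θ Y) (mv Y) (mv (suc Y) * θ′ (suc Y)) ⟩
        (c + γ Y * θ Y) + (d + mv Y) + mv (suc Y) * θ′ (suc Y) + mv Y * θ′ Y ∎)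
        where
        open ≡-Reasoning
        a = Σ< Y (λ y → γ′ y * θ′ y)
        b = Σ< Y (λ y → γ y * mv (y + n))
        c = Σ< Y (λ y → γ y * θ y)
        d = Σ< Y mv
        regroup : ∀ a b c d e → (a + b) + (c + d) + e ≡ (a + c) + (b + d + e)
        regroup = ℕ-Solver.solve-∀
        regroup′ : ∀ a b c d e f → (a + b + c) + (d + e + f) ≡ (a + d) + (b + e) + f + c
        regroup′ = ℕ-Solver.solve-∀

    ¬moved-beyond : ∀ {x} → B.top ≤ x → ¬ Moved x
    ¬moved-beyond t≤x q = n≮0 (<-≤-trans q (≤-reflexive (B.beyond-top t≤x)))

    -- The two correction sums count the moved gaps that lie `n` above a gap of `h`, and all moved
    -- gaps. Their difference, the growth of the size, is the number of moved gaps that are lowest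
    -- in their class.
    size-balance : ∀ {Y} → B.top ≤ Y →
      Σ< Y (λ y → 𝟙 (gap? h′ y) * (h′ y ∸ h′ (y + n))) + Σ< Y (λ y → 𝟙 (gap? h y) * mv (y + n))
      ≡ Σ< Y (λ y → 𝟙 (gap? h y) * (h y ∸ h (y + n))) + Σ< Y mv
    size-balance {Y} t≤Y = trans (partial Y)
      (trans (cong (λ z → Σ< Y (λ y → γ y * θ y) + Σ< Y mv + z * θ′ Y) (𝟙-no (moved? Y) (¬moved-beyond t≤Y)))
             (+-identityʳ _))

-- Residue classes and windows

injective⇒surjective : ∀ n (f : ℕ → ℕ) → (∀ i → i < n → f i < n) →
  (∀ i j → i < n → j < n → f i ≡ f j → i ≡ j) → ∀ y → y < n → ∃ λ i → i < n × f i ≡ y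
-- The value `y` is one pigeon too many: a collision with it exhibits a preimage, and a collision
-- between two values of `f` contradicts injectivity.
injective⇒surjective n f bound inj y y<n with pigeonhole (n<1+n n) g
  where
  g : Fin (suc n) → Fin n
  g Fin.zero = fromℕ< y<n
  g (Fin.suc i) = fromℕ< (bound (toℕ i) (toℕ<n i))
... | Fin.zero , Fin.suc j , _ , eq = toℕ j , toℕ<n j , sym (fromℕ<-injective _ _ y<n (bound (toℕ j) (toℕ<n j)) eq)
... | Fin.suc i , Fin.suc j , s≤s i<j , eq =
  ⊥-elim (<⇒≢ i<j (inj (toℕ i) (toℕ j) (toℕ<n i) (toℕ<n j) (fromℕ<-injective _ _ (bound (toℕ i) (toℕ<n i)) (bound (toℕ j) (toℕ<n j)) eq)))

module Mod (k : ℕ) where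
  n = suc k

  infix 4 _≋_
  _≋_ : ℕ → ℕ → Set
  x ≋ y = x % n ≡ y % n

  ≋⇒+ : ∀ {x y} → x ≋ y → x ≤ y → ∃ λ q → y ≡ x + q * n
  ≋⇒+ {x} {y} e x≤y = y / n ∸ x / n , (begin
    y                                              ≡⟨ m≡m%n+[m/n]*n y n ⟩
    y % n + y / n * n                              ≡⟨ cong₂ _+_ e (cong (_* n) (m+[n∸m]≡n (/-monoˡ-≤ n x≤y))) ⟨
    x % n + (x / n + (y / n ∸ x / n)) * n          ≡⟨ shuffle (x % n) (x / n) (y / n ∸ x / n) n ⟩
    (x % n + x / n * n) + (y / n ∸ x / n) * n      ≡⟨ cong (_+ (y / n ∸ x / n) * n) (m≡m%n+[m/n]*n x n) ⟨
    x + (y / n ∸ x / n) * n                        ∎)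
    where
    open ≡-Reasoning
    shuffle : ∀ a b c d → a + (b + c) * d ≡ (a + b * d) + c * d
    shuffle = ℕ-Solver.solve-∀

  ≋-+* : ∀ x q → x + q * n ≋ x
  ≋-+* x q = [m+kn]%n≡m%n x q n

  ≋⇒≡ : ∀ {x y} → x ≋ y → x ≤ y → y < x + n → x ≡ y
  ≋⇒≡ {x} e x≤y y<x+n with ≋⇒+ e x≤y
  ... | zero , eq = sym (trans eq (+-identityʳ x))
  ... | suc q , eq = ⊥-elim (<⇒≱ y<x+n (≤-trans (+-monoʳ-≤ x (m≤m+n n (q * n))) (≤-reflexive (sym eq))))

  +-mod-/ : ∀ {r} q → r < n → (r + q * n) / n ≡ q
  +-mod-/ {r} q r<n = trans (+-distrib-/-∣ʳ r (n∣m*n q)) (cong₂ _+_ (m<n⇒m/n≡0 r<n) (m*n/n≡m q n))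

  +*-/ : ∀ d q → (d + q * n) / n ≡ d / n + q
  +*-/ d q = trans (+-distrib-/-∣ʳ d (n∣m*n q)) (cong (d / n +_) (m*n/n≡m q n))

  suc-/ : ∀ d → (suc d / n ≡ suc (d / n) × suc d % n ≡ 0) ⊎ (suc d / n ≡ d / n × suc d % n ≢ 0)
  suc-/ d with d % n ≟ k
  ... | yes e = inj₁ (trans (cong (_/ n) eq) (m*n/n≡m (suc (d / n)) n) , trans (cong (_% n) eq) (m*n%n≡0 (suc (d / n)) n))
    where
    eq : suc d ≡ suc (d / n) * n
    eq = cong suc (trans (m≡m%n+[m/n]*n d n) (cong (_+ d / n * n) e))
  ... | no ne = inj₂ (trans (cong (_/ n) eq) (+-mod-/ (d / n) r<n) ,
                      λ z → 1+n≢0 (trans (sym (trans (cong (_% n) eq) (trans (≋-+* (suc (d % n)) (d / n)) (m<n⇒m%n≡m r<n)))) z))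
    where
    r<n : suc (d % n) < n
    r<n = s≤s (≤∧≢⇒< (≤-pred (m%n<n d n)) ne)
    eq : suc d ≡ suc (d % n) + d / n * n
    eq = cong suc (m≡m%n+[m/n]*n d n)

  module Periodic (f : ℕ → ℕ) (period : ∀ x → f (x + n) ≡ f x) where

    period* : ∀ x q → f (x + q * n) ≡ f x
    period* x zero = cong f (+-identityʳ x)
    period* x (suc q) = trans (cong f (shuffle x n (q * n))) (trans (period (x + q * n)) (period* x q))
      where
      shuffle : ∀ a b c → a + (b + c) ≡ a + c + b
      shuffle = ℕ-Solver.solve-∀

    periodic-cong : ∀ {x y} → x ≋ y → f x ≡ f y
    periodic-cong {x} {y} e = trans (sym (reduce x)) (trans (cong f e) (reduce y))
      where
      reduce : ∀ x → f (x % n) ≡ f x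
      reduce x = trans (sym (period* (x % n) (x / n))) (cong f (sym (m≡m%n+[m/n]*n x n)))

-- v lists the lowest gaps of the residue classes mod k + 1 in increasing
-- order, and idx x is the index of the class of x.
record Window (k : ℕ) (idx v : ℕ → ℕ) : Set where
  field
    idx-< : ∀ x → idx x < suc k
    idx-period : ∀ x → idx (x + suc k) ≡ idx x
    idx-v : ∀ {i} → i < suc k → idx (v i) ≡ i
    increasing : ∀ {i j} → i < j → j < suc k → v i < v j

-- The beads in the class of `v i` are `v i - n`, `v i - 2n` and so on; the quotient counts those
-- that are at least `x`.
windowPath : ℕ → (ℕ → ℕ) → ℕ → ℕ
windowPath k v x = Σ< (suc k) (λ i → (v i ∸ x) / suc k)

core : ℕ → (ℕ → ℕ) → Partition
core k v = coreOf (windowPath k v) (v k)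

module WindowPath {k : ℕ} {idx v : ℕ → ℕ} (w : Window k idx v) where
  open Window w public
  open Mod k public

  h : ℕ → ℕ
  h = windowPath k v

  open Periodic idx idx-period public using () renaming (period* to idx-period*; periodic-cong to idx-cong)

  -- The `n` lowest gaps have pairwise distinct residues, since `idx` separates them; hence every
  -- residue is that of some `v i`.
  v-idx : ∀ x → v (idx x) ≋ x
  v-idx x with injective⇒surjective n (λ i → v i % n) (λ i _ → m%n<n (v i) n)
                 (λ i j i<n j<n e → trans (sym (idx-v i<n)) (trans (idx-cong e) (idx-v j<n))) (x % n) (m%n<n x n)
  ... | i , i<n , e = trans (cong (λ z → v z % n) (trans (sym (idx-cong e)) (idx-v i<n))) e

  idx-injective : ∀ {x y} → idx x ≡ idx y → x ≋ y
  idx-injective {x} {y} e = trans (sym (v-idx x)) (trans (cong (λ i → v i % n) e) (v-idx y))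

  v-mono : ∀ {i j} → i ≤ j → j < n → v i ≤ v j
  v-mono {i} {j} i≤j j<n with i ≟ j
  ... | yes refl = ≤-refl
  ... | no ne = <⇒≤ (increasing (≤∧≢⇒< i≤j ne) j<n)

  v-<⁻ : ∀ {i j} → i < n → v i < v j → i < j
  v-<⁻ i<n q = ≰⇒> λ j≤i → <⇒≱ q (v-mono j≤i i<n)

  private
    term : ∀ x i → i < n → (v i ∸ x) / n ≡ (v i ∸ suc x) / n + 𝟙 ((x <? v i) ×-dec (i ≟ idx x))
    term x i i<n = go (x <? v i)
      where
      d = v i ∸ suc x
      go : Dec (x < v i) → (v i ∸ x) / n ≡ d / n + 𝟙 ((x <? v i) ×-dec (i ≟ idx x))
      go (no x≮) = trans (cong (_/ n) (trans (m≤n⇒m∸n≡0 (≮⇒≥ x≮)) (sym (m≤n⇒m∸n≡0 (m≤n⇒m≤1+n (≮⇒≥ x≮))))))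
        (trans (sym (+-identityʳ (d / n))) (cong (d / n +_) (sym (𝟙-no ((x <? v i) ×-dec (i ≟ idx x)) (x≮ ∘ proj₁)))))
      go (yes x<v) = trans (cong (_/ n) v∸x) (split (suc-/ d))
        where
        v∸x : v i ∸ x ≡ suc d
        v∸x = +-∸-assoc 1 x<v
        v≡ : v i ≡ x + suc d
        v≡ = trans (sym (m+[n∸m]≡n (<⇒≤ x<v))) (cong (x +_) v∸x)
        split : (suc d / n ≡ suc (d / n) × suc d % n ≡ 0) ⊎ (suc d / n ≡ d / n × suc d % n ≢ 0) →
          suc d / n ≡ d / n + 𝟙 ((x <? v i) ×-dec (i ≟ idx x))
        split (inj₁ (e , z)) = trans e (trans (+-comm 1 (d / n)) (cong (d / n +_) (sym (𝟙-yes ((x <? v i) ×-dec (i ≟ idx x)) (x<v , i≡)))))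
          where
          i≡ : i ≡ idx x
          i≡ = trans (sym (idx-v i<n)) (trans (cong idx (trans v≡ (cong (x +_) (trans (m≡m%n+[m/n]*n (suc d) n) (cong (_+ suc d / n * n) z)))))
                 (idx-period* x (suc d / n)))
        split (inj₂ (e , nz)) = trans e (trans (sym (+-identityʳ (d / n))) (cong (d / n +_) (sym (𝟙-no ((x <? v i) ×-dec (i ≟ idx x)) λ { (_ , eq) → nz (zero-mod eq) }))))
          where
          zero-mod : i ≡ idx x → suc d % n ≡ 0
          zero-mod eq with ≋⇒+ {x} {v i} (idx-injective (trans (sym eq) (sym (idx-v i<n)))) (<⇒≤ x<v)
          ... | q , eq′ = trans (cong (_% n) (+-cancelˡ-≡ x (suc d) (q * n) (trans (sym v≡) eq′))) (m*n%n≡0 q n)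

  h-local : ∀ x → h x ≡ h (suc x) + 𝟙 (x <? v (idx x))
  h-local x = begin
    Σ< n (λ i → (v i ∸ x) / n)
      ≡⟨ Σ<-cong n (term x) ⟩
    Σ< n (λ i → (v i ∸ suc x) / n + 𝟙 (here? i))
      ≡⟨ Σ<-+ n (λ i → (v i ∸ suc x) / n) (𝟙 ∘ here?) ⟩
    h (suc x) + Σ< n (𝟙 ∘ here?)
      ≡⟨ cong (h (suc x) +_) (Σ<-single n (idx x) (idx-< x) (λ i _ ne → 𝟙-no (here? i) (ne ∘ proj₂))) ⟩
    h (suc x) + 𝟙 (here? (idx x))
      ≡⟨ cong (h (suc x) +_) (𝟙-⇔ (here? (idx x)) (x <? v (idx x)) proj₁ (_, refl)) ⟩
    h (suc x) + 𝟙 (x <? v (idx x)) ∎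
    where
    open ≡-Reasoning
    here? : ∀ i → Dec (x < v i × i ≡ idx x)
    here? i = (x <? v i) ×-dec (i ≟ idx x)

  isPath : IsPath h
  isPath = record
    { antitone = λ x → ≤-trans (m≤m+n (h (suc x)) _) (≤-reflexive (sym (h-local x)))
    ; lipschitz = λ x → ≤-trans (≤-reflexive (h-local x))
        (≤-trans (+-monoʳ-≤ (h (suc x)) (𝟙≤1 (x <? v (idx x)))) (≤-reflexive (+-comm (h (suc x)) 1)))
    ; top = v k
    ; h-top = Σ<-zero n (λ i i<n → trans (cong (_/ n) (m≤n⇒m∸n≡0 (v-mono (≤-pred i<n) (n<1+n k)))) (0/n≡0 n))
    }

  open Path isPath

  gap⇒ : ∀ {x} → Gap h x → v (idx x) ≤ x
  gap⇒ {x} e = ≮⇒≥ λ q → <-irrefl (trans e (h-local x)) (≤-trans (n<1+n _) (≤-trans (≤-reflexive (+-comm 1 _)) (≤-reflexive (cong (h (suc x) +_) (sym (𝟙-yes (x <? v (idx x)) q))))))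

  ⇒gap : ∀ {x} → v (idx x) ≤ x → Gap h x
  ⇒gap {x} q = sym (trans (h-local x) (trans (cong (h (suc x) +_) (𝟙-no (x <? v (idx x)) (≤⇒≯ q))) (+-identityʳ _)))

  gap-v : ∀ {i} → i < n → Gap h (v i)
  gap-v i<n = ⇒gap (≤-reflexive (cong v (idx-v i<n)))

  flush : Flush n h
  flush y e = ⇒gap (subst (λ z → v z ≤ y + n) (sym (idx-period y)) (≤-trans (gap⇒ e) (m≤m+n y n)))

  rank : ℕ → ℕ
  rank x = Σ< n (λ i → 𝟙 (v i <? x))

  <rank⇔ : ∀ {t} x → t < n → (t < rank x → v t < x) × (v t < x → t < rank x)
  <rank⇔ x = segment (λ i → v i <? x) n (λ i≤j j<n q → ≤-<-trans (v-mono i≤j j<n) q)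

  -- The positions from `y` to `y + k` meet each class once, and class `i` shows a gap there exactly
  -- when `v i < y + n`. So `rank (y + n)` is the number of gaps among these `n` positions.
  h-shift : ∀ y → h y + rank (y + n) ≡ h (y + n) + n
  h-shift y = begin
    h y + rank (y + n)                                                   ≡⟨ Σ<-+ n _ _ ⟨
    Σ< n (λ i → (v i ∸ y) / n + 𝟙 (v i <? y + n))                       ≡⟨ Σ<-cong n (λ i _ → shift-term i) ⟩
    Σ< n (λ i → (v i ∸ (y + n)) / n + 1)                                ≡⟨ Σ<-+ n _ _ ⟩
    h (y + n) + Σ< n (λ _ → 1)                                           ≡⟨ cong (h (y + n) +_) (trans (Σ<-const n 1) (*-identityʳ n)) ⟩
    h (y + n) + n                                                        ∎
    where
    open ≡-Reasoning
    shift-term : ∀ i → (v i ∸ y) / n + 𝟙 (v i <? y + n) ≡ (v i ∸ (y + n)) / n + 1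
    shift-term i = go (v i <? y + n)
      where
      go : (d : Dec (v i < y + n)) → (v i ∸ y) / n + 𝟙 d ≡ (v i ∸ (y + n)) / n + 1
      go (yes q) = cong (_+ 1) (trans (m<n⇒m/n≡0 v∸y<n) (sym (trans (cong (_/ n) (m≤n⇒m∸n≡0 (<⇒≤ q))) (0/n≡0 n))))
        where
        v∸y<n : v i ∸ y < n
        v∸y<n = s≤s (m≤n+o⇒m∸n≤o (v i) y (≤-pred (≤-trans q (≤-reflexive (+-suc y k)))))
      go (no q) = trans (+-identityʳ _) (trans (m/n≡1+[m∸n]/n n≤) (trans (+-comm 1 _) (cong (λ z → z / n + 1) (∸-+-assoc (v i) y n))))
        where
        n≤ : n ≤ v i ∸ y
        n≤ = m+n≤o⇒n≤o∸m y (≮⇒≥ q)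
          where
          m+n≤o⇒n≤o∸m : ∀ m {n o} → m + n ≤ o → n ≤ o ∸ m
          m+n≤o⇒n≤o∸m m {n} p = ≤-trans (≤-reflexive (sym (m+n∸m≡n m n))) (∸-monoˡ-≤ m p)

  gaps-shift : ∀ y → gaps h (y + n) ≡ gaps h y + rank (y + n)
  gaps-shift y = +-cancelʳ-≡ (h 0) _ _ (begin
    gaps h (y + n) + h 0            ≡⟨ balance (y + n) ⟩
    y + n + h (y + n)               ≡⟨ shuffle y n (h (y + n)) ⟩
    y + (h (y + n) + n)             ≡⟨ cong (y +_) (h-shift y) ⟨
    y + (h y + rank (y + n))        ≡⟨ +-assoc y (h y) _ ⟨
    y + h y + rank (y + n)          ≡⟨ cong (_+ rank (y + n)) (balance y) ⟨
    gaps h y + h 0 + rank (y + n)   ≡⟨ shuffle′ (gaps h y) (h 0) (rank (y + n)) ⟩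
    gaps h y + rank (y + n) + h 0   ∎)
    where
    open ≡-Reasoning
    shuffle : ∀ a b c → a + b + c ≡ a + (c + b)
    shuffle = ℕ-Solver.solve-∀
    shuffle′ : ∀ a b c → a + b + c ≡ a + c + b
    shuffle′ = ℕ-Solver.solve-∀

  module _ (n≤v₀ : n ≤ v 0) where

    n≤v : ∀ {i} → i < n → n ≤ v i
    n≤v i<n = ≤-trans n≤v₀ (v-mono z≤n i<n)

    -- In the row of a bead x the cells of hook length ≤ k sit over the gaps
    -- between x - n and x, one for each class whose lowest gap is below x.
    <rowCount⇔ : ∀ {t x} → t < n → Bead h x →
      (t < gaps h x ∸ gaps h (x ∸ k) → v t < x) × (v t < x → t < gaps h x ∸ gaps h (x ∸ k))
    <rowCount⇔ {t} {x} t<n b with n ≤? x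
    ... | no n≰x = (λ q → ⊥-elim (none q)) , (λ q → ⊥-elim (n≰x (≤-trans (n≤v t<n) (<⇒≤ q))))
      where
      none : ¬ (t < gaps h x ∸ gaps h (x ∸ k))
      none q with find-gap 0
      ... | y , e , g≡0 = <-irrefl refl (≤-<-trans (≤-trans (n≤v (idx-< y)) (gap⇒ e)) (<-trans y<x (≰⇒> n≰x)))
        where
        y<x : y < x
        y<x = proj₂ (bead<⇔ e) (≤-<-trans (≤-trans (≤-reflexive g≡0) z≤n) (<-≤-trans q (m∸n≤m (gaps h x) (gaps h (x ∸ k)))))
    ... | yes n≤x = (λ q → proj₁ (<rank⇔ x t<n) (subst (t <_) count q)) , (λ q → subst (t <_) (sym count) (proj₂ (<rank⇔ x t<n) q))
      where
      y = x ∸ n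
      x≡ : y + n ≡ x
      x≡ = m∸n+n≡m n≤x
      -- Hooks of length at most `k` reach down to `x - k = suc y`, whereas the rank belongs to a
      -- full period starting at `y`. As `y` is a bead too, the two counts of gaps agree.
      bead-y : Bead h y
      bead-y with gap⊎bead y
      ... | inj₁ e = ⊥-elim (¬gap∧bead (subst (Gap h) x≡ (flush y e)) b)
      ... | inj₂ b′ = b′
      x∸k : x ∸ k ≡ suc y
      x∸k = trans (cong (_∸ k) (trans (sym x≡) (+-suc y k))) (m+n∸n≡m (suc y) k)
      count : gaps h x ∸ gaps h (x ∸ k) ≡ rank x
      count = begin
        gaps h x ∸ gaps h (x ∸ k)             ≡⟨ cong₂ (λ a b → gaps h a ∸ gaps h b) (sym x≡) x∸k ⟩
        gaps h (y + n) ∸ gaps h (suc y)       ≡⟨ cong₂ _∸_ (gaps-shift y) (gaps-bead bead-y) ⟩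
        gaps h y + rank (y + n) ∸ gaps h y    ≡⟨ m+n∸m≡n (gaps h y) _ ⟩
        rank (y + n)                          ≡⟨ cong rank x≡ ⟩
        rank x                                ∎
        where open ≡-Reasoning

    module _ {τ : Partition} (rep : Rep τ h) where
      open RepPath rep isPath using (beyond; rowCount-bead; size-gaps; flush⇒core)

      rowCount≤k : ∀ i → rowCount k τ i ≤ k
      rowCount≤k i with i <? h 0
      ... | no q = ≤-trans (≤-reflexive (rowCount-beyond k τ i (beyond i (≮⇒≥ q)))) z≤n
      ... | yes q with find-bead q
      ...   | x , b , refl = ≤-trans (≤-reflexive (rowCount-bead k b)) (gaps-∸ x k)

      <rowCount : ∀ {t i} → t < n → (t < rowCount k τ i → i < h (v t)) × (i < h (v t) → t < rowCount k τ i)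
      <rowCount {t} {i} t<n with i <? h 0
      ... | no q = (λ c → ⊥-elim (n≮0 (<-≤-trans c (≤-reflexive (rowCount-beyond k τ i (beyond i (≮⇒≥ q))))))) ,
                   (λ c → ⊥-elim (q (<-≤-trans c (h-anti {0} {v t} z≤n))))
      ... | yes q with find-bead q
      ...   | x , b , refl = (λ c → ≤-trans (≤-reflexive (sym b)) (≤-trans (h-anti (proj₁ iff (subst (t <_) (rowCount-bead k b) c))) (≤-reflexive (gap-v t<n)))) ,
                             (λ c → subst (t <_) (sym (rowCount-bead k b)) (proj₂ iff (≰⇒> λ x≤v → <⇒≱ c (≤-trans (≤-reflexive (sym (gap-v t<n))) (h-anti (s≤s x≤v))))))
        where iff = <rowCount⇔ t<n b

      rowCount-antitone : ∀ i → rowCount k τ (suc i) ≤ rowCount k τ i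
      rowCount-antitone i = ≤-ext λ t q → let t<n = ≤-trans q (m≤n⇒m≤1+n (rowCount≤k (suc i))) in
        proj₂ (<rowCount t<n) (<-trans (n<1+n i) (proj₁ (<rowCount t<n) q))

      private
        rowCount-len : ∀ i → length τ ≤ i → rowCount k τ i ≡ 0
        rowCount-len i q = rowCount-beyond k τ i (row-beyond τ q)

      row-𝔭 : ∀ i → row (𝔭 k τ) i ≡ rowCount k τ i
      row-𝔭 i = trans (cong (λ κ → row κ i) (𝔭-fromRows k τ)) (row-fromRows (rowCount k τ) (length τ) rowCount-antitone rowCount-len i)

      InPk-𝔭 : InPk k (𝔭 k τ)
      InPk-𝔭 = subst IsPartition (sym (𝔭-fromRows k τ)) (IsPartition-fromRows (rowCount k τ) (length τ) rowCount-antitone rowCount-len) ,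
               row⇒All≤ (𝔭 k τ) (λ i → ≤-trans (≤-reflexive (row-𝔭 i)) (rowCount≤k i))

      col-𝔭 : ∀ {t} → t < n → col (𝔭 k τ) t ≡ h (v t)
      col-𝔭 {t} t<n = ≡-ext
        (λ i q → proj₁ (<rowCount t<n) (subst (t <_) (row-𝔭 i) (proj₁ (<col⇔<row (proj₁ InPk-𝔭)) q)))
        (λ i q → proj₂ (<col⇔<row (proj₁ InPk-𝔭)) (subst (t <_) (sym (row-𝔭 i)) (proj₂ (<rowCount t<n) q)))

  module _ {h′ : ℕ → ℕ} (path′ : IsPath h′) (same : h′ 0 ≡ h 0) (il : Interlaced h h′) (flush′ : Flush n h′) where
    open Strip isPath path′ same il

    private
      lowest? : ∀ x → Dec (v (idx x) ≡ x)
      lowest? x = v (idx x) ≟ x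

      -- Below `n` there is no position `z - n`, so a gap there is lowest in its class.
      mv-low : ∀ z → z < n → mv z ≡ 𝟙 (lowest? z) * mv z
      mv-low z z<n with moved? z
      ... | no _ = sym (*-zeroʳ (𝟙 (lowest? z)))
      ... | yes q = sym (trans (*-identityʳ _) (𝟙-yes (lowest? z)
                      (≋⇒≡ (v-idx z) (gap⇒ (moved⇒gap q)) (<-≤-trans z<n (m≤n+m n _)))))

      -- A gap at `y + n` either has a gap at `y` or is lowest in its class, and never both. The
      -- first kind cancels against the correction sum of `size-balance`.
      mv-high : ∀ y → mv (n + y) ≡ 𝟙 (gap? h y) * mv (y + n) + 𝟙 (lowest? (n + y)) * mv (n + y)
      mv-high y = trans (cong mv (+-comm n y)) (trans (go (moved? (y + n)) (gap? h y) (lowest? (y + n)))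
                    (cong (λ z → 𝟙 (gap? h y) * mv (y + n) + 𝟙 (lowest? z) * mv z) (+-comm y n)))
        where
        go : (d : Dec (Moved (y + n))) (e : Dec (Gap h y)) (f : Dec (v (idx (y + n)) ≡ y + n)) →
          𝟙 d ≡ 𝟙 e * 𝟙 d + 𝟙 f * 𝟙 d
        go (no _) e f = sym (cong₂ _+_ (*-zeroʳ (𝟙 e)) (*-zeroʳ (𝟙 f)))
        go (yes q) (yes e) (yes f) = ⊥-elim (<⇒≱ (m<m+n y {n} (s≤s z≤n)) (≤-trans (≤-reflexive (sym f)) (subst (λ z → v z ≤ y) (sym (idx-period y)) (gap⇒ e))))
        go (yes q) (yes e) (no f) = refl
        go (yes q) (no e) (yes f) = refl
        go (yes q) (no e) (no f) = ⊥-elim (f (≋⇒≡ (v-idx (y + n)) (gap⇒ (moved⇒gap q))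
          (+-monoˡ-< n (≰⇒> λ v≤y → e (⇒gap (subst (λ z → v z ≤ y) (idx-period y) v≤y))))))

      Σ-lowest : ∀ {Z} → (∀ i → i < n → v i < Z) → Σ< Z (λ z → 𝟙 (lowest? z) * mv z) ≡ Σ< n (λ i → mv (v i))
      Σ-lowest {Z} bound = sym (begin
        Σ< n (λ i → mv (v i))
          ≡⟨ Σ<-cong n (λ i i<n → sym (trans (Σ<-single Z (v i) (bound i i<n)
               (λ z _ ne → cong (_* mv z) (𝟙-no (v i ≟ z) (ne ∘ sym)))) (trans (cong (_* mv (v i)) (𝟙-yes (v i ≟ v i) refl)) (+-identityʳ _)))) ⟩
        Σ< n (λ i → Σ< Z (λ z → 𝟙 (v i ≟ z) * mv z))
          ≡⟨ Σ<-swap n Z (λ i z → 𝟙 (v i ≟ z) * mv z) ⟩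
        Σ< Z (λ z → Σ< n (λ i → 𝟙 (v i ≟ z) * mv z))
          ≡⟨ Σ<-cong Z (λ z _ → Σ<-single n (idx z) (idx-< z) (λ i i<n ne →
               cong (_* mv z) (𝟙-no (v i ≟ z) (λ { refl → ne (sym (idx-v i<n)) })))) ⟩
        Σ< Z (λ z → 𝟙 (lowest? z) * mv z) ∎)
        where open ≡-Reasoning

    module _ {τ κ : Partition} (rep : Rep τ h) (rep′ : Rep κ h′) where

      size-strip : size≤ k κ ≡ size≤ k τ + Σ< n (λ i → mv (v i))
      size-strip = +-cancelʳ-≡ stay _ _ (begin
        size≤ k κ + stay                                             ≡⟨ cong (_+ stay) (RepPath.size-gaps rep′ path′ k top′≤) ⟩
        Σ< Y (λ y → 𝟙 (gap? h′ y) * (h′ y ∸ h′ (y + n))) + stay      ≡⟨ size-balance n flush′ top′≤ ⟩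
        Σ< Y (λ y → 𝟙 (gap? h y) * (h y ∸ h (y + n))) + Σ< Y mv      ≡⟨ cong₂ _+_ (sym (RepPath.size-gaps rep isPath k top≤)) total ⟩
        size≤ k τ + (Σ< n (λ i → mv (v i)) + stay)                   ≡⟨ +-assoc (size≤ k τ) _ stay ⟨
        size≤ k τ + Σ< n (λ i → mv (v i)) + stay                     ∎)
        where
        open ≡-Reasoning
        Y = IsPath.top path′ + v k
        top′≤ : IsPath.top path′ ≤ Y
        top′≤ = m≤m+n _ (v k)
        top≤ : v k ≤ Y
        top≤ = m≤n+m (v k) _
        stay = Σ< Y (λ y → 𝟙 (gap? h y) * mv (y + n))
        low = λ z → 𝟙 (lowest? z) * mv z
        total : Σ< Y mv ≡ Σ< n (λ i → mv (v i)) + stay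
        total = begin
          Σ< Y mv                                              ≡⟨ Σ<-extend mv (m≤n+m Y n) (λ y q → 𝟙-no (moved? y) (¬moved-beyond n flush′ (≤-trans top′≤ q))) ⟨
          Σ< (n + Y) mv                                        ≡⟨ Σ<-split n Y mv ⟩
          Σ< n mv + Σ< Y (λ y → mv (n + y))                    ≡⟨ cong₂ _+_ (Σ<-cong n mv-low) (trans (Σ<-cong Y (λ y _ → mv-high y)) (Σ<-+ Y _ _)) ⟩
          Σ< n low + (stay + Σ< Y (λ y → low (n + y)))         ≡⟨ shuffle (Σ< n low) stay _ ⟩
          (Σ< n low + Σ< Y (λ y → low (n + y))) + stay         ≡⟨ cong (_+ stay) (Σ<-split n Y low) ⟨
          Σ< (n + Y) low + stay                                ≡⟨ cong (_+ stay) (Σ-lowest (λ i i<n → <-≤-trans (s≤s (v-mono (≤-pred i<n) (n<1+n k))) (s≤s (≤-trans top≤ (m≤n+m Y k))))) ⟩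
          Σ< n (λ i → mv (v i)) + stay                         ∎
          where
          shuffle : ∀ a b c → a + (b + c) ≡ (a + c) + b
          shuffle = ℕ-Solver.solve-∀

-- Moves of a set of classes

_∈ᵇ_ : ℕ → (ℕ → Bool) → Set
i ∈ᵇ A = A i ≡ true

_∈ᵇ?_ : ∀ i A → Dec (i ∈ᵇ A)
i ∈ᵇ? A = A i Bool.≟ true

false⊎true : ∀ b → b ≡ false ⊎ b ≡ true
false⊎true false = inj₁ refl
false⊎true true = inj₂ refl

false≢true : ∀ {b} → b ≡ false → b ≡ true → ⊥
false≢true refl ()

if-true : ∀ {b} {x y : ℕ} → b ≡ true → (if b then x else y) ≡ x
if-true refl = refl

if-false : ∀ {b} {x y : ℕ} → b ≡ false → (if b then x else y) ≡ y
if-false refl = refl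

-- The value is 0 when `p` holds everywhere below `N`; `RawMove.Proper` excludes that case.
lastFalse : (ℕ → Bool) → ℕ → ℕ
lastFalse p zero = 0
lastFalse p (suc N) = if p N then lastFalse p N else N

lastFalse-false : ∀ (p : ℕ → Bool) N {x} → x < N → p x ≡ false → p (lastFalse p N) ≡ false
lastFalse-false p (suc N) {x} x<N e with p N in eq
... | false = eq
... | true = lastFalse-false p N (≤∧≢⇒< (≤-pred x<N) λ { refl → false≢true e eq }) e

-- A set A of classes of gaps is moved one step to the left; a gap in a class
-- outside A is carried to the right over the block of classes of A above it.
-- owner x is the class of the last position ≤ x whose class is not in A.
module RawMove (k : ℕ) (idx : ℕ → ℕ) (A : ℕ → Bool) where

  base : ℕ
  base = lastFalse (A ∘ idx) (suc k)

  ownerFrom : ℕ → ℕ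
  ownerFrom zero = idx base
  ownerFrom (suc m) = if A (idx (base + suc m)) then ownerFrom m else idx (base + suc m)

  owner : ℕ → ℕ
  -- `base + (x + base * k)` equals `x + base * n`: a position of the class of `x` that is reached
  -- from `base` upwards.
  owner x = ownerFrom (x + base * k)

  -- The length of the block of classes of `A` directly above `x`, with `f` as fuel. Fuel `k`
  -- suffices above a class outside `A`, because that class recurs at `x + n`.
  run : ℕ → ℕ → ℕ
  run zero x = 0
  run (suc f) x = if A (idx (suc x)) then suc (run f (suc x)) else 0

  -- The class found at `x` after the move: either the one that stepped down from `suc x`, or, if
  -- `x` ends a block, the owner carried there.
  newIdx : ℕ → ℕ
  newIdx x = if A (idx (suc x)) then idx (suc x) else owner x

  moveBy : (ℕ → ℕ) → ℕ → ℕ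
  moveBy v i = if A i then v i ∸ 1 else v i + run k (v i)

  Proper : Set
  Proper = A (idx base) ≡ false

  -- Restricted to one period so that it is decidable; `Move.valid` extends it to all positions.
  Valid : Set
  Valid = ∀ x → x < suc k → idx x ∈ᵇ A → idx x < owner x

module MoveIdx {k : ℕ} {idx v : ℕ → ℕ} (w : Window k idx v) (A : ℕ → Bool) (proper : RawMove.Proper k idx A) where
  open WindowPath w
  open RawMove k idx A

  private
    at-base : ∀ x → idx (base + (x + base * k)) ≡ idx x
    at-base x = trans (cong idx (shuffle base x k)) (idx-period* x base)
      where
      shuffle : ∀ a b c → a + (b + a * c) ≡ b + a * suc c
      shuffle = ℕ-Solver.solve-∀

    ownerFrom-outside : ∀ m → A (idx (base + m)) ≡ false → ownerFrom m ≡ idx (base + m)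
    ownerFrom-outside zero _ = cong idx (sym (+-identityʳ base))
    ownerFrom-outside (suc m) e = if-false e

    ownerFrom-period : ∀ m → ownerFrom (m + n) ≡ ownerFrom m
    ownerFrom-period zero = trans (ownerFrom-outside n (subst (λ z → A z ≡ false) (sym (idx-period base)) proper)) (idx-period base)
    ownerFrom-period (suc m) = cong₂ (λ i r → if A i then r else i)
      (trans (cong idx (shuffle base (suc m) n)) (idx-period (base + suc m))) (ownerFrom-period m)
      where
      shuffle : ∀ a b c → a + (b + c) ≡ a + b + c
      shuffle = ℕ-Solver.solve-∀

  owner-outside : ∀ {x} → A (idx x) ≡ false → owner x ≡ idx x
  owner-outside {x} e = trans (ownerFrom-outside (x + base * k) (trans (cong A (at-base x)) e)) (at-base x)

  owner-suc : ∀ {x} → idx (suc x) ∈ᵇ A → owner (suc x) ≡ owner x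
  owner-suc {x} e = if-true (trans (cong A (at-base (suc x))) e)

  owner∉ : ∀ x → A (owner x) ≡ false
  owner∉ x = go (x + base * k)
    where
    go : ∀ m → A (ownerFrom m) ≡ false
    go zero = proper
    go (suc m) with A (idx (base + suc m)) in eq
    ... | true = go m
    ... | false = eq

  owner-< : ∀ x → owner x < n
  owner-< x = go (x + base * k)
    where
    go : ∀ m → ownerFrom m < n
    go zero = idx-< base
    go (suc m) with A (idx (base + suc m))
    ... | true = go m
    ... | false = idx-< _

  owner-period : ∀ x → owner (x + n) ≡ owner x
  owner-period x = trans (cong ownerFrom (shuffle x n (base * k))) (ownerFrom-period (x + base * k))
    where
    shuffle : ∀ a b c → a + b + c ≡ a + c + b
    shuffle = ℕ-Solver.solve-∀

  owner-cong : ∀ {x y} → x ≋ y → owner x ≡ owner y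
  owner-cong {x} {y} = Periodic.periodic-cong owner owner-period {x} {y}

  run-end : ∀ f x → A (idx (suc (x + f))) ≡ false → A (idx (suc (x + run f x))) ≡ false
  run-end zero x e = e
  run-end (suc f) x e with A (idx (suc x)) in eq
  ... | false = subst (λ z → A (idx (suc z)) ≡ false) (sym (+-identityʳ x)) eq
  ... | true = subst (λ z → A (idx (suc z)) ≡ false) (sym (+-suc x (run f (suc x))))
                 (run-end f (suc x) (subst (λ z → A (idx (suc z)) ≡ false) (+-suc x f) e))

  run-inside : ∀ f x {e} → e < run f x → idx (suc (x + e)) ∈ᵇ A
  run-inside (suc f) x {e} q with A (idx (suc x)) in eq
  run-inside (suc f) x {zero} q | true = subst (λ z → idx (suc z) ∈ᵇ A) (sym (+-identityʳ x)) eq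
  run-inside (suc f) x {suc e} (s≤s q) | true = subst (λ z → idx (suc z) ∈ᵇ A) (sym (+-suc x e)) (run-inside f (suc x) q)

  run-≤ : ∀ f x → run f x ≤ f
  run-≤ zero x = z≤n
  run-≤ (suc f) x with A (idx (suc x))
  ... | false = z≤n
  ... | true = s≤s (run-≤ f (suc x))

module Move {k : ℕ} {idx v : ℕ → ℕ} (w : Window k idx v) (A : ℕ → Bool)
            (proper : RawMove.Proper k idx A) (valid-< : RawMove.Valid k idx A) (1≤v₀ : 1 ≤ v 0) where
  open WindowPath w
  open RawMove k idx A
  open MoveIdx w A proper public

  valid : ∀ x → idx x ∈ᵇ A → idx x < owner x
  valid x e = subst₂ _<_ (idx-cong (m%n%n≡m%n x n)) (owner-cong {x % n} {x} (m%n%n≡m%n x n))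
    (valid-< (x % n) (m%n<n x n) (subst (_∈ᵇ A) (sym (idx-cong (m%n%n≡m%n x n))) e))

  v′ : ℕ → ℕ
  v′ = moveBy v

  v′-in : ∀ {i} → i < n → i ∈ᵇ A → suc (v′ i) ≡ v i
  v′-in {i} i<n e = trans (cong suc (if-true e)) (m+[n∸m]≡n (≤-trans 1≤v₀ (v-mono z≤n i<n)))

  v′-out : ∀ {i} → A i ≡ false → v′ i ≡ v i + run k (v i)
  v′-out e = if-false e

  v≤v′ : ∀ {i} → A i ≡ false → v i ≤ v′ i
  v≤v′ e = ≤-trans (m≤m+n _ _) (≤-reflexive (sym (v′-out e)))

  after-run : ∀ {i} → i < n → A i ≡ false → A (idx (suc (v i + run k (v i)))) ≡ false
  after-run {i} i<n e = run-end k (v i) (trans (cong A (trans (cong idx (sym (+-suc (v i) k))) (trans (idx-period (v i)) (idx-v i<n)))) e)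

  owner-run : ∀ {i} → i < n → A i ≡ false → ∀ e → e ≤ run k (v i) → owner (v i + e) ≡ i
  owner-run {i} i<n o zero _ = trans (cong owner (+-identityʳ (v i)))
    (trans (owner-outside (trans (cong A (idx-v i<n)) o)) (idx-v i<n))
  owner-run {i} i<n o (suc e) q = trans (cong owner (+-suc (v i) e))
    (trans (owner-suc (run-inside k (v i) q)) (owner-run i<n o e (<⇒≤ q)))

  newIdx-v′ : ∀ {i} → i < n → newIdx (v′ i) ≡ i
  newIdx-v′ {i} i<n with false⊎true (A i)
  ... | inj₂ e = trans (if-true (trans (cong A idx≡) e)) idx≡
    where
    idx≡ : idx (suc (v′ i)) ≡ i
    idx≡ = trans (cong idx (v′-in i<n e)) (idx-v i<n)
  ... | inj₁ e = trans (if-false (trans (cong (A ∘ idx ∘ suc) (v′-out e)) (after-run i<n e)))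
                       (trans (cong owner (v′-out e)) (owner-run i<n e _ ≤-refl))

  -- If the gap carried from `v i` reached `v j`, class `j` would lie in the block owned by `i`, and
  -- validity would give `j < i`. This keeps the order of the lowest gaps.
  v′<v : ∀ {i j} → i < j → j < n → v′ i < v j
  v′<v {i} {j} i<j j<n with false⊎true (A i)
  ... | inj₂ e = ≤-trans (≤-reflexive (v′-in (<-trans i<j j<n) e)) (<⇒≤ (increasing i<j j<n))
  ... | inj₁ o = subst (_< v j) (sym (v′-out o)) (≰⇒> λ q → blocked (v j ∸ suc (v i)) (sym (m+[n∸m]≡n (increasing i<j j<n))) q)
    where
    i<n = <-trans i<j j<n
    blocked : ∀ d → v j ≡ suc (v i + d) → v j ≤ v i + run k (v i) → ⊥
    blocked d eq q = <-asym i<j (subst₂ _<_ (idx-v j<n) (trans (cong owner v≡) (owner-run i<n o (suc d) d<run))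
                       (valid (v j) (subst (λ z → idx z ∈ᵇ A) (sym eq) (run-inside k (v i) d<run))))
      where
      v≡ : v j ≡ v i + suc d
      v≡ = trans eq (sym (+-suc (v i) d))
      d<run : d < run k (v i)
      d<run = +-cancelˡ-≤ (v i) (suc d) _ (≤-trans (≤-reflexive (sym v≡)) q)

  increasing′ : ∀ {i j} → i < j → j < n → v′ i < v′ j
  increasing′ {i} {j} i<j j<n with false⊎true (A j)
  ... | inj₁ o = <-≤-trans (v′<v i<j j<n) (v≤v′ o)
  -- The step of `j` to the left can at worst produce a tie, and `newIdx-v′` tells the two classes
  -- apart.
  ... | inj₂ e = ≤∧≢⇒< (≤-pred (<-≤-trans (v′<v i<j j<n) (≤-reflexive (sym (v′-in j<n e)))))
                   (λ eq → <⇒≢ i<j (trans (sym (newIdx-v′ (<-trans i<j j<n))) (trans (cong newIdx eq) (newIdx-v′ j<n))))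

  newIdx-< : ∀ x → newIdx x < n
  newIdx-< x with A (idx (suc x))
  ... | true = idx-< (suc x)
  ... | false = owner-< x

  newIdx-period : ∀ x → newIdx (x + n) ≡ newIdx x
  newIdx-period x = cong₂ (λ i o → if A i then i else o) (idx-period (suc x)) (owner-period x)

  window′ : Window k newIdx v′
  window′ = record { idx-< = newIdx-< ; idx-period = newIdx-period ; idx-v = newIdx-v′ ; increasing = increasing′ }

  private
    module W′ = WindowPath window′

  h′ : ℕ → ℕ
  h′ = W′.h

  -- The gaps whose move is visible. From the lowest gap of the owner upwards, owner and block
  -- consist of gaps only, and rotating them leaves the set of gaps unchanged.
  Shifted : ℕ → Set
  Shifted x = idx x ∈ᵇ A × v (idx x) ≤ x × x < v (owner x)

  shifted? : ∀ x → Dec (Shifted x)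
  shifted? x = (idx x ∈ᵇ? A) ×-dec ((v (idx x) ≤? x) ×-dec (x <? v (owner x)))

  private
    v<v-owner : ∀ x → idx x ∈ᵇ A → v (idx x) < v (owner x)
    v<v-owner x e = increasing (valid x e) (owner-< x)

    -- Together with `bead′+shifted` this is the conservation law of `gap-balance`, stated for
    -- beads, with the common value identified: below the level of the owner a position either holds
    -- a bead or is about to receive one.
    bead+shifted : ∀ x → 𝟙 (x <? v (idx x)) + 𝟙 (shifted? x) ≡ 𝟙 (x <? v (owner x))
    bead+shifted x with false⊎true (A (idx x))
    ... | inj₁ o = trans (cong (𝟙 (x <? v (idx x)) +_) (𝟙-no (shifted? x) (false≢true o ∘ proj₁)))
      (trans (+-identityʳ _) (𝟙-⇔ (x <? v (idx x)) (x <? v (owner x)) (subst (λ i → x < v i) (sym (owner-outside o)))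
                                                  (subst (λ i → x < v i) (owner-outside o))))
    ... | inj₂ e = go (x <? v (owner x)) (x <? v (idx x))
      where
      go : (d : Dec (x < v (owner x))) (b : Dec (x < v (idx x))) → 𝟙 b + 𝟙 (shifted? x) ≡ 𝟙 d
      go (yes d) (yes b) = cong suc (𝟙-no (shifted? x) (λ { (_ , q , _) → <⇒≱ b q }))
      go (yes d) (no b) = 𝟙-yes (shifted? x) (e , ≮⇒≥ b , d)
      go (no d) (yes b) = ⊥-elim (d (<-trans b (v<v-owner x e)))
      go (no d) (no b) = 𝟙-no (shifted? x) (d ∘ proj₂ ∘ proj₂)

    bead′+shifted : ∀ x → 𝟙 (x <? v′ (newIdx x)) + 𝟙 (shifted? (suc x)) ≡ 𝟙 (x <? v (owner x))
    bead′+shifted x with false⊎true (A (idx (suc x)))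
    ... | inj₁ o = trans (cong (𝟙 (x <? v′ (newIdx x)) +_) (𝟙-no (shifted? (suc x)) (false≢true o ∘ proj₁)))
      (trans (+-identityʳ _) (𝟙-⇔ (x <? v′ (newIdx x)) (x <? v (owner x)) to from))
      where
      c = owner x
      new≡ : newIdx x ≡ c
      new≡ = if-false o
      to : x < v′ (newIdx x) → x < v c
      to q = ≰⇒> λ v≤x → <⇒≢ q (W′.≋⇒≡ {x} {v′ (newIdx x)} (sym (W′.v-idx x)) (<⇒≤ q)
        (≤-<-trans (≤-trans (≤-reflexive (trans (cong v′ new≡) (v′-out (owner∉ x)))) (+-mono-≤ v≤x (run-≤ k (v c)))) (+-monoʳ-< x (n<1+n k))))
      from : x < v c → x < v′ (newIdx x)
      from q = <-≤-trans q (≤-trans (v≤v′ (owner∉ x)) (≤-reflexive (cong v′ (sym new≡))))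
    ... | inj₂ e = go (x <? v (owner x)) (x <? v′ (newIdx x))
      where
      j = idx (suc x)
      v′-new : suc (v′ (newIdx x)) ≡ v j
      v′-new = trans (cong (suc ∘ v′) (if-true e)) (v′-in (idx-< (suc x)) e)
      go : (d : Dec (x < v (owner x))) (b : Dec (x < v′ (newIdx x))) → 𝟙 b + 𝟙 (shifted? (suc x)) ≡ 𝟙 d
      go (yes d) (yes b) = cong suc (𝟙-no (shifted? (suc x)) (λ { (_ , q , _) → <⇒≱ (s≤s b) (≤-trans (≤-reflexive v′-new) q) }))
      go (yes d) (no b) = 𝟙-yes (shifted? (suc x)) (e , ≤-trans (≤-reflexive (sym v′-new)) (s≤s (≮⇒≥ b)) ,
        subst (λ c → suc x < v c) (sym (owner-suc e))
          (≤∧≢⇒< d (λ eq → false≢true (trans (cong A (trans (cong idx eq) (idx-v (owner-< x)))) (owner∉ x)) e)))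
      go (no d) (yes b) = ⊥-elim (d (<-trans (n<1+n x) (<-≤-trans (s≤s b) (≤-trans (≤-reflexive v′-new) (<⇒≤ (<-≤-trans (v<v-owner (suc x) e) (≤-reflexive (cong v (owner-suc e)))))))))
      go (no d) (no b) = 𝟙-no (shifted? (suc x)) (λ { (_ , _ , q) → d (<-trans (n<1+n x) (subst (λ c → suc x < v c) (owner-suc e) q)) })

  -- Downward induction from `v k + v′ k`, where both paths have run out of beads and nothing is
  -- shifted.
  h′≡h+shifted : ∀ x → h′ x ≡ h x + 𝟙 (shifted? x)
  h′≡h+shifted x = down (v k + v′ k) x (m≤n+m _ x)
    where
    T≤⇒ : ∀ {x} → v k + v′ k ≤ x → h′ x ≡ h x + 𝟙 (shifted? x)
    T≤⇒ {x} q = trans (Path.beyond-top W′.isPath (≤-trans (m≤n+m (v′ k) (v k)) q))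
      (sym (cong₂ _+_ (Path.beyond-top isPath (≤-trans (m≤m+n (v k) (v′ k)) q))
        (𝟙-no (shifted? x) (λ { (_ , _ , p) → <⇒≱ p (≤-trans (v-mono (≤-pred (owner-< x)) (n<1+n k)) (≤-trans (m≤m+n (v k) (v′ k)) q)) }))))
    down : ∀ d x → v k + v′ k ≤ x + d → h′ x ≡ h x + 𝟙 (shifted? x)
    down zero x q = T≤⇒ (≤-trans q (≤-reflexive (+-identityʳ x)))
    down (suc d) x q = begin
      h′ x                                                ≡⟨ W′.h-local x ⟩
      h′ (suc x) + β′                                     ≡⟨ cong (_+ β′) (down d (suc x) (≤-trans q (≤-reflexive (+-suc x d)))) ⟩
      h (suc x) + 𝟙 (shifted? (suc x)) + β′               ≡⟨ shuffle (h (suc x)) (𝟙 (shifted? (suc x))) β′ ⟩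
      h (suc x) + (β′ + 𝟙 (shifted? (suc x)))             ≡⟨ cong (h (suc x) +_) (trans (bead′+shifted x) (sym (bead+shifted x))) ⟩
      h (suc x) + (β + 𝟙 (shifted? x))                    ≡⟨ +-assoc (h (suc x)) β _ ⟨
      h (suc x) + β + 𝟙 (shifted? x)                      ≡⟨ cong (_+ 𝟙 (shifted? x)) (h-local x) ⟨
      h x + 𝟙 (shifted? x)                                ∎
      where
      open ≡-Reasoning
      β = 𝟙 (x <? v (idx x))
      β′ = 𝟙 (x <? v′ (newIdx x))
      shuffle : ∀ a b c → a + b + c ≡ a + (c + b)
      shuffle = ℕ-Solver.solve-∀

  moved⇒shifted : ∀ {x} → h x < h′ x → Shifted x
  moved⇒shifted {x} q with shifted? x in eq
  ... | yes s = s
  ... | no ¬s = ⊥-elim (<-irrefl (sym (trans (h′≡h+shifted x) (trans (cong (h x +_) (𝟙-no (shifted? x) ¬s)) (+-identityʳ (h x))))) q)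

  shifted⇒moved : ∀ {x} → Shifted x → h x < h′ x
  shifted⇒moved {x} s = ≤-reflexive (sym (trans (h′≡h+shifted x) (trans (cong (h x +_) (𝟙-yes (shifted? x) s)) (+-comm (h x) 1))))

  same₀ : h′ 0 ≡ h 0
  same₀ = trans (h′≡h+shifted 0) (trans (cong (h 0 +_) (𝟙-no (shifted? 0) λ { (_ , q , _) →
    <⇒≱ 1≤v₀ (≤-trans (v-mono z≤n (idx-< 0)) q) })) (+-identityʳ (h 0)))

  interlaced : Interlaced h h′
  interlaced x = ≤-trans (m≤m+n (h x) _) (≤-reflexive (sym (h′≡h+shifted x))) , upper (shifted? x)
    where
    upper : Dec (Shifted x) → h′ x ≤ suc (h (suc x))
    upper (no ¬s) = ≤-trans (≤-reflexive (trans (h′≡h+shifted x) (trans (cong (h x +_) (𝟙-no (shifted? x) ¬s)) (+-identityʳ (h x))))) (IsPath.lipschitz isPath x)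
    upper (yes s@(_ , q , _)) = ≤-reflexive (trans (h′≡h+shifted x) (trans (cong (h x +_) (𝟙-yes (shifted? x) s))
      (trans (+-comm (h x) 1) (cong suc (sym (⇒gap q))))))

  shifted-v : ∀ {i} → i < n → i ∈ᵇ A → Shifted (v i)
  shifted-v {i} i<n e = idx∈ , ≤-reflexive (cong v (idx-v i<n)) ,
    subst (λ j → v j < v (owner (v i))) (idx-v i<n) (v<v-owner (v i) idx∈)
    where
    idx∈ : idx (v i) ∈ᵇ A
    idx∈ = subst (_∈ᵇ A) (sym (idx-v i<n)) e

  -- A gap of `A` passes one bead. A carried gap passes none: by validity every class of its block
  -- has its lowest gap below `v i`, so the path is flat along the block.
  h′-v′ : ∀ {i} → i < n → h′ (v′ i) ≡ h (v i) + 𝟙 (i ∈ᵇ? A)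
  h′-v′ {i} i<n with i ∈ᵇ? A
  ... | yes e = trans (sym (W′.gap-v i<n)) (trans (cong h′ (v′-in i<n e))
    (trans (h′≡h+shifted (v i)) (cong (h (v i) +_) (𝟙-yes (shifted? (v i)) (shifted-v i<n e)))))
  ... | no ¬e = begin
    h′ (v′ i)                                           ≡⟨ h′≡h+shifted (v′ i) ⟩
    h (v′ i) + 𝟙 (shifted? (v′ i))                      ≡⟨ cong (h (v′ i) +_) (𝟙-no (shifted? (v′ i)) ¬shifted) ⟩
    h (v′ i) + 0                                        ≡⟨ cong (λ x → h x + 0) (v′-out o) ⟩
    h (v i + run k (v i)) + 0                           ≡⟨ cong (_+ 0) (along (run k (v i)) ≤-refl) ⟩
    h (v i) + 0                                         ∎
    where
    open ≡-Reasoning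
    o : A i ≡ false
    o with false⊎true (A i)
    ... | inj₁ o = o
    ... | inj₂ e = ⊥-elim (¬e e)
    ¬shifted : ¬ Shifted (v′ i)
    ¬shifted (_ , _ , q) = <⇒≱ q (≤-trans (≤-reflexive (cong v (trans (cong owner (v′-out o)) (owner-run i<n o _ ≤-refl)))) (v≤v′ o))
    gap-run : ∀ e → e ≤ run k (v i) → Gap h (v i + e)
    gap-run zero _ = subst (Gap h) (sym (+-identityʳ (v i))) (gap-v i<n)
    gap-run (suc e) q = ⇒gap (≤-trans (<⇒≤ (<-≤-trans (v<v-owner _ (subst (λ x → idx x ∈ᵇ A) (sym (+-suc (v i) e)) (run-inside k (v i) q)))
                                            (≤-reflexive (cong v (owner-run i<n o (suc e) q))))) (m≤m+n (v i) (suc e)))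
    along : ∀ e → e ≤ run k (v i) → h (v i + e) ≡ h (v i)
    along zero _ = cong h (+-identityʳ (v i))
    along (suc e) q = trans (cong h (+-suc (v i) e)) (trans (gap-run e (<⇒≤ q)) (along e (<⇒≤ q)))

-- Residues of strip cells and of unblocked corners

unique-length-≤ : {X : Set} (xs ys : List X) → Unique xs → (∀ {a} → a ∈ xs → a ∈ ys) → length xs ≤ length ys
unique-length-≤ [] ys _ _ = z≤n
unique-length-≤ (x ∷ xs) ys (x∉ ∷ u) sub with ∈-∃++ (sub (here refl))
... | as , bs , refl = ≤-trans (s≤s (unique-length-≤ xs (as ++ bs) u sub′)) (≤-reflexive
    (trans (cong suc (length-++ as)) (trans (sym (+-suc (length as) (length bs))) (sym (length-++ as)))))
  where
  sub′ : ∀ {a} → a ∈ xs → a ∈ as ++ bs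
  sub′ {a} a∈ with ∈-++⁻ as (sub (there a∈))
  ... | inj₁ p = ∈-++⁺ˡ p
  ... | inj₂ (here e) = ⊥-elim (All.lookup x∉ a∈ (sym e))
  ... | inj₂ (there p) = ∈-++⁺ʳ as p

module Classes (n : ℕ) (f : ℕ → ℕ) (inj : ∀ {i j} → i < n → j < n → f i ≡ f j → i ≡ j)
               {Q : ℕ → Set} (Q? : ∀ i → Dec (Q i)) where
  private
    chosen classes : List ℕ
    chosen = filter Q? (upTo n)
    classes = map f chosen

    ∈classes⁺ : ∀ {i} → i < n → Q i → f i ∈ classes
    ∈classes⁺ i<n q = ∈-map⁺ f (∈-filter⁺ Q? (∈-upTo⁺ i<n) q)

    ∈classes⁻ : ∀ {z} → z ∈ classes → ∃ λ i → i < n × Q i × z ≡ f i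
    ∈classes⁻ z∈ with ∈-map⁻ f z∈
    ... | i , i∈ , e with ∈-filter⁻ Q? {xs = upTo n} i∈
    ...   | i∈′ , q = i , ∈-upTo⁻ i∈′ , q , e

    classes-unique : Unique classes
    classes-unique = AllPairsₚ.map⁺ (AllPairsₚ.filter⁺ Q? (AllPairsₚ.applyUpTo⁺₁ id n
      (λ i<j j<n e → <⇒≢ i<j (inj (<-trans i<j j<n) j<n e))))

    classes-length : length classes ≡ Σ< n (𝟙 ∘ Q?)
    classes-length = trans (length-map f chosen) (length-filter-applyUpTo Q? id n)

  module _ (zs : List ℕ) (into : ∀ {i} → i < n → Q i → f i ∈ zs) where
    private
      sub : ∀ {z} → z ∈ classes → z ∈ deduplicate _≟_ zs
      sub z∈ with ∈classes⁻ z∈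
      ... | i , i<n , q , refl = ∈-deduplicate⁺ _≟_ (into i<n q)

    distinct-count : (∀ {z} → z ∈ zs → ∃ λ i → i < n × Q i × z ≡ f i) → length (deduplicate _≟_ zs) ≡ Σ< n (𝟙 ∘ Q?)
    distinct-count back = trans (≤-antisym
      (unique-length-≤ _ classes (deduplicate-! zs) (λ z∈ → onto (back (∈-deduplicate⁻ _≟_ zs z∈))))
      (unique-length-≤ classes _ classes-unique sub)) classes-length
      where
      onto : ∀ {z} → (∃ λ i → i < n × Q i × z ≡ f i) → z ∈ classes
      onto (i , i<n , q , refl) = ∈classes⁺ i<n q

    -- The values at the indices with `Q` already exhaust the number of distinct entries of `zs`;
    -- one further value `f i` would exceed it.
    distinct-full : length (deduplicate _≟_ zs) ≡ Σ< n (𝟙 ∘ Q?) → ∀ {i} → i < n → f i ∈ zs → Q i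
    distinct-full eq {i} i<n fi∈ with Q? i
    ... | yes q = q
    ... | no ¬q = ⊥-elim (<-irrefl (trans classes-length (sym eq)) (unique-length-≤ (f i ∷ classes) _
        (All.tabulate (λ z∈ e → new (∈classes⁻ (subst (_∈ classes) (sym e) z∈))) ∷ classes-unique)
        λ { (here refl) → ∈-deduplicate⁺ _≟_ fi∈ ; (there z∈) → sub z∈ }))
      where
      new : (∃ λ j → j < n × Q j × f i ≡ f j) → ⊥
      new (j , j<n , q , e) with inj i<n j<n e
      ... | refl = ¬q q

rep-unique : ∀ {τ κ h h′} → Rep τ h → Rep κ h′ → (∀ x → h x ≡ h′ x) → τ ≡ κ
rep-unique {τ} {κ} {h} {h′} r r′ eq = partition-ext R.isPartition R′.isPartition (λ i → ≡-ext (to i) (from i))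
  where
  module R = Rep r
  module R′ = Rep r′
  pos : ∀ {B i} j → i < B → (j + B ∸ i) + i ≡ j + B
  pos {B} j i<B = m∸n+n≡m (≤-trans (<⇒≤ i<B) (m≤n+m B j))
  to : ∀ i j → j < row τ i → j < row κ i
  to i j q = proj₂ (R′.cell (trans (pos j i<B) (cong (j +_) (eq 0)))) (subst (i <_) (eq _) (proj₁ (R.cell (pos j i<B)) q))
    where i<B = ≰⇒> λ B≤i → n≮0 (<-≤-trans q (≤-reflexive (R.beyond i B≤i)))
  from : ∀ i j → j < row κ i → j < row τ i
  from i j q = proj₂ (R.cell (trans (pos j i<B) (cong (j +_) (sym (eq 0))))) (subst (i <_) (sym (eq _)) (proj₁ (R′.cell (pos j i<B)) q))
    where i<B = ≰⇒> λ B≤i → n≮0 (<-≤-trans q (≤-reflexive (R′.beyond i B≤i)))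

mutual
  -- The local recursion of freeCorners is not in scope; freeCorners-∷ serves to
  -- recover it by unification.
  freeCornersFrom : Partition → Partition → ℕ → List ℕ → List Cell
  freeCornersFrom = _

  freeCorners-∷ : ∀ κ j xs → freeCorners κ (suc j ∷ xs) ≡
    (if (row xs 0 ≤ᵇ j) ∧ (row κ 1 ≤ᵇ j)
     then (0 , j) ∷ freeCornersFrom κ (suc j ∷ xs) 1 xs else freeCornersFrom κ (suc j ∷ xs) 1 xs)
  freeCorners-∷ κ j xs with suc j ∷ xs | 1
  ... | τ | i = refl

module _ (κ τ : Partition) where

  FreeCorner : Cell → Set
  FreeCorner (i , j) = suc j ≡ row τ i × row τ (suc i) ≤ j × row κ (suc i) ≤ j

  private
    ∈-if⁺ : ∀ b {c : Cell} {cs} → T b → c ∈ (if b then c ∷ cs else cs)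
    ∈-if⁺ true _ = here refl

    ∈-if⁺′ : ∀ b {c d : Cell} {cs} → c ∈ cs → c ∈ (if b then d ∷ cs else cs)
    ∈-if⁺′ true c∈ = there c∈
    ∈-if⁺′ false c∈ = c∈

    ∈-if⁻ : ∀ b {c d : Cell} {cs} → c ∈ (if b then d ∷ cs else cs) → (T b × c ≡ d) ⊎ c ∈ cs
    ∈-if⁻ true (here e) = inj₁ (_ , e)
    ∈-if⁻ true (there p) = inj₂ p
    ∈-if⁻ false p = inj₂ p

    from⁺ : ∀ m xs → (∀ i → row xs i ≡ row τ (m + i)) → ∀ {i j} → FreeCorner (m + i , j) → (m + i , j) ∈ freeCornersFrom κ τ m xs
    from⁺ m [] e {i} (r , _) = ⊥-elim (1+n≢0 (trans r (sym (e i))))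
    from⁺ m (x ∷ xs) e {zero} {j} (r , a , b) with trans (e 0) (sym r)
    ... | refl rewrite +-identityʳ m =
      ∈-if⁺ ((row τ (suc m) ≤ᵇ j) ∧ (row κ (suc m) ≤ᵇ j)) (Equivalence.from T-∧ (≤⇒≤ᵇ a , ≤⇒≤ᵇ b))
    from⁺ m (zero ∷ xs) e {suc i} c rewrite +-suc m i =
      from⁺ (suc m) xs (λ i → trans (e (suc i)) (cong (row τ) (+-suc m i))) c
    from⁺ m (suc y ∷ xs) e {suc i} {j} c rewrite +-suc m i =
      ∈-if⁺′ ((row τ (suc m) ≤ᵇ y) ∧ (row κ (suc m) ≤ᵇ y)) (from⁺ (suc m) xs (λ i → trans (e (suc i)) (cong (row τ) (+-suc m i))) c)

    from⁻ : ∀ m xs → (∀ i → row xs i ≡ row τ (m + i)) → ∀ {c} → c ∈ freeCornersFrom κ τ m xs → FreeCorner c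
    from⁻ m (zero ∷ xs) e c∈ = from⁻ (suc m) xs (λ i → trans (e (suc i)) (cong (row τ) (+-suc m i))) c∈
    from⁻ m (suc y ∷ xs) e c∈ with ∈-if⁻ ((row τ (suc m) ≤ᵇ y) ∧ (row κ (suc m) ≤ᵇ y)) c∈
    ... | inj₂ p = from⁻ (suc m) xs (λ i → trans (e (suc i)) (cong (row τ) (+-suc m i))) p
    ... | inj₁ (t , refl) with Equivalence.to (T-∧ {row τ (suc m) ≤ᵇ y}) t
    ...   | a , b = trans (e 0) (cong (row τ) (+-identityʳ m)) , ≤ᵇ⇒≤ (row τ (suc m)) y a , ≤ᵇ⇒≤ (row κ (suc m)) y b

  ∈freeCorners⁺ : ∀ {c} → FreeCorner c → c ∈ freeCorners κ τ
  ∈freeCorners⁺ = from⁺ 0 τ (λ _ → refl)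

  ∈freeCorners⁻ : ∀ {c} → c ∈ freeCorners κ τ → FreeCorner c
  ∈freeCorners⁻ = from⁻ 0 τ (λ _ → refl)

module Residues {k : ℕ} {τ κ : Partition} {h h′ : ℕ → ℕ}
  (rep : Rep τ h) (path : IsPath h) (rep′ : Rep κ h′) (path′ : IsPath h′)
  (same : h′ 0 ≡ h 0) (il : Interlaced h h′) where
  open Mod k
  private
    module A = RepPath rep path
    module B = RepPath rep′ path′
  open Strip path path′ same il

  -- Modulo `k + 1` the summand `h 0 * k` is `- h 0`, and `x - h 0` is the content of the cells
  -- attached to position `x`.
  posResidue : ℕ → ℕ
  posResidue x = (x + h 0 * k) % n

  posResidue-cong : ∀ {x y} → x ≋ y → posResidue x ≡ posResidue y
  posResidue-cong {x} {y} e = begin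
    (x + h 0 * k) % n                    ≡⟨ %-distribˡ-+ x (h 0 * k) n ⟩
    (x % n + h 0 * k % n) % n            ≡⟨ cong (λ z → (z + h 0 * k % n) % n) e ⟩
    (y % n + h 0 * k % n) % n            ≡⟨ %-distribˡ-+ y (h 0 * k) n ⟨
    (y + h 0 * k) % n                    ∎
    where open ≡-Reasoning

  posResidue-injective : ∀ {x y} → posResidue x ≡ posResidue y → x ≋ y
  posResidue-injective {x} {y} e = trans (sym (back x)) (trans (cong (λ z → (z + h 0 % n) % n) e) (back y))
    where
    shuffle : ∀ a b c → a + b * c + b ≡ a + b * suc c
    shuffle = ℕ-Solver.solve-∀
    back : ∀ x → (posResidue x + h 0 % n) % n ≡ x % n
    back x = trans (sym (%-distribˡ-+ (x + h 0 * k) (h 0) n)) (trans (cong (_% n) (shuffle x (h 0) k)) (≋-+* x (h 0)))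

  residue-pos : ∀ i j x → x + i ≡ j + h 0 → residue k (i , j) ≡ posResidue x
  residue-pos i j x e = begin
    (j + i * k) % n                        ≡⟨ ≋-+* (j + i * k) (h 0) ⟨
    (j + i * k + h 0 * n) % n              ≡⟨ cong (_% n) (shuffle j i k (h 0)) ⟩
    (j + h 0 + i * k + h 0 * k) % n        ≡⟨ cong (λ z → (z + i * k + h 0 * k) % n) e ⟨
    (x + i + i * k + h 0 * k) % n          ≡⟨ cong (_% n) (shuffle′ x i k (h 0 * k)) ⟩
    (x + h 0 * k + i * n) % n              ≡⟨ ≋-+* (x + h 0 * k) i ⟩
    posResidue x                           ∎
    where
    open ≡-Reasoning
    shuffle : ∀ j i k B → j + i * k + B * suc k ≡ j + B + i * k + B * k
    shuffle = ℕ-Solver.solve-∀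
    shuffle′ : ∀ x i k c → x + i + i * k + c ≡ x + c + i * suc k
    shuffle′ = ℕ-Solver.solve-∀

  -- The gap moved from `x` adds the cell on top of its column of `τ`: column `gaps h x`, row `h x`.
  moved-residue⁺ : ∀ {x} → Moved x → posResidue x ∈ map (residue k) (skewCells κ τ)
  moved-residue⁺ {x} m = subst (_∈ map (residue k) (skewCells κ τ)) (residue-pos (h x) (gaps h x) x (sym (A.balance x)))
    (∈-map⁺ (residue k) (∈-filter⁺ _ (∈cells⁺ κ (proj₂ (B.cell (trans (sym (A.balance x)) (cong (gaps h x +_) (sym same)))) m))
      (≮⇒≥ λ q → <-irrefl refl (proj₁ (A.cell (sym (A.balance x))) q))))

  moved-residue⁻ : ∀ {z} → z ∈ map (residue k) (skewCells κ τ) → ∃ λ x → Moved x × z ≡ posResidue x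
  moved-residue⁻ z∈ with ∈-map⁻ (residue k) z∈
  ... | (i , j) , c∈ , refl with ∈-filter⁻ (λ c → row τ (proj₁ c) ≤? proj₂ c) {xs = cells κ} c∈
  ...   | c∈κ , r≤j = j + h 0 ∸ i , ≤-<-trans (≮⇒≥ λ q → <⇒≱ (proj₂ (A.cell e) q) r≤j) (proj₁ (B.cell (trans e (cong (j +_) (sym same)))) (∈cells⁻ κ c∈κ)) ,
                        residue-pos i j (j + h 0 ∸ i) e
    where
    e : (j + h 0 ∸ i) + i ≡ j + h 0
    e = m∸n+n≡m (≤-trans (<⇒≤ (<-≤-trans (B.row-bound (∈cells⁻ κ c∈κ)) (≤-reflexive same))) (m≤n+m (h 0) j))

  -- A removable corner of `τ` is a gap `y` followed by a bead, and it is blocked when this gap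
  -- moves away. Nothing can move into `y` from a bead, so a gap of `h′` at `y` was already there in
  -- `h` and has stayed.
  corner-residue⁺ : ∀ {y} → Gap h′ y → Bead h (suc y) → posResidue (suc y) ∈ map (residue k) (freeCorners κ τ)
  corner-residue⁺ {y} e b = subst (_∈ map (residue k) (freeCorners κ τ)) (residue-pos (h (suc (suc y))) (gaps h y) (suc y) pos₀)
    (∈-map⁺ (residue k) (∈freeCorners⁺ κ τ (≤-antisym (proj₂ (A.cell pos₀) (≤-reflexive (sym b)))
        (≮⇒≥ λ q → <-irrefl refl (proj₁ (A.cell pos₁) q)) ,
      (≮⇒≥ λ q → <⇒≱ (proj₁ (A.cell pos₂) q) (≤-trans (proj₁ (il y)) (≤-reflexive h′y))) ,
      (≮⇒≥ λ q → <⇒≱ (proj₁ (B.cell (trans pos₂ (cong (gaps h y +_) (sym same)))) q) (≤-reflexive h′y)))))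
    where
    i = h (suc (suc y))
    h′y : h′ y ≡ suc i
    h′y = trans (sym e) (≤-antisym (proj₂ (il (suc y))) (≤-trans (≤-reflexive (sym b)) (proj₁ (il (suc y)))))
    hy : h y ≡ suc i
    hy = ≤-antisym (≤-trans (proj₁ (il y)) (≤-reflexive h′y)) (≤-trans (≤-reflexive (sym b)) (A.antitone y))
    pos₂ : y + suc i ≡ gaps h y + h 0
    pos₂ = trans (cong (y +_) (sym hy)) (sym (A.balance y))
    pos₀ : suc y + i ≡ gaps h y + h 0
    pos₀ = trans (sym (+-suc y i)) pos₂
    pos₁ : suc (suc y) + i ≡ suc (gaps h y) + h 0
    pos₁ = cong suc pos₀

  corner-residue⁻ : ∀ {z} → z ∈ map (residue k) (freeCorners κ τ) → ∃ λ y → Gap h′ y × Bead h (suc y) × z ≡ posResidue (suc y)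
  corner-residue⁻ z∈ with ∈-map⁻ (residue k) z∈
  ... | (i , j) , c∈ , refl with ∈freeCorners⁻ κ τ c∈
  ...   | r , _ , r′ = find (j + h 0 ∸ i) (m∸n+n≡m (≤-trans (<⇒≤ i<B) (m≤n+m (h 0) j)))
    where
    i<B : i < h 0
    i<B = A.row-bound {i} {j} (≤-reflexive r)
    find : ∀ x → x + i ≡ j + h 0 → ∃ λ y → Gap h′ y × Bead h (suc y) × residue k (i , j) ≡ posResidue (suc y)
    find zero e = ⊥-elim (<⇒≱ i<B (≤-trans (m≤n+m (h 0) j) (≤-reflexive (sym e))))
    find (suc y) e = y , ≤-antisym (B.antitone y) (≤-trans h′y≤ (≤-trans (≤-reflexive (sym hx)) (proj₁ (il (suc y))))) ,
        trans hx (cong suc (sym hsx)) , residue-pos i j (suc y) e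
      where
      i<hx : i < h (suc y)
      i<hx = proj₁ (A.cell e) (≤-reflexive r)
      hsx≤ : h (suc (suc y)) ≤ i
      hsx≤ = ≮⇒≥ λ q → <-irrefl r (proj₂ (A.cell {x = suc (suc y)} (cong suc e)) q)
      hx : h (suc y) ≡ suc i
      hx = ≤-antisym (≤-trans (A.lipschitz (suc y)) (s≤s hsx≤)) i<hx
      hsx : h (suc (suc y)) ≡ i
      hsx = ≤-antisym hsx≤ (≤-pred (≤-trans (≤-reflexive (sym hx)) (A.lipschitz (suc y))))
      h′y≤ : h′ y ≤ suc i
      h′y≤ = ≮⇒≥ λ q → <⇒≱ (proj₂ (B.cell (trans (+-suc y i) (trans e (cong (j +_) (sym same))))) q) r′

-- Weak strips correspond to valid moves

card : ℕ → (ℕ → Bool) → ℕ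
card n A = Σ< n (λ i → 𝟙 (i ∈ᵇ? A))

card-cong : ∀ n {A A′} → (∀ i → i < n → A i ≡ A′ i) → card n A ≡ card n A′
card-cong n {A} {A′} e = Σ<-cong n (λ i i<n → 𝟙-⇔ (i ∈ᵇ? A) (i ∈ᵇ? A′) (trans (sym (e i i<n))) (trans (e i i<n)))

card<⇒∉ : ∀ n A → card n A < n → ∃ λ i → i < n × A i ≡ false
card<⇒∉ (suc n) A q with false⊎true (A n)
... | inj₁ o = n , n<1+n n , o
... | inj₂ e with card<⇒∉ n A (≤-pred (subst (_< suc n) (trans (cong (card n A +_) (𝟙-yes (n ∈ᵇ? A) e)) (+-comm (card n A) 1)) q))
...   | i , i<n , o = i , m<n⇒m<1+n i<n , o

card≤⇒proper : ∀ {k idx v} → Window k idx v → ∀ A → card (suc k) A ≤ k → RawMove.Proper k idx A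
card≤⇒proper {k} {idx} {v} w A q with card<⇒∉ (suc k) A (s≤s q)
... | i , i<n , o = lastFalse-false (A ∘ idx) (suc k) (m%n<n (v i) (suc k))
  (trans (cong A (trans (idx-cong {v i % suc k} {v i} (m%n%n≡m%n (v i) (suc k))) (idx-v i<n))) o)
  where open WindowPath w

module Core {k : ℕ} {idx v : ℕ → ℕ} (w : Window k idx v) where
  open WindowPath w

  rep : Rep (core k v) h
  rep = rep-core isPath

  isCore : IsCore k (core k v)
  isCore = RepPath.flush⇒core rep isPath flush

module Sound {k : ℕ} {idx v : ℕ → ℕ} (w : Window k idx v) (A : ℕ → Bool)
             (proper : RawMove.Proper k idx A) (valid : RawMove.Valid k idx A) (1≤v₀ : 1 ≤ v 0) where
  open WindowPath w
  open Move w A proper valid 1≤v₀ hiding (valid)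
  open RawMove k idx A
  private
    module W′ = WindowPath window′
    rep = Core.rep w
    rep′ = Core.rep window′
  open Strip isPath W′.isPath same₀ interlaced
  open Residues {k} rep isPath rep′ W′.isPath same₀ interlaced

  weakStrip : WeakStrip k (core k v) (core k v′) (card n A)
  weakStrip = proj₁ strip , proj₂ strip ,
    trans (size-strip W′.isPath same₀ interlaced W′.flush rep rep′) (cong (size≤ k (core k v) +_)
      (Σ<-cong n (λ i i<n → 𝟙-⇔ (moved? (v i)) (i ∈ᵇ? A) (moved⇒∈ i<n) (λ e → shifted⇒moved (shifted-v i<n e))))) ,
    Classes.distinct-count n (posResidue ∘ v) inj (_∈ᵇ? A) (map (residue k) (skewCells (core k v′) (core k v)))
      (λ {i} i<n e → moved-residue⁺ {v i} (shifted⇒moved (shifted-v i<n e))) back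
    where
    strip : Contained (core k v) (core k v′) × Horizontal (core k v) (core k v′)
    strip = interlaced⇒strip rep isPath rep′ W′.isPath same₀ interlaced
    inj : ∀ {i j} → i < n → j < n → posResidue (v i) ≡ posResidue (v j) → i ≡ j
    inj {i} {j} i<n j<n e = trans (sym (idx-v i<n)) (trans (idx-cong (posResidue-injective {v i} {v j} e)) (idx-v j<n))
    moved⇒∈ : ∀ {i} → i < n → Moved (v i) → i ∈ᵇ A
    moved⇒∈ i<n m = subst (_∈ᵇ A) (idx-v i<n) (proj₁ (moved⇒shifted m))
    back : ∀ {z} → z ∈ map (residue k) (skewCells (core k v′) (core k v)) → ∃ λ i → i < n × i ∈ᵇ A × z ≡ posResidue (v i)
    back z∈ with moved-residue⁻ z∈
    ... | x , m , refl = idx x , idx-< x , proj₁ (moved⇒shifted m) , posResidue-cong {x} {v (idx x)} (sym (v-idx x))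

  -- The class of v i carries an unblocked corner exactly when the lowest gap
  -- of the preceding class, after the move, is not adjacent to v i.
  rr-count : rr k (core k v′) (core k v) ≡ Σ< n (λ i → 𝟙 (suc (v′ (newIdx (v i + k))) <? v i))
  rr-count = Classes.distinct-count n (posResidue ∘ v) inj (λ i → suc (v′ (newIdx (v i + k))) <? v i) _ into back
    where
    inj : ∀ {i j} → i < n → j < n → posResidue (v i) ≡ posResidue (v j) → i ≡ j
    inj {i} {j} i<n j<n e = trans (sym (idx-v i<n)) (trans (idx-cong (posResidue-injective {v i} {v j} e)) (idx-v j<n))
    suc-≋ : ∀ {y z} → y ≋ z + k → suc y ≋ z
    suc-≋ {y} {z} e = begin
      suc y % n                       ≡⟨ %-distribˡ-+ 1 y n ⟩
      (1 % n + y % n) % n             ≡⟨ cong (λ a → (1 % n + a) % n) e ⟩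
      (1 % n + (z + k) % n) % n       ≡⟨ %-distribˡ-+ 1 (z + k) n ⟨
      suc (z + k) % n                 ≡⟨ cong (_% n) (+-suc z k) ⟨
      (z + n) % n                     ≡⟨ [m+n]%n≡m%n z n ⟩
      z % n                           ∎
      where open ≡-Reasoning
    ≋-pred : ∀ {y z} → suc y ≋ z → y ≋ z + k
    ≋-pred {y} {z} e = begin
      y % n                           ≡⟨ [m+n]%n≡m%n y n ⟨
      (y + n) % n                     ≡⟨ cong (_% n) (+-suc y k) ⟩
      (suc y + k) % n                 ≡⟨ %-distribˡ-+ (suc y) k n ⟩
      (suc y % n + k % n) % n         ≡⟨ cong (λ a → (a + k % n) % n) e ⟩
      (z % n + k % n) % n             ≡⟨ %-distribˡ-+ z k n ⟨
      (z + k) % n                     ∎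
      where open ≡-Reasoning
    into : ∀ {i} → i < n → suc (v′ (newIdx (v i + k))) < v i → posResidue (v i) ∈ map (residue k) (freeCorners (core k v′) (core k v))
    into {i} i<n q = subst (_∈ map (residue k) (freeCorners (core k v′) (core k v))) (posResidue-cong {suc y} {v i} cls)
      (corner-residue⁺ {y} (W′.gap-v (newIdx-< (v i + k))) bead)
      where
      y = v′ (newIdx (v i + k))
      cls : suc y ≋ v i
      cls = suc-≋ {y} {v i} (W′.v-idx (v i + k))
      bead : Bead h (suc y)
      bead with Path.gap⊎bead isPath (suc y)
      ... | inj₂ b = b
      ... | inj₁ e = ⊥-elim (<⇒≱ q (≤-trans (≤-reflexive (cong v (sym (trans (idx-cong {suc y} {v i} cls) (idx-v i<n))))) (gap⇒ e)))
    back : ∀ {z} → z ∈ map (residue k) (freeCorners (core k v′) (core k v)) →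
      ∃ λ i → i < n × suc (v′ (newIdx (v i + k))) < v i × z ≡ posResidue (v i)
    back z∈ with corner-residue⁻ z∈
    ... | y , e , b , refl = i , idx-< (suc y) , <-≤-trans (s≤s (s≤s v′≤y)) sy<v , posResidue-cong {suc y} {v i} (sym (v-idx (suc y)))
      where
      i = idx (suc y)
      sy<v : suc y < v i
      sy<v = ≰⇒> λ q → Path.¬gap∧bead isPath (⇒gap q) b
      v′≤y : v′ (newIdx (v i + k)) ≤ y
      v′≤y = subst (λ c → v′ c ≤ y) (W′.idx-cong {y} {v i + k} (≋-pred {y} {v i} (sym (v-idx (suc y))))) (W′.gap⇒ e)

module Complete {k : ℕ} {idx v : ℕ → ℕ} (w : Window k idx v) (1≤v₀ : 1 ≤ v 0)
  {κ : Partition} (κ-partition : IsPartition κ) (κ-core : IsCore k κ)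
  {s : ℕ} (s≤k : s ≤ k) (κ-strip : WeakStrip k (core k v) κ s) where
  open WindowPath w
  open Path isPath using (h-anti; find-bead; ¬gap∧bead; gap⊎bead)
  private
    τ = core k v
    module τ-rep = RepPath (Core.rep w) isPath

    bead₀ : Bead h 0
    bead₀ with gap⊎bead 0
    ... | inj₂ b = b
    ... | inj₁ e = ⊥-elim (<⇒≱ 1≤v₀ (≤-trans (v-mono z≤n (idx-< 0)) (gap⇒ e)))

    -- Position 0 is a bead with no gap below it, hence an empty row of `τ`. A horizontal strip
    -- lengthens the first column by at most one, so `κ` still fits into `h 0` beads.
    col₀ : suc (col τ 0) ≤ h 0
    col₀ = ≮⇒≥ λ q → last (h 1) bead₀ (proj₁ (<col⇔<row τ-rep.isPartition) (≤-pred (≤-trans (≤-reflexive (cong suc (sym bead₀))) q)))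
      where
      last : ∀ i → h 0 ≡ suc i → 0 < row τ i → ⊥
      last i e q = <-irrefl (sym (suc-injective (trans (sym bead₀) e))) (proj₁ (τ-rep.cell {i} {0} {1} (sym e)) q)

    rows-beyond : ∀ i → h 0 ≤ i → row κ i ≡ 0
    rows-beyond i B≤i = n≤0⇒n≡0 (≮⇒≥ λ q → <⇒≱ (<-≤-trans (proj₂ (<col⇔<row κ-partition) q) (≤-trans (proj₁ (proj₂ κ-strip) 0) col₀)) B≤i)

  h′ : ℕ → ℕ
  h′ = pathOf κ (h 0)

  private
    rep′ : Rep κ h′
    rep′ = rep-pathOf κ-partition rows-beyond
    path′ : IsPath h′
    path′ = isPath-pathOf κ-partition rows-beyond
    same : h′ 0 ≡ h 0
    same = pathOf₀ κ-partition rows-beyond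
    il : Interlaced h h′
    il = strip⇒interlaced (Core.rep w) isPath rep′ path′ same (proj₁ κ-strip) (proj₁ (proj₂ κ-strip))
    flush′ : Flush n h′
    flush′ = RepPath.core⇒flush rep′ path′ κ-core

    flush* : ∀ {x} q → Gap h′ x → Gap h′ (x + q * n)
    flush* {x} zero e = subst (Gap h′) (sym (+-identityʳ x)) e
    flush* {x} (suc q) e = subst (Gap h′) (shuffle x (q * n) n) (flush′ _ (flush* q e))
      where
      shuffle : ∀ a b c → a + b + c ≡ a + (c + b)
      shuffle = ℕ-Solver.solve-∀

  open Strip isPath path′ same il
  open Residues {k} (Core.rep w) isPath rep′ path′ same il

  private
    total : Σ< n (λ i → mv (v i)) ≡ s
    total = +-cancelˡ-≡ (size≤ k τ) _ _ (trans (sym (size-strip path′ same il flush′ (Core.rep w) rep′)) (proj₁ (proj₂ (proj₂ κ-strip))))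

    -- By the size condition `s` counts the classes whose lowest gap moves, by the residue condition
    -- the classes in which any gap moves. The first set is contained in the second, so they
    -- coincide.
    lowest-moved : ∀ {x} → Moved x → Moved (v (idx x))
    lowest-moved {x} m = Classes.distinct-full n (posResidue ∘ v) inj (λ i → moved? (v i)) _ (λ {i} _ → moved-residue⁺ {v i})
        (trans (proj₂ (proj₂ (proj₂ κ-strip))) (sym total)) (idx-< x)
        (subst (_∈ map (residue k) (skewCells κ τ)) (posResidue-cong {x} {v (idx x)} (sym (v-idx x))) (moved-residue⁺ {x} m))
      where
      inj : ∀ {i j} → i < n → j < n → posResidue (v i) ≡ posResidue (v j) → i ≡ j
      inj {i} {j} i<n j<n e = trans (sym (idx-v i<n)) (trans (idx-cong (posResidue-injective {v i} {v j} e)) (idx-v j<n))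

  movedSet : ℕ → Bool
  movedSet i = does (moved? (v i))

  -- `A` will be the representative listed in `subsets`, which agrees with `movedSet` only below
  -- `n`.
  module _ (A : ℕ → Bool) (agree : ∀ i → i < n → A i ≡ movedSet i) where
    private
      ∈⇒moved : ∀ {i} → i < n → i ∈ᵇ A → Moved (v i)
      ∈⇒moved {i} i<n e = extract (moved? (v i)) (trans (sym (agree i i<n)) e)
        where
        extract : {P : Set} (d : Dec P) → does d ≡ true → P
        extract (yes p) _ = p
      moved⇒∈ : ∀ {i} → i < n → Moved (v i) → i ∈ᵇ A
      moved⇒∈ {i} i<n m = trans (agree i i<n) (inject (moved? (v i)) m)
        where
        inject : {P : Set} (d : Dec P) → P → does d ≡ true
        inject (yes _) _ = refl
        inject (no ¬p) p = ⊥-elim (¬p p)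

    card-complete : card n A ≡ s
    card-complete = trans (Σ<-cong n (λ i i<n → 𝟙-⇔ (i ∈ᵇ? A) (moved? (v i)) (∈⇒moved i<n) (moved⇒∈ i<n))) total

    proper : RawMove.Proper k idx A
    proper = card≤⇒proper w A (≤-trans (≤-reflexive card-complete) s≤k)

    open RawMove k idx A
    open MoveIdx w A proper

    private
      outside-balance : ∀ x → A (idx x) ≡ false → 𝟙 (gap? h x) ≡ mv x + 𝟙 (v (owner x) ≤? x)
      outside-balance x o = trans (𝟙-⇔ (gap? h x) (v (owner x) ≤? x) (λ e → subst (λ c → v c ≤ x) (sym own) (gap⇒ e)) (λ q → ⇒gap (subst (λ c → v c ≤ x) own q)))
        (cong (_+ 𝟙 (v (owner x) ≤? x)) (sym (𝟙-no (moved? x) λ m → false≢true o (moved⇒∈ (idx-< x) (lowest-moved m)))))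
        where own = owner-outside o

      moved-positive : ∀ {x} → Moved x → ∃ λ u → x ≡ suc u
      moved-positive {zero} m = ⊥-elim (¬moved₀ m)
      moved-positive {suc u} m = u , refl

      -- The induction runs from the base class upwards, one class at a time.
      class-balance : ∀ m x → x ≋ base + m → 𝟙 (gap? h x) ≡ mv x + 𝟙 (v (owner x) ≤? x)
      class-balance zero x e = outside-balance x (trans (cong A (trans (idx-cong e) (cong idx (+-identityʳ base)))) proper)
      class-balance (suc m) x e with false⊎true (A (idx x))
      ... | inj₁ o = outside-balance x o
      ... | inj₂ a = trans (𝟙-⇔ (gap? h x) ((v c ≤? x) ⊎-dec moved? x) to from) (split (v c ≤? x) (moved? x))
        where
        c = owner x
        v≢ : v c ≢ x
        v≢ eq = false≢true (trans (cong A (trans (cong idx (sym eq)) (idx-v (owner-< x)))) (owner∉ x)) a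
        -- The induction hypothesis at the preceding class, pushed through `gap-balance`: after the
        -- move `u` is a gap either because it is on or above the level of the owner or because the
        -- gap at `y` came in, and not for both reasons.
        below : ∀ {u y} → suc u ≡ y → y ≋ x → 𝟙 (gap? h′ u) ≡ 𝟙 (v c ≤? u) + mv y
        below {u} {y} refl y≋x = +-cancelʳ-≡ (mv u) _ _ (begin
          𝟙 (gap? h′ u) + mv u                    ≡⟨ gap-balance u ⟩
          𝟙 (gap? h u) + mv (suc u)               ≡⟨ cong (_+ mv (suc u)) (class-balance m u u≋) ⟩
          mv u + 𝟙 (v (owner u) ≤? u) + mv (suc u)  ≡⟨ cong (λ c → mv u + 𝟙 (v c ≤? u) + mv (suc u)) own ⟩
          mv u + 𝟙 (v c ≤? u) + mv (suc u)        ≡⟨ shuffle (mv u) (𝟙 (v c ≤? u)) (mv (suc u)) ⟩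
          𝟙 (v c ≤? u) + mv (suc u) + mv u        ∎)
          where
          open ≡-Reasoning
          shuffle : ∀ a b c → a + b + c ≡ b + c + a
          shuffle = ℕ-Solver.solve-∀
          own : owner u ≡ c
          own = trans (sym (owner-suc (subst (_∈ᵇ A) (idx-cong (sym y≋x)) a))) (owner-cong {suc u} {x} y≋x)
          u≋ : u ≋ base + m
          u≋ = suc-cancel (trans y≋x (trans e (cong (_% n) (+-suc base m))))
            where
            suc-cancel : ∀ {a b} → suc a ≋ suc b → a ≋ b
            suc-cancel {a} {b} q = trans (sym (back a)) (trans (cong (λ z → (z + k % n) % n) q) (back b))
              where
              back : ∀ a → (suc a % n + k % n) % n ≡ a % n
              back a = trans (sym (%-distribˡ-+ (suc a) k n)) (trans (cong (_% n) (sym (+-suc a k))) ([m+n]%n≡m%n a n))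
        i = idx x
        moved-i : Moved (v i)
        moved-i = ∈⇒moved (idx-< x) a
        u = proj₁ (moved-positive moved-i)
        vi≡ : suc u ≡ v i
        vi≡ = sym (proj₂ (moved-positive moved-i))
        gap-u : Gap h′ u
        gap-u = moved⇒gap′ (subst Moved (sym vi≡) moved-i)
        -- Otherwise the lowest gap of the class, in moving to `u`, would land on a place that is
        -- already a gap by the level of the owner.
        vi<vc : v i ≤ v c
        vi<vc = ≤-trans (≤-reflexive (sym vi≡)) (≰⇒> λ q → 1+n≢0 (suc-injective (trans (sym (cong₂ _+_ (𝟙-yes (v c ≤? u) q) (𝟙-yes (moved? (v i)) moved-i)))
          (trans (sym (below vi≡ (v-idx x))) (𝟙-yes (gap? h′ u) gap-u)))))
        to : Gap h x → v c ≤ x ⊎ Moved x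
        to g = decide (v c ≤? x) (moved? x)
          where
          decide : Dec (v c ≤ x) → Dec (Moved x) → v c ≤ x ⊎ Moved x
          decide (yes q) _ = inj₁ q
          decide (no _) (yes m′) = inj₂ m′
          -- The lowest gap of the class lands on `u`, and `h′` is flush, so `x′ = x - 1` is a gap
          -- of `h′`; with neither alternative available, `below` makes it a bead.
          decide (no q) (no ¬m) = ⊥-elim (contra x refl)
           where
            contra : ∀ x′ → x′ ≡ x → ⊥
            contra zero refl = n≮0 (≤-trans (≤-reflexive vi≡) (gap⇒ g))
            contra (suc x′) refl = 1+n≢0 (trans (sym (𝟙-yes (gap? h′ x′) gap-x′)) (trans (below refl refl)
              (cong₂ _+_ (𝟙-no (v c ≤? x′) (λ r → q (m≤n⇒m≤1+n r))) (𝟙-no (moved? (suc x′)) ¬m))))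
              where
              gap-x′ : Gap h′ x′
              gap-x′ with ≋⇒+ {v i} {suc x′} (v-idx x) (gap⇒ g)
              ... | r , eq = subst (Gap h′) (suc-injective (trans (cong (_+ r * n) vi≡) (sym eq))) (flush* r gap-u)
        from : v c ≤ x ⊎ Moved x → Gap h x
        from (inj₁ q) = ⇒gap (≤-trans vi<vc q)
        from (inj₂ m′) = moved⇒gap m′
        split : (d : Dec (v c ≤ x)) (m : Dec (Moved x)) → 𝟙 (d ⊎-dec m) ≡ 𝟙 m + 𝟙 d
        split (yes q) (no _) = refl
        split (no _) (yes _) = refl
        split (no _) (no _) = refl
        split (yes q) (yes m′) = ⊥-elim (contra x refl)
          where
          contra : ∀ x′ → x′ ≡ x → ⊥
          contra zero refl = ¬moved₀ m′
          contra (suc x′) refl = 1+n≢0 (suc-injective (trans (sym (cong₂ _+_ (𝟙-yes (v c ≤? x′) (≤-pred (≤∧≢⇒< q v≢))) (𝟙-yes (moved? (suc x′)) m′)))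
            (trans (sym (below refl refl)) (𝟙-yes (gap? h′ x′) (moved⇒gap′ m′)))))

      balance-all : ∀ x → 𝟙 (gap? h x) ≡ mv x + 𝟙 (v (owner x) ≤? x)
      balance-all x = class-balance (x + base * k) x (sym (trans (cong (_% n) (shuffle base x k)) (≋-+* x base)))
        where
        shuffle : ∀ a b c → a + (b + a * c) ≡ b + a * suc c
        shuffle = ℕ-Solver.solve-∀

      moved⇒< : ∀ {x} → Moved x → x < v (owner x)
      moved⇒< {x} m = ≰⇒> λ q → 1+n≢0 (suc-injective (trans (sym (cong₂ _+_ (𝟙-yes (moved? x) m) (𝟙-yes (v (owner x) ≤? x) q)))
        (trans (sym (balance-all x)) (𝟙-yes (gap? h x) (moved⇒gap m)))))

    valid : RawMove.Valid k idx A
    valid x _ a = v-<⁻ (idx-< x) (<-≤-trans (moved⇒< (∈⇒moved (idx-< x) a)) (≤-reflexive (cong v (owner-cong {v (idx x)} {x} (v-idx x)))))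

    κ≡core : κ ≡ core k (moveBy v)
    κ≡core = rep-unique rep′ (Core.rep window′) λ x → trans (h′≡ x) (trans (cong (h x +_) (𝟙-⇔ (moved? x) (shifted? x) (to x) (from x))) (sym (h′≡h+shifted x)))
      where
      open Move w A proper valid 1≤v₀ using (window′; Shifted; shifted?; h′≡h+shifted)
      to : ∀ x → Moved x → Shifted x
      to x m = moved⇒∈ (idx-< x) (lowest-moved m) , gap⇒ (moved⇒gap m) , moved⇒< m
      from : ∀ x → Shifted x → Moved x
      from x (_ , q , r) = 𝟙-true (moved? x) (trans (sym (trans (balance-all x) (trans (cong (mv x +_) (𝟙-no (v (owner x) ≤? x) (<⇒≱ r))) (+-identityʳ _))))
        (𝟙-yes (gap? h x) (⇒gap q)))

-- Adding k-rectangles raises v i by (k + 1) F i: the classes of the gaps do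
-- not change, only their levels.
shiftBy : ℕ → (ℕ → ℕ) → (ℕ → ℕ) → ℕ → ℕ
shiftBy k F v i = v i + F i * suc k

Monotone : (ℕ → ℕ) → Set
Monotone F = ∀ {i j} → i ≤ j → F i ≤ F j

interval-∸ : ∀ a b c d → c ≤ a → d ≤ b → (a + b) ∸ (c + d) ≡ (a ∸ c) + (b ∸ d)
interval-∸ a b c d c≤a d≤b = begin
  (a + b) ∸ (c + d)                                ≡⟨ cong₂ (λ x y → (x + y) ∸ (c + d)) (m∸n+n≡m c≤a) (m∸n+n≡m d≤b) ⟨
  ((a ∸ c + c) + (b ∸ d + d)) ∸ (c + d)            ≡⟨ cong (_∸ (c + d)) (shuffle (a ∸ c) c (b ∸ d) d) ⟩
  ((a ∸ c) + (b ∸ d) + (c + d)) ∸ (c + d)          ≡⟨ m+n∸n≡m _ (c + d) ⟩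
  (a ∸ c) + (b ∸ d)                                ∎
  where
  open ≡-Reasoning
  shuffle : ∀ a b c d → (a + b) + (c + d) ≡ a + c + (b + d)
  shuffle = ℕ-Solver.solve-∀

-- Truncation is harmless because the order of `i` and `j` decides the sign of both differences at
-- once.
monotone-∸ : ∀ {G H : ℕ → ℕ} → Monotone G → Monotone H → ∀ i j → (G i + H i) ∸ (G j + H j) ≡ (G i ∸ G j) + (H i ∸ H j)
monotone-∸ {G} {H} mG mH i j with ≤-total i j
... | inj₂ j≤i = interval-∸ (G i) (H i) (G j) (H j) (mG j≤i) (mH j≤i)
... | inj₁ i≤j = trans (m≤n⇒m∸n≡0 (+-mono-≤ (mG i≤j) (mH i≤j))) (sym (cong₂ _+_ (m≤n⇒m∸n≡0 (mG i≤j)) (m≤n⇒m∸n≡0 (mH i≤j))))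

window-shiftBy : ∀ {k idx v} → Window k idx v → ∀ {F} → Monotone F → Window k idx (shiftBy k F v)
window-shiftBy {k} {idx} {v} w {F} F-mono = record
  { idx-< = idx-<
  ; idx-period = idx-period
  ; idx-v = λ {i} i<n → trans (idx-period* (v i) (F i)) (idx-v i<n)
  ; increasing = λ i<j j<n → +-mono-<-≤ (increasing i<j j<n) (*-monoˡ-≤ n (F-mono (<⇒≤ i<j)))
  }
  where open WindowPath w

module Shift {k : ℕ} {idx v : ℕ → ℕ} (w : Window k idx v) {F : ℕ → ℕ} (F-mono : Monotone F) where
  open WindowPath w

  vF : ℕ → ℕ
  vF = shiftBy k F v

  v≤vF : ∀ i → v i ≤ vF i
  v≤vF i = m≤m+n (v i) _

  private
    shift-window : Window k idx vF
    shift-window = window-shiftBy w F-mono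

  path-shift : ∀ {t} → t < n → windowPath k vF (vF t) ≡ h (v t) + Σ< n (λ i → F i ∸ F t)
  path-shift {t} t<n = trans (Σ<-cong n term) (Σ<-+ n (λ i → (v i ∸ v t) / n) (λ i → F i ∸ F t))
    where
    term : ∀ i → i < n → (vF i ∸ vF t) / n ≡ (v i ∸ v t) / n + (F i ∸ F t)
    term i i<n with ≤-total i t
    ... | inj₁ i≤t = trans (cong (_/ n) (m≤n⇒m∸n≡0 (+-mono-≤ (v-mono i≤t t<n) (*-monoˡ-≤ n (F-mono i≤t)))))
      (sym (cong₂ _+_ (cong (_/ n) (m≤n⇒m∸n≡0 (v-mono i≤t t<n))) (m≤n⇒m∸n≡0 (F-mono i≤t))))
    ... | inj₂ t≤i = trans (cong (_/ n) (trans (interval-∸ (v i) (F i * n) (v t) (F t * n) (v-mono t≤i i<n) (*-monoˡ-≤ n (F-mono t≤i)))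
        (cong ((v i ∸ v t) +_) (sym (*-distribʳ-∸ n (F i) (F t))))))
      (+*-/ (v i ∸ v t) (F i ∸ F t))

  module _ (n≤v₀ : n ≤ v 0) where

    col-𝔭-shift : ∀ {t} → t < n → col (𝔭 k (core k vF)) t ≡ col (𝔭 k (core k v)) t + Σ< n (λ i → F i ∸ F t)
    col-𝔭-shift {t} t<n = trans (WindowPath.col-𝔭 shift-window (≤-trans n≤v₀ (v≤vF 0)) (Core.rep shift-window) t<n)
      (trans (path-shift t<n) (cong (_+ Σ< n (λ i → F i ∸ F t)) (sym (col-𝔭 n≤v₀ (Core.rep w) t<n))))

    𝔭-shift : ∀ {P} → All (0 <_) P → All (_≤ k) P → (∀ t → t < n → col P t ≡ Σ< n (λ i → F i ∸ F t)) →
      𝔭 k (core k vF) ≡ P ∪ 𝔭 k (core k v)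
    𝔭-shift {P} P>0 P≤k P-col = partition-ext-col (proj₁ inF) (IsPartition-∪ P>0 (proj₁ in₀)) cols
      where
      inF : InPk k (𝔭 k (core k vF))
      inF = WindowPath.InPk-𝔭 shift-window (≤-trans n≤v₀ (v≤vF 0)) (Core.rep shift-window)
      in₀ : InPk k (𝔭 k (core k v))
      in₀ = InPk-𝔭 n≤v₀ (Core.rep w)
      cols : ∀ t → col (𝔭 k (core k vF)) t ≡ col (P ∪ 𝔭 k (core k v)) t
      cols t with t <? n
      ... | yes t<n = trans (col-𝔭-shift t<n) (trans (+-comm _ (Σ< n (λ i → F i ∸ F t)))
        (trans (cong (_+ col (𝔭 k (core k v)) t) (sym (P-col t t<n))) (sym (col-∪ P (𝔭 k (core k v)) t))))
      ... | no t≮n = trans (All≤⇒col _ (proj₂ inF) t k≤t) (sym (All≤⇒col _ (All-∪ P≤k (proj₂ in₀)) t k≤t))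
        where k≤t = <⇒≤ (≮⇒≥ t≮n)

  module _ (A : ℕ → Bool) (proper : RawMove.Proper k idx A) (valid : RawMove.Valid k idx A) (1≤v₀ : 1 ≤ v 0) where
    open RawMove k idx A
    open MoveIdx w A proper using (owner∉)
    private
      module M = Move w A proper valid 1≤v₀
      1≤vF₀ : 1 ≤ vF 0
      1≤vF₀ = ≤-trans 1≤v₀ (v≤vF 0)
      module MF = Move shift-window A proper valid 1≤vF₀

    run-period : ∀ f x q → run f (x + q * n) ≡ run f x
    run-period zero x q = refl
    run-period (suc f) x q = cong₂ (λ i r → if A i then suc r else 0) (idx-period* (suc x) q) (run-period f (suc x) q)

    move-shift : ∀ {i} → i < n → moveBy vF i ≡ shiftBy k F (moveBy v) i
    move-shift {i} i<n with A i
    ... | true = +-∸-comm (F i * n) (≤-trans 1≤v₀ (v-mono z≤n i<n))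
    ... | false = trans (cong (vF i +_) (run-period k (v i) (F i))) (shuffle (v i) (F i * n) (run k (v i)))
      where
      shuffle : ∀ a b c → a + b + c ≡ a + c + b
      shuffle = ℕ-Solver.solve-∀

    -- The two functions are known to agree only below `n`, so the cores are compared through their
    -- paths.
    core-move-shift : core k (moveBy vF) ≡ core k (shiftBy k F (moveBy v))
    core-move-shift = rep-unique (Core.rep MF.window′) (Core.rep (window-shiftBy M.window′ F-mono))
      (λ x → Σ<-cong n (λ i i<n → cong (λ z → (z ∸ x) / n) (move-shift i<n)))

    rr-shift : rr k (core k (moveBy vF)) (core k vF) ≡
      Σ< n (λ i → 𝟙 (suc (shiftBy k F (moveBy v) (newIdx (v i + k))) <? vF i))
    rr-shift = trans (Sound.rr-count shift-window A proper valid 1≤vF₀)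
      (Σ<-cong n (λ i i<n → cong (λ z → 𝟙 (suc z <? vF i))
        (trans (move-shift (M.newIdx-< (vF i + k))) (cong (shiftBy k F (moveBy v)) (M-period i)))))
      where
      shuffle : ∀ a b c → a + b + c ≡ a + c + b
      shuffle = ℕ-Solver.solve-∀
      M-period : ∀ i → newIdx (vF i + k) ≡ newIdx (v i + k)
      M-period i = trans (cong newIdx (shuffle (v i) (F i * n) k)) (WindowPath.idx-period* M.window′ (v i + k) (F i))

-- All that the number of unblocked corners sees of a shift.
SameSteps : (ℕ → ℕ) → (ℕ → ℕ) → Set
SameSteps F G = ∀ {i j} → i ≤ j → (F i ≡ F j × G i ≡ G j) ⊎ (F i < F j × G i < G j)

module _ {k : ℕ} {idx v : ℕ → ℕ} (w : Window k idx v) (A : ℕ → Bool)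
         (proper : RawMove.Proper k idx A) (valid : RawMove.Valid k idx A) (1≤v₀ : 1 ≤ v 0)
         {F G : ℕ → ℕ} (F-mono : Monotone F) (G-mono : Monotone G) (same : SameSteps F G) where
  open WindowPath w
  open RawMove k idx A
  private
    module M = Move w A proper valid 1≤v₀

  -- Let `e` be the class preceding `i` after the move. For `i ≤ e` there is no corner under any
  -- monotone shift. For `e < i` a jump of the shift between them always opens one, since
  -- `v′ e < v i` already; without a jump the shift cancels from the inequality.
  rr-invariant : rr k (core k (moveBy (shiftBy k F v))) (core k (shiftBy k F v)) ≡ rr k (core k (moveBy (shiftBy k G v))) (core k (shiftBy k G v))
  rr-invariant = trans (Shift.rr-shift w F-mono A proper valid 1≤v₀)
    (trans (Σ<-cong n (λ i i<n → compare i i<n (newIdx (v i + k)) (M.newIdx-< (v i + k))))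
           (sym (Shift.rr-shift w G-mono A proper valid 1≤v₀)))
    where
    v≤suc : ∀ i → i < n → v i ≤ suc (moveBy v i)
    v≤suc i i<n with false⊎true (A i)
    ... | inj₂ e = ≤-reflexive (sym (M.v′-in i<n e))
    ... | inj₁ o = m≤n⇒m≤1+n (M.v≤v′ o)
    never : ∀ {H : ℕ → ℕ} → Monotone H → ∀ i e → e < n → i ≤ e → ¬ suc (moveBy v e + H e * n) < v i + H i * n
    never {H} H-mono i e e<n i≤e q = <⇒≱ q (+-mono-≤ (≤-trans (v-mono i≤e e<n) (v≤suc e e<n)) (*-monoˡ-≤ n (H-mono i≤e)))
    compare : ∀ i → i < n → ∀ e → e < n →
      𝟙 (suc (moveBy v e + F e * n) <? v i + F i * n) ≡ 𝟙 (suc (moveBy v e + G e * n) <? v i + G i * n)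
    compare i i<n e e<n with <-≤-connex e i
    ... | inj₂ i≤e = trans (𝟙-no (suc (moveBy v e + F e * n) <? v i + F i * n) (never F-mono i e e<n i≤e))
                           (sym (𝟙-no (suc (moveBy v e + G e * n) <? v i + G i * n) (never G-mono i e e<n i≤e)))
    ... | inj₁ e<i with same (<⇒≤ e<i)
    ...   | inj₂ (F< , G<) = trans (𝟙-yes (suc (moveBy v e + F e * n) <? v i + F i * n) (always F F<))
                                   (sym (𝟙-yes (suc (moveBy v e + G e * n) <? v i + G i * n) (always G G<)))
      where
      always : (H : ℕ → ℕ) → H e < H i → suc (moveBy v e + H e * n) < v i + H i * n
      always H q = +-mono-≤-< (M.v′<v e<i i<n) (*-monoˡ-< n q)
    ...   | inj₁ (F≡ , G≡) = trans (level F F≡) (sym (level G G≡))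
      where
      level : (H : ℕ → ℕ) → H e ≡ H i → 𝟙 (suc (moveBy v e + H e * n) <? v i + H i * n) ≡ 𝟙 (suc (moveBy v e) <? v i)
      level H eq = 𝟙-⇔ (suc (moveBy v e + H e * n) <? v i + H i * n) (suc (moveBy v e) <? v i)
        (λ q → +-cancelʳ-< (H i * n) (suc (moveBy v e)) (v i) (subst (λ z → suc (moveBy v e + z * n) < v i + H i * n) eq q))
        (λ q → subst (λ z → suc (moveBy v e + z * n) < v i + H i * n) (sym eq) (+-monoˡ-< (H i * n) q))

-- Rectangles

-- `a` copies of `R k t` raise the classes of index at least `t` by `a` levels each: every column
-- left of `t` then gains `a` beads from each of the `suc k ∸ t` raised classes.
height : ∀ {m} → (Fin m → ℕ) → (Fin m → ℕ) → ℕ → ℕ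
height {zero} t a i = 0
height {suc m} t a i = a Fin.zero * 𝟙 (t Fin.zero ≤? i) + height (t ∘ Fin.suc) (a ∘ Fin.suc) i

rectangles : ∀ {m} → ℕ → (Fin m → ℕ) → (Fin m → ℕ) → Partition
rectangles k t a = ⋃ (tabulate (λ i → Rpow k (t i) (a i)))

step-mono : ∀ a s → Monotone (λ i → a * 𝟙 (s ≤? i))
step-mono a s {i} {j} i≤j = *-monoʳ-≤ a (𝟙-mono (s ≤? i) (s ≤? j) (λ s≤i → ≤-trans s≤i i≤j))

height-mono : ∀ {m} (t a : Fin m → ℕ) → Monotone (height t a)
height-mono {zero} t a i≤j = z≤n
height-mono {suc m} t a i≤j = +-mono-≤ (step-mono (a Fin.zero) (t Fin.zero) i≤j) (height-mono (t ∘ Fin.suc) (a ∘ Fin.suc) i≤j)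

rectangles-All : ∀ {m k} {P : ℕ → Set} (t a : Fin m → ℕ) → (∀ i → P (t i)) → All P (rectangles k t a)
rectangles-All {zero} t a h = []
rectangles-All {suc m} {k} t a h = All-∪ (replicate⁺ (a Fin.zero * (suc k ∸ t Fin.zero)) (h Fin.zero)) (rectangles-All {k = k} (t ∘ Fin.suc) (a ∘ Fin.suc) (h ∘ Fin.suc))

rectangles-IsPartition : ∀ {m k} (t a : Fin m → ℕ) → (∀ i → 1 ≤ t i) → IsPartition (rectangles k t a)
rectangles-IsPartition {zero} t a h = [] , []
rectangles-IsPartition {suc m} {k} t a h = IsPartition-∪ (replicate⁺ (a Fin.zero * (suc k ∸ t Fin.zero)) (h Fin.zero)) (rectangles-IsPartition {k = k} (t ∘ Fin.suc) (a ∘ Fin.suc) (h ∘ Fin.suc))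

col-Rpow : ∀ k s a j → Σ< (suc k) (λ i → a * 𝟙 (s ≤? i) ∸ a * 𝟙 (s ≤? j)) ≡ col (Rpow k s a) j
col-Rpow k s a j = trans (go (j <? s)) (sym (col-replicate (a * (suc k ∸ s)) s j))
  where
  go : (d : Dec (j < s)) → Σ< (suc k) (λ i → a * 𝟙 (s ≤? i) ∸ a * 𝟙 (s ≤? j)) ≡ a * (suc k ∸ s) * 𝟙 (j <? s)
  go (yes j<s) = begin
    Σ< (suc k) (λ i → a * 𝟙 (s ≤? i) ∸ a * 𝟙 (s ≤? j))
      ≡⟨ Σ<-cong (suc k) (λ i _ → cong (a * 𝟙 (s ≤? i) ∸_) (trans (cong (a *_) (𝟙-no (s ≤? j) (<⇒≱ j<s))) (*-zeroʳ a))) ⟩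
    Σ< (suc k) (λ i → a * 𝟙 (s ≤? i))     ≡⟨ Σ<-* (suc k) a (λ i → 𝟙 (s ≤? i)) ⟩
    a * Σ< (suc k) (λ i → 𝟙 (s ≤? i))     ≡⟨ cong (a *_) (count-from (suc k) s) ⟩
    a * (suc k ∸ s)                         ≡⟨ *-identityʳ _ ⟨
    a * (suc k ∸ s) * 1                     ≡⟨ cong (a * (suc k ∸ s) *_) (𝟙-yes (j <? s) j<s) ⟨
    a * (suc k ∸ s) * 𝟙 (j <? s)            ∎
    where open ≡-Reasoning
  go (no j≮s) = trans (Σ<-zero (suc k) (λ i _ → m≤n⇒m∸n≡0 (*-monoʳ-≤ a (≤-trans (𝟙≤1 (s ≤? i)) (≤-reflexive (sym (𝟙-yes (s ≤? j) (≮⇒≥ j≮s))))))))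
    (sym (trans (cong (a * (suc k ∸ s) *_) (𝟙-no (j <? s) j≮s)) (*-zeroʳ (a * (suc k ∸ s)))))

col-rectangles : ∀ {m} k (t a : Fin m → ℕ) j → col (rectangles k t a) j ≡ Σ< (suc k) (λ i → height t a i ∸ height t a j)
col-rectangles {zero} k t a j = sym (Σ<-zero (suc k) (λ _ _ → refl))
col-rectangles {suc m} k t a j = begin
  col (Rpow k (t Fin.zero) (a Fin.zero) ∪ rectangles k (t ∘ Fin.suc) (a ∘ Fin.suc)) j
    ≡⟨ col-∪ (Rpow k (t Fin.zero) (a Fin.zero)) _ j ⟩
  col (Rpow k (t Fin.zero) (a Fin.zero)) j + col (rectangles k (t ∘ Fin.suc) (a ∘ Fin.suc)) j
    ≡⟨ cong₂ _+_ (sym (col-Rpow k (t Fin.zero) (a Fin.zero) j)) (col-rectangles k (t ∘ Fin.suc) (a ∘ Fin.suc) j) ⟩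
  Σ< (suc k) (λ i → G i ∸ G j) + Σ< (suc k) (λ i → H i ∸ H j)
    ≡⟨ Σ<-+ (suc k) (λ i → G i ∸ G j) (λ i → H i ∸ H j) ⟨
  Σ< (suc k) (λ i → (G i ∸ G j) + (H i ∸ H j))
    ≡⟨ Σ<-cong (suc k) (λ i _ → monotone-∸ (step-mono (a Fin.zero) (t Fin.zero)) (height-mono (t ∘ Fin.suc) (a ∘ Fin.suc)) i j) ⟨
  Σ< (suc k) (λ i → height t a i ∸ height t a j) ∎
  where
  open ≡-Reasoning
  G = λ i → a Fin.zero * 𝟙 (t Fin.zero ≤? i)
  H = height (t ∘ Fin.suc) (a ∘ Fin.suc)

height-same : ∀ {m} (t a b : Fin m → ℕ) → (∀ i → 1 ≤ a i) → (∀ i → 1 ≤ b i) → SameSteps (height t a) (height t b)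
height-same {zero} t a b pa pb i≤j = inj₁ (refl , refl)
height-same {suc m} t a b pa pb {i} {j} i≤j
  with height-same (t ∘ Fin.suc) (a ∘ Fin.suc) (b ∘ Fin.suc) (pa ∘ Fin.suc) (pb ∘ Fin.suc) i≤j
... | inj₂ (p , q) = inj₂ (+-mono-≤-< (step-mono (a Fin.zero) (t Fin.zero) i≤j) p , +-mono-≤-< (step-mono (b Fin.zero) (t Fin.zero) i≤j) q)
... | inj₁ (p , q) = go (t Fin.zero ≤? i) (t Fin.zero ≤? j)
  where
  go : (d : Dec (t Fin.zero ≤ i)) (e : Dec (t Fin.zero ≤ j)) →
    (a Fin.zero * 𝟙 d + height (t ∘ Fin.suc) (a ∘ Fin.suc) i ≡ a Fin.zero * 𝟙 e + height (t ∘ Fin.suc) (a ∘ Fin.suc) j ×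
     b Fin.zero * 𝟙 d + height (t ∘ Fin.suc) (b ∘ Fin.suc) i ≡ b Fin.zero * 𝟙 e + height (t ∘ Fin.suc) (b ∘ Fin.suc) j) ⊎
    (a Fin.zero * 𝟙 d + height (t ∘ Fin.suc) (a ∘ Fin.suc) i < a Fin.zero * 𝟙 e + height (t ∘ Fin.suc) (a ∘ Fin.suc) j ×
     b Fin.zero * 𝟙 d + height (t ∘ Fin.suc) (b ∘ Fin.suc) i < b Fin.zero * 𝟙 e + height (t ∘ Fin.suc) (b ∘ Fin.suc) j)
  go (yes _) (yes _) = inj₁ (cong (a Fin.zero * 1 +_) p , cong (b Fin.zero * 1 +_) q)
  go (no _) (no _) = inj₁ (cong (a Fin.zero * 0 +_) p , cong (b Fin.zero * 0 +_) q)
  go (yes d) (no ¬e) = ⊥-elim (¬e (≤-trans d i≤j))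
  go (no _) (yes _) = inj₂ (+-mono-<-≤ (*-monoʳ-< (a Fin.zero) {{>-nonZero (pa Fin.zero)}} (s≤s z≤n)) (≤-reflexive p) ,
                            +-mono-<-≤ (*-monoʳ-< (b Fin.zero) {{>-nonZero (pb Fin.zero)}} (s≤s z≤n)) (≤-reflexive q))

-- Windows of bounded partitions

initial : ℕ → ℕ → Bool
initial r i = does (i <? r)

∈initial : ∀ r i → (i ∈ᵇ initial r → i < r) × (i < r → i ∈ᵇ initial r)
∈initial r i = go (i <? r)
  where
  go : (d : Dec (i < r)) → (does d ≡ true → i < r) × (i < r → does d ≡ true)
  go (yes p) = (λ _ → p) , (λ _ → refl)
  go (no ¬p) = (λ ()) , (λ p → ⊥-elim (¬p p))

card-initial : ∀ {n r} → r ≤ n → card n (initial r) ≡ r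
card-initial {n} {r} r≤n = trans (Σ<-extend (λ i → 𝟙 (i ∈ᵇ? initial r)) r≤n (λ i r≤i → 𝟙-no (i ∈ᵇ? initial r) (λ e → <⇒≱ (proj₁ (∈initial r i) e) r≤i)))
  (count-all r (_∈ᵇ? initial r) (λ i i<r → proj₂ (∈initial r i) i<r))

-- Every element of an initial set of classes is below its owner, because
-- owners lie outside the set.
initial-valid : ∀ {k idx v} (w : Window k idx v) r (proper : RawMove.Proper k idx (initial r)) → RawMove.Valid k idx (initial r)
initial-valid w r proper x _ e = <-≤-trans (proj₁ (∈initial r _) e)
  (≮⇒≥ λ q → false≢true (MoveIdx.owner∉ w (initial r) proper x) (proj₂ (∈initial r _) q))

-- The lowest gaps occupy consecutive positions, so no bead lies above a gap: this is the empty
-- core.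
trivial-window : ∀ k N → Window k (_% suc k) (λ i → i + N * suc k)
trivial-window k N = record
  { idx-< = λ x → m%n<n x (suc k)
  ; idx-period = λ x → [m+n]%n≡m%n x (suc k)
  ; idx-v = λ {i} i<n → trans ([m+kn]%n≡m%n i N (suc k)) (m<n⇒m%n≡m i<n)
  ; increasing = λ i<j _ → +-monoˡ-< (N * suc k) i<j
  }

record WindowOf (k N : ℕ) (μ : Partition) : Set where
  field
    idx v : ℕ → ℕ
    window : Window k idx v
    N≤v₀ : N ≤ v 0
    cols : ∀ {t} → t < suc k → windowPath k v (v t) ≡ col μ t

-- A realisation of `𝔠 μ`: putting a row `r` in front adds one cell to each of the columns below
-- `r`, which is the move of the first `r` classes. That move takes `v 0` one step to the left, so
-- the recursive call asks for `suc N`.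
windowOf : ∀ k μ → InPk k μ → ∀ N → WindowOf k N μ
windowOf k [] _ N = record
  { idx = _% suc k ; v = λ i → i + N * suc k ; window = trivial-window k N
  ; N≤v₀ = m≤m*n N (suc k)
  ; cols = λ {t} t<n → Σ<-zero (suc k) (λ i i<n → m<n⇒m/n≡0 (≤-<-trans (≤-trans (≤-reflexive
      ([m+o]∸[n+o] i t (N * suc k))) (m∸n≤m i t)) i<n))
  }
  where
  [m+o]∸[n+o] : ∀ m n o → (m + o) ∸ (n + o) ≡ m ∸ n
  [m+o]∸[n+o] m n o = trans (cong₂ _∸_ (+-comm m o) (+-comm n o)) ([m+n]∸[m+o]≡n∸o o m n)
windowOf k (r ∷ ν) (p , r≤k ∷ ν≤k) N = record
  { idx = newIdx ; v = moveBy v ; window = M.window′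
  ; N≤v₀ = ≤-pred (≤-trans N≤v₀ (≤-reflexive (sym (M.v′-in (s≤s z≤n) (proj₂ (∈initial r 0) (All.head (proj₁ p)))))))
  ; cols = λ {t} t<n → trans (M.h′-v′ t<n) (trans (+-comm _ (𝟙 (t ∈ᵇ? initial r)))
      (trans (cong₂ _+_ (𝟙-⇔ (t ∈ᵇ? initial r) (t <? r) (proj₁ (∈initial r t)) (proj₂ (∈initial r t))) (cols t<n)) (sym (col-∷ r ν t))))
  }
  where
  open WindowOf (windowOf k ν (IsPartition-tail p , ν≤k) (suc N))
  proper : RawMove.Proper k idx (initial r)
  proper = card≤⇒proper window (initial r) (≤-trans (≤-reflexive (card-initial (m≤n⇒m≤1+n r≤k))) r≤k)
  open RawMove k idx (initial r)
  module M = Move window (initial r) proper (initial-valid window r proper) (≤-trans (s≤s z≤n) N≤v₀)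

-- Subsets of {0, …, n - 1}

-- Inequality of functions says nothing about their values below `n`. The witness used here is also
-- the column in which the resulting partitions differ.
Differ : ℕ → (ℕ → Bool) → (ℕ → Bool) → Set
Differ n A B = ∃ λ i → i < n × A i ≢ B i

update : ℕ → Bool → (ℕ → Bool) → ℕ → Bool
update n b A i = if does (i ≟ n) then b else A i

update-here : ∀ n b A → update n b A n ≡ b
update-here n b A = go (n ≟ n)
  where
  go : (d : Dec (n ≡ n)) → (if does d then b else A n) ≡ b
  go (yes _) = refl
  go (no ne) = ⊥-elim (ne refl)

update-there : ∀ {n i} b A → i < n → update n b A i ≡ A i
update-there {n} {i} b A i<n = go (i ≟ n)
  where
  go : (d : Dec (i ≡ n)) → (if does d then b else A i) ≡ A i
  go (yes e) = ⊥-elim (<-irrefl e i<n)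
  go (no _) = refl

subsets : ℕ → List (ℕ → Bool)
subsets zero = (λ _ → false) ∷ []
subsets (suc n) = map (update n true) (subsets n) ++ map (update n false) (subsets n)

subsets-complete : ∀ n (B : ℕ → Bool) → ∃ λ A → A ∈ subsets n × (∀ i → i < n → A i ≡ B i)
subsets-complete zero B = _ , here refl , λ _ ()
subsets-complete (suc n) B with subsets-complete n B
... | A , A∈ , agree = update n (B n) A , mem (B n) , eq
  where
  mem : ∀ b → update n b A ∈ subsets (suc n)
  mem true = ∈-++⁺ˡ (∈-map⁺ (update n true) A∈)
  mem false = ∈-++⁺ʳ (map (update n true) (subsets n)) (∈-map⁺ (update n false) A∈)
  eq : ∀ i → i < suc n → update n (B n) A i ≡ B i
  eq i i<sn with <-≤-connex i n
  ... | inj₁ i<n = trans (update-there (B n) A i<n) (agree i i<n)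
  ... | inj₂ n≤i with ≤-antisym (≤-pred i<sn) n≤i
  ...   | refl = update-here n (B n) A

subsets-distinct : ∀ n → AllPairs (Differ n) (subsets n)
subsets-distinct zero = [] ∷ []
subsets-distinct (suc n) = AllPairsₚ.++⁺ (half true) (half false)
  (All.tabulate λ A∈ → All.tabulate λ B∈ → cross A∈ B∈)
  where
  lift : ∀ b {A B} → Differ n A B → Differ (suc n) (update n b A) (update n b B)
  lift b {A} {B} (i , i<n , ne) = i , m<n⇒m<1+n i<n ,
    λ e → ne (trans (sym (update-there b A i<n)) (trans e (update-there b B i<n)))
  half : ∀ b → AllPairs (Differ (suc n)) (map (update n b) (subsets n))
  half b = AllPairsₚ.map⁺ (AllPairs.map (lift b) (subsets-distinct n))
  cross : ∀ {A B} → A ∈ map (update n true) (subsets n) → B ∈ map (update n false) (subsets n) → Differ (suc n) A B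
  cross A∈ B∈ with ∈-map⁻ (update n true) A∈ | ∈-map⁻ (update n false) B∈
  ... | A , _ , refl | B , _ , refl = n , n<1+n n , λ e → absurd (trans (sym (update-here n true A)) (trans e (update-here n false B)))
    where
    absurd : true ≡ false → ⊥
    absurd ()

-- The Pieri rule indexed by moves

unique-map : {X Y : Set} {P : X → Set} {R : X → X → Set} (f : X → Y) → (∀ {a b} → P a → P b → R a b → f a ≢ f b) →
  ∀ xs → All P xs → AllPairs R xs → Unique (map f xs)
unique-map f sep [] _ _ = []
unique-map {P = P} {R} f sep (x ∷ xs) (px ∷ pxs) (rx ∷ rxs) = distinct xs pxs rx ∷ unique-map f sep xs pxs rxs
  where
  distinct : ∀ ys → All P ys → All (R x) ys → All (f x ≢_) (map f ys)
  distinct [] _ _ = []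
  distinct (y ∷ ys) (py ∷ pys) (ry ∷ rys) = sep px py ry ∷ distinct ys pys rys

-- Cancels from two equal sums all terms but one. The alternative `R a b ⊎ R b a` accounts for the
-- terms on either side of `a` in the list.
sum-single-out : {X : Set} {R : X → X → Set} (f g : X → ℤ) → ∀ xs → AllPairs R xs → ∀ {a} → a ∈ xs →
  (∀ {b} → b ∈ xs → R a b ⊎ R b a → f b ≡ g b) → sumℤ (map f xs) ≡ sumℤ (map g xs) → f a ≡ g a
sum-single-out {R = R} f g (x ∷ xs) (rx ∷ rxs) {a} (here refl) others eq =
  ∙-cancelʳ (sumℤ (map f xs)) (f a) (g a)
    (trans eq (cong (λ s → g a ℤ.+ s) (sym (rest xs (λ b∈ → others (there b∈) (inj₁ (All.lookup rx b∈)))))))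
  where
  rest : ∀ ys → (∀ {b} → b ∈ ys → f b ≡ g b) → sumℤ (map f ys) ≡ sumℤ (map g ys)
  rest [] h = refl
  rest (y ∷ ys) h = cong₂ ℤ._+_ (h (here refl)) (rest ys (h ∘ there))
sum-single-out f g (x ∷ xs) (rx ∷ rxs) {a} (there a∈) others eq =
  sum-single-out f g xs rxs a∈ (others ∘ there)
    (∙-cancelˡ (f x) _ _ (trans eq (cong (λ s → s ℤ.+ sumℤ (map g xs)) (sym (others (here refl) (inj₂ (All.lookup rx a∈)))))))

record GoodMove (k : ℕ) (idx : ℕ → ℕ) (r : ℕ) (A : ℕ → Bool) : Set where
  constructor _,_
  field
    valid : RawMove.Valid k idx A
    card≤ : card (suc k) A ≤ r
open GoodMove

goodMove? : ∀ k idx r A → Dec (GoodMove k idx r A)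
goodMove? k idx r A = map′ (λ (h , c) → (λ x x<n → h {x} x<n) , c) (λ good → (λ {x} x<n → valid good x x<n) , card≤ good)
  (allUpTo? (λ x → (idx x ∈ᵇ? A) →-dec (idx x <? RawMove.owner k idx A x)) (suc k) ×-dec (card (suc k) A ≤? r))

moves : ℕ → (ℕ → ℕ) → ℕ → List (ℕ → Bool)
moves k idx r = filter (goodMove? k idx r) (subsets (suc k))

module Pieri {k : ℕ} {idx v : ℕ → ℕ} (w : Window k idx v) (n<v₀ : suc k < v 0) {r : ℕ} (r≤k : r ≤ k) where
  open WindowPath w hiding (h)
  open Core w
  private
    n≤v₀ = <⇒≤ n<v₀
    1≤v₀ = ≤-trans (s≤s z≤n) n<v₀

  Good : (ℕ → Bool) → Set
  Good = GoodMove k idx r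

  target : (ℕ → Bool) → Partition
  target A = core k (RawMove.moveBy k idx A v)

  good-moves : All Good (moves k idx r)
  good-moves = all-filter (goodMove? k idx r) (subsets n)

  module _ {A : ℕ → Bool} (good : Good A) where
    proper : RawMove.Proper k idx A
    proper = card≤⇒proper w A (≤-trans (card≤ good) r≤k)

    module M = Move w A proper (valid good) 1≤v₀

    -- A move lowers `v 0` by at most one. The strict bound `n<v₀` is there so that `𝔭` can still be
    -- read off afterwards.
    n≤v′₀ : n ≤ RawMove.moveBy k idx A v 0
    n≤v′₀ with false⊎true (A 0)
    ... | inj₁ o = ≤-trans n≤v₀ (M.v≤v′ o)
    ... | inj₂ e = ≤-pred (≤-trans n<v₀ (≤-reflexive (sym (M.v′-in (s≤s z≤n) e))))

    InPk-target : InPk k (𝔭 k (target A))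
    InPk-target = WindowPath.InPk-𝔭 M.window′ n≤v′₀ (Core.rep M.window′)

    col-target : ∀ {t} → t < n → col (𝔭 k (target A)) t ≡ col (𝔭 k (core k v)) t + 𝟙 (t ∈ᵇ? A)
    col-target {t} t<n = trans (WindowPath.col-𝔭 M.window′ n≤v′₀ (Core.rep M.window′) t<n)
      (trans (M.h′-v′ t<n) (cong (_+ 𝟙 (t ∈ᵇ? A)) (sym (col-𝔭 n≤v₀ rep t<n))))

  -- `A` can be recovered from its target as the set of columns in which `𝔭` has grown.
  target-separates : ∀ {A B} → Good A → Good B → Differ n A B → target A ≢ target B
  target-separates {A} {B} gA gB (t , t<n , ne) eq = ne (same (A t) (B t)
    (+-cancelˡ-≡ (col (𝔭 k (core k v)) t) _ _ (trans (sym (col-target gA t<n)) (trans (cong (λ κ → col (𝔭 k κ) t) eq) (col-target gB t<n)))))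
    where
    same : ∀ a b → 𝟙 (a Bool.≟ true) ≡ 𝟙 (b Bool.≟ true) → a ≡ b
    same true true _ = refl
    same false false _ = refl

  strips : List Partition
  strips = map target (moves k idx r)

  strips-unique : Unique strips
  strips-unique = unique-map target target-separates (moves k idx r) good-moves
    (AllPairsₚ.filter⁺ (goodMove? k idx r) (subsets-distinct n))

  strips-spec : ∀ κ → κ ∈ strips ⇔ (IsPartition κ × IsCore k κ × Σ ℕ λ s → s ≤ r × WeakStrip k (core k v) κ s)
  strips-spec κ = mk⇔ to from
    where
    to : κ ∈ strips → IsPartition κ × IsCore k κ × Σ ℕ λ s → s ≤ r × WeakStrip k (core k v) κ s
    to κ∈ with ∈-map⁻ target κ∈
    ... | A , A∈ , refl = Rep.isPartition (Core.rep (M.window′ good)) , Core.isCore (M.window′ good) ,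
                          card n A , card≤ good , Sound.weakStrip w A (proper good) (valid good) 1≤v₀
      where
      good : Good A
      good = All.lookup good-moves A∈
    from : (IsPartition κ × IsCore k κ × Σ ℕ λ s → s ≤ r × WeakStrip k (core k v) κ s) → κ ∈ strips
    from (p , c , s , s≤r , ws) with subsets-complete n (Complete.movedSet w 1≤v₀ p c (≤-trans s≤r r≤k) ws)
    ... | A , A∈ , agree = subst (_∈ strips) (sym (C.κ≡core A agree)) (∈-map⁺ target
        (∈-filter⁺ (goodMove? k idx r) A∈
          (C.valid A agree , ≤-trans (≤-reflexive (C.card-complete A agree)) s≤r)))
      where module C = Complete w 1≤v₀ p c (≤-trans s≤r r≤k) ws

  size-target : ∀ {A} → Good A → size≤ k (target A) ≡ size≤ k (core k v) + card n A
  size-target {A} good = proj₁ (proj₂ (proj₂ (Sound.weakStrip w A (proper good) (valid good) 1≤v₀)))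

coefficient : ℕ → ℕ → ℕ → ℤ
coefficient ρ r s = sign (r ∸ s) ℤ.* (ℤ.+_ (ρ C (r ∸ s)))

pieri-term : ∀ k r (g : Partition → Poly k) τ κ {s μ} → size≤ k κ ≡ size≤ k τ + s → 𝔭 k κ ≡ μ →
  PieriTerm k r g τ κ ≈P coefficient (rr k κ τ) r s •P g μ
pieri-term k r g τ κ {s} e refl x =
  cong (λ d → coefficient (rr k κ τ) r d ℤ.* g (𝔭 k κ) x) (trans (cong (_∸ size≤ k τ) e) (m+n∸m≡n (size≤ k τ) s))

sumP-cong : ∀ {k} {X : Set} {f g : X → Poly k} xs → (∀ {a} → a ∈ xs → f a ≈P g a) → sumP (map f xs) ≈P sumP (map g xs)
sumP-cong [] h e = refl
sumP-cong (x ∷ xs) h e = cong₂ ℤ._+_ (h (here refl) e) (sumP-cong xs (h ∘ there) e)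

sumP-sumℤ : ∀ {k} {X : Set} (f : X → Poly k) xs e → sumP (map f xs) e ≡ sumℤ (map (λ a → f a e) xs)
sumP-sumℤ f [] e = refl
sumP-sumℤ f (x ∷ xs) e = cong (λ z → f x e ℤ.+ z) (sumP-sumℤ f xs e)

record Rectangular (k : ℕ) (P : Partition) (F : ℕ → ℕ) : Set where
  field
    isPartition : IsPartition P
    bounded : All (_≤ k) P
    cols : ∀ t → t < suc k → col P t ≡ Σ< (suc k) (λ i → F i ∸ F t)
    monotone : Monotone F

rectangles-rectangular : ∀ {m} k (t a : Fin m → ℕ) → (∀ i → 1 ≤ t i × t i ≤ k) → Rectangular k (rectangles k t a) (height t a)
rectangles-rectangular k t a h = record
  { isPartition = rectangles-IsPartition {k = k} t a (proj₁ ∘ h)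
  ; bounded = rectangles-All {k = k} t a (proj₂ ∘ h)
  ; cols = λ j _ → col-rectangles k t a j
  ; monotone = height-mono t a
  }

-- The common recursion and its unique solution

module _ {k : ℕ} {g : Partition → Poly k} (schur : IsKkSchur k g) where
  private n = suc k

  module _ {P F} (rect : Rectangular k P F) {idx v} (w : Window k idx v) (n<v₀ : n < v 0) {r} (r≤k : r ≤ k) where
    private
      module R = Rectangular rect
      vF = shiftBy k F v
      wF = window-shiftBy w R.monotone
      n<vF₀ : n < vF 0
      n<vF₀ = ≤-trans n<v₀ (m≤m+n (v 0) _)
      n≤v₀ = <⇒≤ n<v₀
      1≤v₀ = ≤-trans (s≤s z≤n) n<v₀
      module S = Shift w R.monotone
      module Pr = Pieri w n<v₀ r≤k
      module PrF = Pieri wF n<vF₀ r≤k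

    ρ : (ℕ → Bool) → ℕ
    ρ A = rr k (PrF.target A) (core k vF)

    -- The rule is applied to the shifted window, but its sum is indexed by the moves of the
    -- unshifted one. The list `moves k idx r` is the same for every `P`; only `ρ` still depends on
    -- the rectangles.
    pieri : hP k r *P g (P ∪ 𝔭 k (core k v)) ≈P
      sumP (map (λ A → coefficient (ρ A) r (card n A) •P g (P ∪ 𝔭 k (Pr.target A))) (moves k idx r))
    pieri e = trans (cong (λ μ → (hP k r *P g μ) e) (sym 𝔭-core))
      (trans (proj₂ (proj₂ schur) (𝔭 k (core k vF)) (WindowPath.InPk-𝔭 wF (<⇒≤ n<vF₀) (Core.rep wF)) r r≤k (core k vF)
                (Rep.isPartition (Core.rep wF) , Core.isCore wF , refl) PrF.strips PrF.strips-unique PrF.strips-spec e)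
      (trans (cong (λ fs → sumP fs e) (sym (map-∘ (moves k idx r))))
             (sumP-cong (moves k idx r) (λ A∈ → term (All.lookup Pr.good-moves A∈)) e)))
      where
      𝔭-core : 𝔭 k (core k vF) ≡ P ∪ 𝔭 k (core k v)
      𝔭-core = S.𝔭-shift n≤v₀ (proj₁ R.isPartition) R.bounded R.cols
      term : ∀ {A} → Pr.Good A → PieriTerm k r g (core k vF) (PrF.target A) ≈P
        coefficient (ρ A) r (card n A) •P g (P ∪ 𝔭 k (Pr.target A))
      term {A} good = pieri-term k r g (core k vF) (PrF.target A) (PrF.size-target good)
        (trans (cong (𝔭 k) (S.core-move-shift A (Pr.proper good) (valid good) 1≤v₀))
               (Shift.𝔭-shift (Pr.M.window′ good) R.monotone (Pr.n≤v′₀ good) (proj₁ R.isPartition) R.bounded R.cols))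

  -- λ is obtained from ν = (λ₂, λ₃, …) by the move of the first λ₁ classes, with
  -- coefficient 1 in h_{λ₁} g_{P ∪ ν}; every other term has a smaller size or
  -- the same size and a longer first row, hence a smaller measure.
  measure : Partition → ℕ
  measure μ = Σ< n (col μ) * n + (k ∸ row μ 0)

  measure-< : ∀ μ ν → Σ< n (col μ) < Σ< n (col ν) → measure μ < measure ν
  measure-< μ ν q = <-≤-trans (+-monoʳ-< (Σ< n (col μ) * n) (s≤s (m∸n≤m k (row μ 0))))
    (≤-trans (≤-reflexive (+-comm _ n)) (≤-trans (*-monoˡ-≤ n q) (m≤m+n _ _)))

  measure-row-< : ∀ μ ν → Σ< n (col μ) ≡ Σ< n (col ν) → row ν 0 < row μ 0 → row μ 0 ≤ k → measure μ < measure ν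
  measure-row-< μ ν e q b = subst (λ z → measure μ < z * n + (k ∸ row ν 0)) e
    (+-monoʳ-< (Σ< n (col μ) * n) (∸-monoʳ-< q b))

  module _ {P F Q G} (rectP : Rectangular k P F) (rectQ : Rectangular k Q G) (same : SameSteps F G) where

    Proportional : Partition → Set
    Proportional μ = g (P ∪ μ) *P g Q ≈P g (Q ∪ μ) *P g P

    private
      module step {r ν} (in-λ : InPk k (r ∷ ν)) (ih : ∀ μ → InPk k μ → measure μ < measure (r ∷ ν) → Proportional μ) where
        r≤k : r ≤ k
        r≤k = All.head (proj₂ in-λ)
        0<r : 0 < r
        0<r = All.head (proj₁ (proj₁ in-λ))
        in-ν : InPk k ν
        in-ν = IsPartition-tail (proj₁ in-λ) , All.tail (proj₂ in-λ)
        open WindowOf (windowOf k ν in-ν (suc n))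
        n≤v₀ = <⇒≤ N≤v₀
        1≤v₀ = ≤-trans (s≤s z≤n) N≤v₀
        module W = WindowPath window
        module Pr = Pieri window N≤v₀ r≤k

        𝔭≡ : 𝔭 k (core k v) ≡ ν
        𝔭≡ = partition-ext-col (proj₁ in-𝔭) (proj₁ in-ν) eq
          where
          in-𝔭 = W.InPk-𝔭 n≤v₀ (Core.rep window)
          eq : ∀ t → col (𝔭 k (core k v)) t ≡ col ν t
          eq t with t <? n
          ... | yes t<n = trans (W.col-𝔭 n≤v₀ (Core.rep window) t<n) (cols t<n)
          ... | no t≮n = trans (All≤⇒col _ (proj₂ in-𝔭) t (<⇒≤ (≮⇒≥ t≮n))) (sym (All≤⇒col ν (proj₂ in-ν) t (<⇒≤ (≮⇒≥ t≮n))))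

        μ : (ℕ → Bool) → Partition
        μ A = 𝔭 k (Pr.target A)

        col-μ : ∀ {A} → Pr.Good A → ∀ {t} → t < n → col (μ A) t ≡ col ν t + 𝟙 (t ∈ᵇ? A)
        col-μ {A} good {t} t<n = trans (Pr.col-target good t<n) (cong (λ κ → col κ t + 𝟙 (t ∈ᵇ? A)) 𝔭≡)

        Σ-μ : ∀ {A} → Pr.Good A → Σ< n (col (μ A)) ≡ Σ< n (col ν) + card n A
        Σ-μ {A} good = trans (Σ<-cong n (λ t t<n → col-μ good t<n)) (Σ<-+ n (col ν) (λ t → 𝟙 (t ∈ᵇ? A)))

        Σ-λ : Σ< n (col (r ∷ ν)) ≡ Σ< n (col ν) + r
        Σ-λ = trans (Σ<-cong n (λ t _ → trans (col-∷ r ν t) (+-comm (𝟙 (t <? r)) (col ν t))))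
          (trans (Σ<-+ n (col ν) (λ t → 𝟙 (t <? r))) (cong (λ z → Σ< n (col ν) + z)
            (trans (Σ<-extend (λ t → 𝟙 (t <? r)) (m≤n⇒m≤1+n r≤k) (λ t r≤t → 𝟙-no (t <? r) (≤⇒≯ r≤t)))
                   (count-all r (_<? r) (λ _ p → p)))))

        -- The listed representative of the first `r` classes, whose term is the one to be isolated.
        A₀ : ℕ → Bool
        A₀ = proj₁ (subsets-complete n (initial r))
        A₀-agree : ∀ i → i < n → A₀ i ≡ initial r i
        A₀-agree = proj₂ (proj₂ (subsets-complete n (initial r)))
        card-A₀ : card n A₀ ≡ r
        card-A₀ = trans (card-cong n A₀-agree) (card-initial (m≤n⇒m≤1+n r≤k))
        good₀ : Pr.Good A₀
        good₀ = (λ x _ e → <-≤-trans (proj₁ (∈initial r _) (trans (sym (A₀-agree _ (W.idx-< x))) e))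
                    (≮⇒≥ λ q → false≢true (MoveIdx.owner∉ window A₀ prop x)
                      (trans (A₀-agree _ (MoveIdx.owner-< window A₀ prop x)) (proj₂ (∈initial r _) q)))) ,
                ≤-reflexive card-A₀
          where
          prop : RawMove.Proper k idx A₀
          prop = card≤⇒proper window A₀ (≤-trans (≤-reflexive card-A₀) r≤k)
        A₀∈ : A₀ ∈ moves k idx r
        A₀∈ = ∈-filter⁺ (goodMove? k idx r) (proj₁ (proj₂ (subsets-complete n (initial r)))) good₀

        μ-A₀ : μ A₀ ≡ r ∷ ν
        μ-A₀ = partition-ext-col (proj₁ (Pr.InPk-target good₀)) (proj₁ in-λ) eq
          where
          eq : ∀ t → col (μ A₀) t ≡ col (r ∷ ν) t
          eq t with t <? n
          ... | yes t<n = trans (col-μ good₀ t<n) (trans (+-comm (col ν t) _) (trans (cong (_+ col ν t)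
                (𝟙-⇔ (t ∈ᵇ? A₀) (t <? r) (λ e → proj₁ (∈initial r t) (trans (sym (A₀-agree t t<n)) e))
                                          (λ q → trans (A₀-agree t t<n) (proj₂ (∈initial r t) q)))) (sym (col-∷ r ν t))))
          ... | no t≮n = trans (All≤⇒col _ (proj₂ (Pr.InPk-target good₀)) t (<⇒≤ (≮⇒≥ t≮n)))
                               (sym (All≤⇒col (r ∷ ν) (proj₂ in-λ) t (<⇒≤ (≮⇒≥ t≮n))))

        ν-smaller : measure ν < measure (r ∷ ν)
        ν-smaller = measure-< ν (r ∷ ν) (<-≤-trans (m<m+n (Σ< n (col ν)) 0<r) (≤-reflexive (sym Σ-λ)))

        -- With fewer than `r` elements the size is smaller. A set of `r` elements other than the
        -- first `r` contains some `t ≥ r`; column `t` is then nonempty, so the first row is longer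
        -- than `r`.
        other-smaller : ∀ {A} → Pr.Good A → Differ n A₀ A → measure (μ A) < measure (r ∷ ν)
        other-smaller {A} good (i , i<n , ne) with m≤n⇒m<n∨m≡n (card≤ good)
        ... | inj₁ q = measure-< (μ A) (r ∷ ν) (subst₂ _<_ (sym (Σ-μ good)) (sym Σ-λ) (+-monoʳ-< (Σ< n (col ν)) q))
        ... | inj₂ card≡r = measure-row-< (μ A) (r ∷ ν) (trans (Σ-μ good) (trans (cong (λ z → Σ< n (col ν) + z) card≡r) (sym Σ-λ))) longer
                              (row₀≤ (proj₂ (Pr.InPk-target good)))
          where
          row₀≤ : ∀ {xs} → All (_≤ k) xs → row xs 0 ≤ k
          row₀≤ [] = z≤n
          row₀≤ (p ∷ _) = p
          longer : r < row (μ A) 0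
          longer with anyUpTo? (λ t → (r ≤? t) ×-dec (t ∈ᵇ? A)) n
          ... | yes (t , t<n , r≤t , e) = ≤-<-trans r≤t (proj₁ (<col⇔<row (proj₁ (Pr.InPk-target good))) (≤-trans (s≤s z≤n)
                  (≤-trans (≤-reflexive (sym (𝟙-yes (t ∈ᵇ? A) e))) (≤-trans (m≤n+m _ (col ν t)) (≤-reflexive (sym (col-μ good t<n)))))))
          ... | no none = ⊥-elim (ne (trans (A₀-agree i i<n) (sym A≡)))
            where
            outside : ∀ t → t < n → r ≤ t → ¬ (t ∈ᵇ A)
            outside t t<n r≤t e = none (t , t<n , r≤t , e)
            full : ∀ t → t < r → t ∈ᵇ A
            full = count-full r (_∈ᵇ? A) (trans (sym short) card≡r)
              where
              short : card n A ≡ Σ< r (λ t → 𝟙 (t ∈ᵇ? A))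
              short = begin
                card n A                                                       ≡⟨ cong (λ z → card z A) (m+[n∸m]≡n (m≤n⇒m≤1+n r≤k)) ⟨
                card (r + (n ∸ r)) A                                           ≡⟨ Σ<-split r (n ∸ r) (λ t → 𝟙 (t ∈ᵇ? A)) ⟩
                card r A + Σ< (n ∸ r) (λ t → 𝟙 ((r + t) ∈ᵇ? A))                ≡⟨ cong (λ z → card r A + z) (Σ<-zero (n ∸ r) (λ t q → 𝟙-no ((r + t) ∈ᵇ? A)
                                                                                    (outside (r + t) (<-≤-trans (+-monoʳ-< r q) (≤-reflexive (m+[n∸m]≡n (m≤n⇒m≤1+n r≤k)))) (m≤m+n r t)))) ⟩
                card r A + 0                                                   ≡⟨ +-identityʳ _ ⟩
                card r A                                                       ∎
                where open ≡-Reasoning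
            A≡ : A i ≡ initial r i
            A≡ with <-≤-connex i r
            ... | inj₁ i<r = trans (full i i<r) (sym (proj₂ (∈initial r i) i<r))
            ... | inj₂ r≤i with false⊎true (A i) | false⊎true (initial r i)
            ...   | inj₂ e | _ = ⊥-elim (outside i i<n r≤i e)
            ...   | inj₁ _ | inj₂ e = ⊥-elim (<⇒≱ (proj₁ (∈initial r i) e) r≤i)
            ...   | inj₁ o | inj₁ o′ = trans o (sym o′)

        c : (ℕ → Bool) → ℤ
        c A = coefficient (ρ rectP window N≤v₀ r≤k A) r (card n A)

        summand : Partition → Partition → (ℕ → Bool) → Poly k
        summand P Q A = c A •P (g (P ∪ μ A) *P g Q)

        -- The coefficients are rewritten as those belonging to `rectP`, so that both expansions,
        -- for `P` and for `Q`, carry identical coefficients and only the products differ.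
        product : ∀ {P F} (rect : Rectangular k P F) (Q : Partition) →
          (∀ {A} → Pr.Good A → ρ rect window N≤v₀ r≤k A ≡ ρ rectP window N≤v₀ r≤k A) →
          hP k r *P (g (P ∪ ν) *P g Q) ≈P sumP (map (summand P Q) (moves k idx r))
        product {P} rect Q same-ρ e = trans (sym (*P-assoc (hP k r) (g (P ∪ ν)) (g Q) e))
          (trans (*P-cong {f = hP k r *P g (P ∪ ν)} {g = g Q} expand (λ _ → refl) e)
          (trans (sumP-*P (map (λ A → coefficient (ρ rect window N≤v₀ r≤k A) r (card n A) •P g (P ∪ μ A)) (moves k idx r)) (g Q) e)
          (trans (cong (λ fs → sumP fs e) (sym (map-∘ (moves k idx r))))
                 (sumP-cong (moves k idx r) (λ {A} A∈ e → trans (*P-•ˡ (coefficient (ρ rect window N≤v₀ r≤k A) r (card n A)) (g (P ∪ μ A)) (g Q) e)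
                   (cong (λ z → coefficient z r (card n A) ℤ.* (g (P ∪ μ A) *P g Q) e) (same-ρ (All.lookup Pr.good-moves A∈)))) e))))
          where
          expand : hP k r *P g (P ∪ ν) ≈P sumP (map (λ A → coefficient (ρ rect window N≤v₀ r≤k A) r (card n A) •P g (P ∪ μ A)) (moves k idx r))
          expand e = trans (cong (λ κ → (hP k r *P g (P ∪ κ)) e) (sym 𝔭≡)) (pieri rect window N≤v₀ r≤k e)

        conclude : Proportional (r ∷ ν)
        conclude e = trans (sym (leading P Q)) (trans
          (sum-single-out {R = Differ n} (λ A → summand P Q A e) (λ A → summand Q P A e) (moves k idx r)
            (AllPairsₚ.filter⁺ (goodMove? k idx r) (subsets-distinct n)) A₀∈ others sums)
          (leading Q P))
          where
          -- At full size `r` the lower entry of the binomial is 0, so the coefficient is 1 whatever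
          -- the number of corners; no division is required to isolate this term.
          c₀ : c A₀ ≡ ℤ.1ℤ
          c₀ = trans (cong (coefficient (ρ rectP window N≤v₀ r≤k A₀) r) card-A₀) (cong (λ d → sign d ℤ.* (ℤ.+_ (ρ rectP window N≤v₀ r≤k A₀ C d))) (n∸n≡0 r))
          leading : ∀ P Q → summand P Q A₀ e ≡ (g (P ∪ (r ∷ ν)) *P g Q) e
          leading P Q = trans (cong₂ ℤ._*_ c₀ (cong (λ κ → (g (P ∪ κ) *P g Q) e) μ-A₀)) (ℤₚ.*-identityˡ _)
          others : ∀ {A} → A ∈ moves k idx r → Differ n A₀ A ⊎ Differ n A A₀ → summand P Q A e ≡ summand Q P A e
          others {A} A∈ d = cong (λ z → c A ℤ.* z) (ih (μ A) (Pr.InPk-target good) (other-smaller good (orient d)) e)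
            where
            good : Pr.Good A
            good = All.lookup Pr.good-moves A∈
            orient : Differ n A₀ A ⊎ Differ n A A₀ → Differ n A₀ A
            orient (inj₁ d) = d
            orient (inj₂ (i , i<n , ne)) = i , i<n , ne ∘ sym
          same-ρ : ∀ {A} → Pr.Good A → ρ rectQ window N≤v₀ r≤k A ≡ ρ rectP window N≤v₀ r≤k A
          same-ρ {A} good = sym (rr-invariant window A (Pr.proper good) (valid good) 1≤v₀ (Rectangular.monotone rectP) (Rectangular.monotone rectQ) same)
          sums : sumℤ (map (λ A → summand P Q A e) (moves k idx r)) ≡ sumℤ (map (λ A → summand Q P A e) (moves k idx r))
          sums = begin
            sumℤ (map (λ A → summand P Q A e) (moves k idx r))      ≡⟨ sumP-sumℤ (summand P Q) (moves k idx r) e ⟨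
            sumP (map (summand P Q) (moves k idx r)) e              ≡⟨ product rectP Q (λ _ → refl) e ⟨
            (hP k r *P (g (P ∪ ν) *P g Q)) e                        ≡⟨ *P-cong {f = hP k r} {g = g (P ∪ ν) *P g Q} (λ _ → refl) (ih ν in-ν ν-smaller) e ⟩
            (hP k r *P (g (Q ∪ ν) *P g P)) e                        ≡⟨ product rectQ P same-ρ e ⟩
            sumP (map (summand Q P) (moves k idx r)) e              ≡⟨ sumP-sumℤ (summand Q P) (moves k idx r) e ⟩
            sumℤ (map (λ A → summand Q P A e) (moves k idx r))      ∎
            where open ≡-Reasoning

    proportional : ∀ d μ → InPk k μ → measure μ < d → Proportional μ
    proportional (suc d) [] _ _ e = begin
      (g (P ∪ []) *P g Q) e   ≡⟨ cong (λ κ → (g κ *P g Q) e) (∪-[] (Rectangular.isPartition rectP)) ⟩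
      (g P *P g Q) e          ≡⟨ *P-comm (g P) (g Q) e ⟩
      (g Q *P g P) e          ≡⟨ cong (λ κ → (g κ *P g P) e) (∪-[] (Rectangular.isPartition rectQ)) ⟨
      (g (Q ∪ []) *P g P) e   ∎
      where open ≡-Reasoning
    proportional (suc d) (r ∷ ν) in-λ q =
      step.conclude in-λ (λ μ in-μ smaller → proportional d μ in-μ (<-≤-trans smaller (≤-pred q)))

theorem3p6 : (k m : ℕ) → 1 ≤ k → 1 ≤ m →
    (t : Fin m → ℕ) → (∀ i → 1 ≤ t i × t i ≤ k) → (∀ i j → t i ≡ t j → i ≡ j) →
    (a : Fin m → ℕ) → (∀ i → 1 ≤ a i) →
    (g : Partition → Poly k) → IsKkSchur k g →
    (λ′ : Partition) → InPk k λ′ →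
    let P = ⋃ (tabulate (λ i → Rpow k (t i) (a i)))
        Q = ⋃ (tabulate (λ i → R k (t i)))
    in g (P ∪ λ′) *P g Q ≈P g (Q ∪ λ′) *P g P
theorem3p6 k m _ _ t t-range _ a a≥1 g schur λ′ in-λ =
  -- `R k t` is `Rpow k t 1`, so `Q` is the same family of rectangles with all multiplicities equal
  -- to 1.
  proportional schur (rectangles-rectangular k t a t-range) (rectangles-rectangular k t (λ _ → 1) t-range)
    (height-same t a (λ _ → 1) a≥1 (λ _ → ≤-refl)) _ λ′ in-λ ≤-refl
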